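{- There exists an algorithm that, given an instance $(Q,A,b)$ of Integer Quadratic Programming, runs in time $f(n,\alpha)\,L^{O(1)}$ for some computable function $f$, and outputs a vector $x \in \mathbb{Z}^n$ with the following guarantees: if the instance has a feasible solution then $x$ is feasible, and if the instance is not unbounded then $x$ is an optimal solution.
   Context: Integer Quadratic Programming: the input is an $n\times n$ integer symmetric matrix $Q$, an $m\times n$ integer matrix $A$ and an $m$-dimensional integer vector $b$; the task is to minimize $x^TQx$ subject to $Ax\le b$, $x\in\mathbb{Z}^n$. A vector $x\in\mathbb{Z}^n$ with $Ax\le b$ is a feasible solution. The instance is unbounded if for every integer $\beta$ there is a feasible $x$ with $x^TQx\le\beta$. $\alpha$ denotes the maximum absolute value of an entry of $Q$ and $A$, and $L$ is the total number of bits in the encoding of the input.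
   Formalization: The second guarantee is stated for instances that have a feasible solution: if the instance is feasible and not unbounded then x is optimal; an infeasible instance is literally not unbounded but has no optimal solution. -}

module Defs where

open import Data.Bool using (Bool; true; false)
open import Data.Fin using (Fin; zero)
open import Data.Integer as ℤ using (ℤ; +_; -[1+_]; ∣_∣)
open import Data.List as List using (List; []; _∷_)
open import Data.Nat using (ℕ; zero; suc; _+_; _≤_; _⊔_)
open import Data.Product using (Σ-syntax; ∃-syntax; _×_)
open import Data.Vec as Vec using (Vec; []; _∷_; lookup; _[_]≔_; replicate; toList)
open import Data.Vec.Relation.Binary.Pointwise.Inductive using (Pointwise)
open import Relation.Binary.PropositionalEquality using (_≡_)

Matrix : ℕ → ℕ → Set
Matrix m n = Vec (Vec ℤ n) m

_·_ : ∀ {n} → Vec ℤ n → Vec ℤ n → ℤ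
u · v = Vec.foldr (λ _ → ℤ) ℤ._+_ (+ 0) (Vec.zipWith ℤ._*_ u v)

_*ᵥ_ : ∀ {m n} → Matrix m n → Vec ℤ n → Vec ℤ m
M *ᵥ x = Vec.map (_· x) M

Symmetric : ∀ {n} → Matrix n n → Set
Symmetric {n} M = (i j : Fin n) → lookup (lookup M i) j ≡ lookup (lookup M j) i

record Instance (n m : ℕ) : Set where
  field
    Q     : Matrix n n
    Q-sym : Symmetric Q
    A     : Matrix m n
    b     : Vec ℤ m

module _ {n m : ℕ} (I : Instance n m) where
  open Instance I

  objective : Vec ℤ n → ℤ
  objective x = x · (Q *ᵥ x)

  Feasible : Vec ℤ n → Set
  Feasible x = Pointwise ℤ._≤_ (A *ᵥ x) b

  HasFeasible : Set
  HasFeasible = ∃[ x ] Feasible x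

  Unbounded : Set
  Unbounded = (β : ℤ) → ∃[ x ] (Feasible x × objective x ℤ.≤ β)

  Optimal : Vec ℤ n → Set
  Optimal x = Feasible x × (∀ y → Feasible y → objective x ℤ.≤ objective y)

maxAbs : ∀ {m n} → Matrix m n → ℕ
maxAbs M = Vec.foldr (λ _ → ℕ) _⊔_ 0
             (Vec.map (λ r → Vec.foldr (λ _ → ℕ) _⊔_ 0 (Vec.map ∣_∣ r)) M)

-- The maximum over an empty set of entries is 0.
α : ∀ {n m} → Instance n m → ℕ
α I = maxAbs (Instance.Q I) ⊔ maxAbs (Instance.A I)

-- Model of computation: Jones' WHILE language over binary trees
-- (N. D. Jones, "Computability and Complexity from a Programming
-- Perspective"), with a fixed finite number k of variables per program.
-- With unit cost per operation (trees are shared, so copying a variable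
-- is copying a pointer) it is polynomial-time equivalent to Turing machines.

data Tree : Set where
  nil : Tree
  _∙_ : Tree → Tree → Tree

infixr 5 _∙_

-- As in Lisp, the head and tail of nil are nil.
head tail : Tree → Tree
head nil     = nil
head (l ∙ r) = l
tail nil     = nil
tail (l ∙ r) = r

data Expr (k : ℕ) : Set where
  var  : Fin k → Expr k
  nil  : Expr k
  cons : Expr k → Expr k → Expr k
  hd   : Expr k → Expr k
  tl   : Expr k → Expr k

data Cmd (k : ℕ) : Set where
  skip          : Cmd k
  _:=_          : Fin k → Expr k → Cmd k
  _⨾_           : Cmd k → Cmd k → Cmd k
  if_then_else_ : Expr k → Cmd k → Cmd k → Cmd k
  while_loop_   : Expr k → Cmd k → Cmd k

infix  6 _:=_
infixr 5 _⨾_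
infix  4 if_then_else_ while_loop_

Store : ℕ → Set
Store k = Vec Tree k

eval : ∀ {k} → Expr k → Store k → Tree
eval (var i)    s = lookup s i
eval nil        s = nil
eval (cons d e) s = eval d s ∙ eval e s
eval (hd e)     s = head (eval e s)
eval (tl e)     s = tail (eval e s)

cost : ∀ {k} → Expr k → ℕ
cost (var i)    = 1
cost nil        = 1
cost (cons d e) = suc (cost d + cost e)
cost (hd e)     = suc (cost e)
cost (tl e)     = suc (cost e)

-- c ∶ s ⇓ s′ [ t ]: started in store s, the command c terminates in store s′
-- after exactly t steps.  A test succeeds when its value is not nil.
data _∶_⇓_[_] {k : ℕ} : Cmd k → Store k → Store k → ℕ → Set where
  ⇓-skip   : ∀ {s} → skip ∶ s ⇓ s [ 1 ]
  ⇓-assign : ∀ {i e s} →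
             (i := e) ∶ s ⇓ (s [ i ]≔ eval e s) [ suc (cost e) ]
  ⇓-seq    : ∀ {c d s s′ s″ t u} →
             c ∶ s ⇓ s′ [ t ] → d ∶ s′ ⇓ s″ [ u ] →
             (c ⨾ d) ∶ s ⇓ s″ [ t + u ]
  ⇓-then   : ∀ {e c d s s′ t l r} → eval e s ≡ l ∙ r →
             c ∶ s ⇓ s′ [ t ] →
             (if e then c else d) ∶ s ⇓ s′ [ suc (cost e) + t ]
  ⇓-else   : ∀ {e c d s s′ t} → eval e s ≡ nil →
             d ∶ s ⇓ s′ [ t ] →
             (if e then c else d) ∶ s ⇓ s′ [ suc (cost e) + t ]
  ⇓-stop   : ∀ {e c s} → eval e s ≡ nil →
             (while e loop c) ∶ s ⇓ s [ suc (cost e) ]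
  ⇓-loop   : ∀ {e c s s′ s″ t u l r} → eval e s ≡ l ∙ r →
             c ∶ s ⇓ s′ [ t ] → (while e loop c) ∶ s′ ⇓ s″ [ u ] →
             (while e loop c) ∶ s ⇓ s″ [ suc (cost e) + (t + u) ]

-- Variable 0 holds the input at the start and the output at the end; all other
-- variables start as nil.
record Program : Set where
  field
    extraVars : ℕ
    body      : Cmd (suc extraVars)

Run : Program → Tree → Tree → ℕ → Set
Run p input output t =
  ∃[ s ] ((body ∶ (input ∷ replicate extraVars nil) ⇓ s [ t ]) × lookup s zero ≡ output)
  where open Program p

RunsWithin : Program → Tree → Tree → ℕ → Set
RunsWithin p input output bound = ∃[ t ] (t ≤ bound × Run p input output t)

increment : List Bool → List Bool
increment []           = true ∷ []
increment (false ∷ bs) = true ∷ bs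
increment (true  ∷ bs) = false ∷ increment bs

-- The binary numeral without leading zeros, least significant bit first; the
-- numeral of 0 is the single bit 0.
bits : ℕ → List Bool
bits zero    = false ∷ []
bits (suc n) = increment (bits n)

encodeBool : Bool → Tree
encodeBool false = nil
encodeBool true  = nil ∙ nil

encodeList : {X : Set} → (X → Tree) → List X → Tree
encodeList enc = List.foldr (λ x t → enc x ∙ t) nil

encodeℕ : ℕ → Tree
encodeℕ n = encodeList encodeBool (bits n)

isNegative : ℤ → Bool
isNegative (+ _)    = false
isNegative -[1+ _ ] = true

encodeℤ : ℤ → Tree
encodeℤ z = encodeBool (isNegative z) ∙ encodeℕ ∣ z ∣

encodeVec : ∀ {n} → Vec ℤ n → Tree
encodeVec v = encodeList encodeℤ (toList v)

encodeMatrix : ∀ {m n} → Matrix m n → Tree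
encodeMatrix M = encodeList encodeVec (toList M)

encode : ∀ {n m} → Instance n m → Tree
encode {n} {m} I =
  encodeℕ n ∙ encodeℕ m ∙ encodeMatrix Q ∙ encodeMatrix A ∙ encodeVec b
  where open Instance I

sizeℕ : ℕ → ℕ
sizeℕ n = List.length (bits n)

sizeℤ : ℤ → ℕ
sizeℤ z = suc (sizeℕ ∣ z ∣)

sizeVec : ∀ {n} → Vec ℤ n → ℕ
sizeVec v = Vec.sum (Vec.map sizeℤ v)

sizeMatrix : ∀ {m n} → Matrix m n → ℕ
sizeMatrix M = Vec.sum (Vec.map sizeVec M)

-- The number of bits (binary digits and sign bits) in encode I.  It is always
-- at least 2, and the number of nodes of encode I is linear in it.
L : ∀ {n m} → Instance n m → ℕ
L {n} {m} I = sizeℕ n + sizeℕ m + sizeMatrix Q + sizeMatrix A + sizeVec b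
  where open Instance I

Computable₂ : (ℕ → ℕ → ℕ) → Set
Computable₂ f =
  Σ[ p ∈ Program ] (∀ a b → ∃[ t ] Run p (encodeℕ a ∙ encodeℕ b) (encodeℕ (f a b)) t)

{-# OPTIONS --safe #-}
module Submission where

-- Let β(a) be the least right-hand side of a row equal to a.  If the instance is
-- feasible (and bounded), then some feasible (optimal) x has the form
-- d x = v + Σₖ β(aₖ) cₖ with n rows aₖ and with d, v, cₖ bounded in terms of n and α
-- only, so it suffices to try all such x and to keep the best feasible one.
--
-- To find this form, maintain d x = v + Σ β(aₖ) cₖ + Σ yᵢ gᵢ, starting from the unit
-- vectors gᵢ, and remove one direction g at a time: an equation h · x = ε β(a) + s
-- with small h, s and h · g ≠ 0 lets one eliminate g.  If a constraint not parallel to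
-- g is nearly tight at x, use its row.  Otherwise x ± g are feasible, so either one of
-- them improves x, or |2 g·Qx| ≤ g·Qg, which is an equation with h = Qg when
-- g·Qg ≠ 0.  If g·Qg = 0, the objective is constant along g: walk along g until a
-- constraint is nearly tight or, if none ever is, until 0 ≤ g·x < g·g.  Improvements
-- can be repeated until any prescribed bound is passed, which makes the argument
-- constructive.
--
-- The enumeration depends on n and α only, and so does its running time τ.  The
-- computable factor is f(n, α) = 2 ^ (C τ): its binary numeral is written by a clocked
-- copy of the enumeration that emits C zeros per step.

open import Data.Bool using (true; false)
open import Data.Empty using (⊥-elim)
open import Data.Fin using (Fin; zero; suc)
open import Data.Fin.Properties using (any?)
open import Data.Integer as ℤ using (ℤ; +_; -[1+_]; ∣_∣; 0ℤ; 1ℤ; -1ℤ)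
import Data.Integer.DivMod as ℤ
import Data.Integer.Properties as ℤₚ
import Data.Integer.Tactic.RingSolver as ℤ-Ring
open import Data.List as List using ([]; _∷_)
open import Data.Maybe using (Maybe; just; nothing)
open import Data.Nat using (ℕ; zero; suc; _+_; _*_; _^_; _≤_; _<_; _⊔_; z≤n; s≤s; NonZero; >-nonZero; _≤′_; ≤′-refl; ≤′-step)
open import Data.Nat.DivMod using (_/_; _%_; m≡m%n+[m/n]*n; m%n<n; m<n*o⇒m/o<n)
open import Data.Nat.Properties
open import Data.Nat.Tactic.RingSolver using (solve-∀)
open import Data.Product using (Σ-syntax; ∃-syntax; _×_; _,_; proj₁; proj₂)
open import Data.Sum using (_⊎_; inj₁; inj₂; [_,_]′)
open import Data.Vec as Vec using (Vec; []; _∷_; lookup; tabulate; _[_]≔_)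
open import Data.Vec.Functional using () renaming (_∷_ to _◂_)
open import Data.Vec.Properties using (lookup∘tabulate; tabulate∘lookup; tabulate-∘; lookup-map; lookup-replicate; ≡-dec; ∷-injectiveˡ; ∷-injectiveʳ)
open import Data.Vec.Relation.Binary.Pointwise.Inductive using (Pointwise; []; _∷_)
open import Data.Vec.Relation.Unary.All using (All; []; _∷_)
open import Function using (_∘_)
open import Relation.Binary.PropositionalEquality using (_≡_; _≢_; refl; sym; trans; cong; cong₂; subst; subst₂; module ≡-Reasoning)
open import Relation.Nullary using (¬_; Dec; yes; no; ¬?; _×-dec_; decidable-stable)
open import Defs

-- A functional language compiled to WHILE programs

-- Right-hand sides are indexed by the entries of a row and not by its position: the number of
-- constraints is not bounded in terms of `n` and `α`, but the number of possible rows is. The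
-- values `β(a)` are the only large numbers behind a candidate, and they are looked up in the
-- instance after the enumeration.
--
-- All coefficient bounds are powers of one `B` that is at least `n`, `α` and 2. Removing a
-- direction turns `B` into `B ^ 8`, so `n` removals give `B ^ (8 ^ n)`. For `B = 2 ^ (n + ℓ + 1)`,
-- with `ℓ` the bit length of `α`, this is `2 ^ κ n ℓ`.
--
-- No closed formula for the time of the enumeration is needed. In `τ` steps the size of a store,
-- plus 1, grows by a factor of at most `2 ^ τ`, and the rest of the algorithm is polynomial in the
-- instance and the list of candidates; so a power of `2 ^ τ` times a power of `L` bounds the whole.
-- Hence the enumeration is written in plain terms `Tm`, and everything else in terms `PTm` that
-- carry proofs of polynomial time and size.

mutual
  -- rec recurses along the spine of a list while transforming a parameter; its three
  -- bodies see the arguments of base, down and up in recTree before the ambient variables.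
  data Tm : ℕ → Set where
    var  : ∀ {k} → Fin k → Tm k
    nil  : ∀ {k} → Tm k
    cons : ∀ {k} → Tm k → Tm k → Tm k
    hd   : ∀ {k} → Tm k → Tm k
    tl   : ∀ {k} → Tm k → Tm k
    ite  : ∀ {k} → Tm k → Tm k → Tm k → Tm k
    call : ∀ {k j} → Tm j → Args k j → Tm k
    rec  : ∀ {k} → (list param : Tm k) (base : Tm (1 + k)) (down : Tm (3 + k)) (up : Tm (4 + k)) → Tm k

  data Args (k : ℕ) : ℕ → Set where
    []  : Args k 0
    _∷_ : ∀ {j} → Tm k → Args k j → Args k (suc j)

ifT : {X : Set} → Tree → X → X → X
ifT nil     x y = y
ifT (_ ∙ _) x y = x

recTree : (base : Tree → Tree) (down : Tree → Tree → Tree → Tree) (up : Tree → Tree → Tree → Tree → Tree) →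
          Tree → Tree → Tree
recTree base down up nil     s = base s
recTree base down up (a ∙ l) s = up (recTree base down up l (down a l s)) a l s

mutual
  ⟦_⟧ : ∀ {k} → Tm k → Vec Tree k → Tree
  ⟦ var i ⟧ ρ = lookup ρ i
  ⟦ nil ⟧ ρ = nil
  ⟦ cons t u ⟧ ρ = ⟦ t ⟧ ρ ∙ ⟦ u ⟧ ρ
  ⟦ hd t ⟧ ρ = head (⟦ t ⟧ ρ)
  ⟦ tl t ⟧ ρ = tail (⟦ t ⟧ ρ)
  ⟦ ite t u v ⟧ ρ = ifT (⟦ t ⟧ ρ) (⟦ u ⟧ ρ) (⟦ v ⟧ ρ)
  ⟦ call t us ⟧ ρ = ⟦ t ⟧ (⟦ us ⟧* ρ)
  ⟦ rec t u base down up ⟧ ρ =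
    recTree (λ s → ⟦ base ⟧ (s ∷ ρ)) (λ a l s → ⟦ down ⟧ (a ∷ l ∷ s ∷ ρ)) (λ r a l s → ⟦ up ⟧ (r ∷ a ∷ l ∷ s ∷ ρ))
            (⟦ t ⟧ ρ) (⟦ u ⟧ ρ)

  ⟦_⟧* : ∀ {k j} → Args k j → Vec Tree k → Vec Tree j
  ⟦ [] ⟧* ρ = []
  ⟦ t ∷ ts ⟧* ρ = ⟦ t ⟧ ρ ∷ ⟦ ts ⟧* ρ

envTree : ∀ {k} → Vec Tree k → Tree
envTree []      = nil
envTree (x ∷ ρ) = x ∙ envTree ρ

-- Calling convention of compiled code: `X′` holds the environment on entry and the value on exit,
-- and the stack in `S′` is handed back unchanged. This makes pieces of code composable.
X′ S′ : Fin 2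
X′ = zero
S′ = suc zero

xE sE : Expr 2
xE = var X′
sE = var S′

varE : ∀ {k} → Fin k → Expr 2 → Expr 2
varE zero    e = hd e
varE (suc i) e = varE i (tl e)

pairCmd : Cmd 2 → Cmd 2 → Cmd 2
pairCmd c d =
  S′ := cons xE sE ⨾ c ⨾ S′ := cons xE sE ⨾ X′ := hd (tl sE) ⨾ d ⨾
  X′ := cons (hd sE) xE ⨾ S′ := tl (tl sE)

iteCmd : Cmd 2 → Cmd 2 → Cmd 2 → Cmd 2
iteCmd b c d =
  S′ := cons xE sE ⨾ b ⨾ S′ := cons xE sE ⨾ X′ := hd (tl sE) ⨾
  (if hd sE then (S′ := tl (tl sE) ⨾ c) else (S′ := tl (tl sE) ⨾ d))

-- The descent runs with X′ = l ∙ s ∙ K and S′ = env ∙ S, where K stacks the pairs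
-- l ∙ s of the pending calls; the ascent runs with X′ = r and S′ = K ∙ env ∙ S.
downCmd upCmd : Cmd 2 → Cmd 2
downCmd c =
  S′ := cons xE sE ⨾
  X′ := cons (hd (hd (hd sE))) (cons (tl (hd (hd sE))) (cons (hd (tl (hd sE))) (hd (tl sE)))) ⨾
  c ⨾
  X′ := cons (tl (hd (hd sE))) (cons xE (cons (cons (hd (hd sE)) (hd (tl (hd sE)))) (tl (tl (hd sE))))) ⨾
  S′ := tl sE
upCmd c =
  X′ := cons xE (cons (hd (hd (hd (hd sE)))) (cons (tl (hd (hd (hd sE)))) (cons (tl (hd (hd sE))) (hd (tl sE))))) ⨾
  c ⨾
  S′ := cons (tl (hd sE)) (tl sE)

recCmd : Cmd 2 → Cmd 2 → Cmd 2 → Cmd 2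
recCmd base down up =
  (while hd xE loop downCmd down) ⨾
  S′ := cons (tl (tl xE)) sE ⨾
  X′ := cons (hd (tl xE)) (hd (tl sE)) ⨾
  base ⨾
  (while hd sE loop upCmd up) ⨾
  S′ := tl (tl sE)

mutual
  compile : ∀ {k} → Tm k → Cmd 2
  compile (var i) = X′ := varE i xE
  compile nil = X′ := nil
  compile (cons t u) = pairCmd (compile t) (compile u)
  compile (hd t) = compile t ⨾ X′ := hd xE
  compile (tl t) = compile t ⨾ X′ := tl xE
  compile (ite t u v) = iteCmd (compile t) (compile u) (compile v)
  compile (call t us) = compile* us ⨾ compile t
  compile (rec t u base down up) =
    S′ := cons xE sE ⨾ pairCmd (compile t) (compile u) ⨾
    X′ := cons (hd xE) (cons (tl xE) nil) ⨾
    recCmd (compile base) (compile down) (compile up)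

  compile* : ∀ {k j} → Args k j → Cmd 2
  compile* [] = X′ := nil
  compile* (t ∷ ts) = pairCmd (compile t) (compile* ts)

-- The constants are the exact costs of the bookkeeping (`S′ := cons xE sE`, for instance, takes 4
-- steps), because the evaluation relation records the exact number of steps.
pairTime iteTime downTime upTime : ℕ → ℕ → ℕ
pairTime t u = 4 + (t + (4 + (4 + (u + (5 + 4)))))
iteTime b c = 4 + (b + (4 + (4 + (3 + (4 + c)))))
downTime c rest = 3 + ((4 + (19 + (c + (21 + 3)))) + rest)
upTime c rest = 3 + ((23 + (c + 7)) + rest)

downTimes : (down : Tree → Tree → Tree → Tree) (time : Tree → Tree → Tree → ℕ) → Tree → Tree → ℕ
downTimes down time nil     s = 3
downTimes down time (a ∙ l) s = downTime (time a l s) (downTimes down time l (down a l s))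

baseTimes : (down : Tree → Tree → Tree → Tree) (time : Tree → ℕ) → Tree → Tree → ℕ
baseTimes down time nil     s = time s
baseTimes down time (a ∙ l) s = baseTimes down time l (down a l s)

-- The ascent handles the innermost frame first, whereas the recursion starts at the outermost one;
-- the time of the iterations still to come is therefore passed along as `rest`.
upTimes : (base : Tree → Tree) (down : Tree → Tree → Tree → Tree) (up : Tree → Tree → Tree → Tree → Tree)
          (time : Tree → Tree → Tree → Tree → ℕ) → Tree → Tree → ℕ → ℕ
upTimes base down up time nil     s rest = rest
upTimes base down up time (a ∙ l) s rest =
  upTimes base down up time l (down a l s) (upTime (time (recTree base down up l (down a l s)) a l s) rest)

mutual
  time : ∀ {k} → Tm k → Vec Tree k → ℕ
  time (var i) ρ = suc (cost (varE i xE))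
  time nil ρ = 2
  time (cons t u) ρ = pairTime (time t ρ) (time u ρ)
  time (hd t) ρ = time t ρ + 3
  time (tl t) ρ = time t ρ + 3
  time (ite t u v) ρ = iteTime (time t ρ) (ifT (⟦ t ⟧ ρ) (time u ρ) (time v ρ))
  time (call t us) ρ = time* us ρ + time t (⟦ us ⟧* ρ)
  time (rec t u base down up) ρ =
    let ⟦b⟧ = λ s → ⟦ base ⟧ (s ∷ ρ)
        ⟦d⟧ = λ a l s → ⟦ down ⟧ (a ∷ l ∷ s ∷ ρ)
        ⟦u⟧ = λ r a l s → ⟦ up ⟧ (r ∷ a ∷ l ∷ s ∷ ρ)
    in 4 + (pairTime (time t ρ) (time u ρ) + (8 +
       (downTimes ⟦d⟧ (λ a l s → time down (a ∷ l ∷ s ∷ ρ)) (⟦ t ⟧ ρ) (⟦ u ⟧ ρ) + (6 + (8 +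
       (baseTimes ⟦d⟧ (λ s → time base (s ∷ ρ)) (⟦ t ⟧ ρ) (⟦ u ⟧ ρ) +
       (upTimes ⟦b⟧ ⟦d⟧ ⟦u⟧ (λ r a l s → time up (r ∷ a ∷ l ∷ s ∷ ρ)) (⟦ t ⟧ ρ) (⟦ u ⟧ ρ) 3
        + 4)))))))

  time* : ∀ {k j} → Args k j → Vec Tree k → ℕ
  time* [] ρ = 2
  time* (t ∷ ts) ρ = pairTime (time t ρ) (time* ts ρ)

eval-varE : ∀ {k} (i : Fin k) (ρ : Vec Tree k) (e : Expr 2) (s : Store 2) → eval e s ≡ envTree ρ →
            eval (varE i e) s ≡ lookup ρ i
eval-varE zero    (x ∷ ρ) e s eq = cong head eq
eval-varE (suc i) (x ∷ ρ) e s eq = eval-varE i ρ (tl e) s (cong tail eq)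

run-pair : ∀ {c d x S y z t u} → (∀ S → c ∶ x ∷ S ∷ [] ⇓ y ∷ S ∷ [] [ t ]) → (∀ S → d ∶ x ∷ S ∷ [] ⇓ z ∷ S ∷ [] [ u ]) →
           pairCmd c d ∶ x ∷ S ∷ [] ⇓ (y ∙ z) ∷ S ∷ [] [ pairTime t u ]
run-pair c⇓ d⇓ = ⇓-seq ⇓-assign (⇓-seq (c⇓ _) (⇓-seq ⇓-assign (⇓-seq ⇓-assign
                   (⇓-seq (d⇓ _) (⇓-seq ⇓-assign ⇓-assign)))))

run-ite : ∀ {b c d x S} y {z w t u v} → (∀ S → b ∶ x ∷ S ∷ [] ⇓ y ∷ S ∷ [] [ t ]) →
          (∀ S → c ∶ x ∷ S ∷ [] ⇓ z ∷ S ∷ [] [ u ]) → (∀ S → d ∶ x ∷ S ∷ [] ⇓ w ∷ S ∷ [] [ v ]) →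
          iteCmd b c d ∶ x ∷ S ∷ [] ⇓ ifT y z w ∷ S ∷ [] [ iteTime t (ifT y u v) ]
run-ite nil b⇓ c⇓ d⇓ = ⇓-seq ⇓-assign (⇓-seq (b⇓ _) (⇓-seq ⇓-assign (⇓-seq ⇓-assign
                         (⇓-else refl (⇓-seq ⇓-assign (d⇓ _))))))
run-ite (_ ∙ _) b⇓ c⇓ d⇓ = ⇓-seq ⇓-assign (⇓-seq (b⇓ _) (⇓-seq ⇓-assign (⇓-seq ⇓-assign
                         (⇓-then refl (⇓-seq ⇓-assign (c⇓ _))))))

module _ {cb cd cu : Cmd 2} (env : Tree)
         {base : Tree → Tree} {down : Tree → Tree → Tree → Tree} {up : Tree → Tree → Tree → Tree → Tree}
         {tb : Tree → ℕ} {td : Tree → Tree → Tree → ℕ} {tu : Tree → Tree → Tree → Tree → ℕ}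
         (cb⇓ : ∀ s S → cb ∶ (s ∙ env) ∷ S ∷ [] ⇓ base s ∷ S ∷ [] [ tb s ])
         (cd⇓ : ∀ a l s S → cd ∶ (a ∙ l ∙ s ∙ env) ∷ S ∷ [] ⇓ down a l s ∷ S ∷ [] [ td a l s ])
         (cu⇓ : ∀ r a l s S → cu ∶ (r ∙ a ∙ l ∙ s ∙ env) ∷ S ∷ [] ⇓ up r a l s ∷ S ∷ [] [ tu r a l s ]) where

  private
    baseArg : Tree → Tree → Tree
    baseArg nil     s = s
    baseArg (a ∙ l) s = baseArg l (down a l s)

    frames : Tree → Tree → Tree → Tree
    frames nil     s K = K
    frames (a ∙ l) s K = frames l (down a l s) (((a ∙ l) ∙ s) ∙ K)

    run-down : ∀ l s K S → (while hd xE loop downCmd cd) ∶ (l ∙ s ∙ K) ∷ (env ∙ S) ∷ [] ⇓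
                 (nil ∙ baseArg l s ∙ frames l s K) ∷ (env ∙ S) ∷ [] [ downTimes down td l s ]
    run-down nil s K S = ⇓-stop refl
    run-down (a ∙ l) s K S =
      ⇓-loop refl (⇓-seq ⇓-assign (⇓-seq ⇓-assign (⇓-seq (cd⇓ a l s _) (⇓-seq ⇓-assign ⇓-assign))))
             (run-down l (down a l s) (((a ∙ l) ∙ s) ∙ K) S)

    base-baseTimes : ∀ l s → tb (baseArg l s) ≡ baseTimes down tb l s
    base-baseTimes nil s = refl
    base-baseTimes (a ∙ l) s = base-baseTimes l (down a l s)

    -- Induction with a continuation: the premise is the run of the loop that remains once the
    -- frames of `l` have been popped.
    run-up : ∀ l s K S v rest →
      (while hd sE loop upCmd cu) ∶ recTree base down up l s ∷ (K ∙ env ∙ S) ∷ [] ⇓ v ∷ (nil ∙ env ∙ S) ∷ [] [ rest ] →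
      (while hd sE loop upCmd cu) ∶ base (baseArg l s) ∷ (frames l s K ∙ env ∙ S) ∷ [] ⇓ v ∷ (nil ∙ env ∙ S) ∷ []
        [ upTimes base down up tu l s rest ]
    run-up nil s K S v rest p = p
    run-up (a ∙ l) s K S v rest p =
      run-up l (down a l s) (((a ∙ l) ∙ s) ∙ K) S v _
        (⇓-loop refl (⇓-seq ⇓-assign (⇓-seq (cu⇓ _ a l s _) ⇓-assign)) p)

  run-rec : ∀ l s S → recCmd cb cd cu ∶ (l ∙ s ∙ nil) ∷ (env ∙ S) ∷ [] ⇓ recTree base down up l s ∷ S ∷ []
    [ downTimes down td l s + (6 + (8 + (baseTimes down tb l s + (upTimes base down up tu l s 3 + 4)))) ]
  run-rec l s S =
    ⇓-seq (run-down l s nil S) (⇓-seq ⇓-assign (⇓-seq ⇓-assign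
      (⇓-seq (subst (λ t → cb ∶ (baseArg l s ∙ env) ∷ (frames l s nil ∙ env ∙ S) ∷ [] ⇓
                                 base (baseArg l s) ∷ (frames l s nil ∙ env ∙ S) ∷ [] [ t ])
                     (base-baseTimes l s) (cb⇓ _ _))
        (⇓-seq (run-up l s nil S _ 3 (⇓-stop refl)) ⇓-assign))))

mutual
  run : ∀ {k} (t : Tm k) (ρ : Vec Tree k) (S : Tree) →
        compile t ∶ envTree ρ ∷ S ∷ [] ⇓ ⟦ t ⟧ ρ ∷ S ∷ [] [ time t ρ ]
  run (var i) ρ S =
    subst (λ x → (X′ := varE i xE) ∶ envTree ρ ∷ S ∷ [] ⇓ x ∷ S ∷ [] [ suc (cost (varE i xE)) ])
          (eval-varE i ρ xE (envTree ρ ∷ S ∷ []) refl) ⇓-assign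
  run nil ρ S = ⇓-assign
  run (cons t u) ρ S = run-pair (run t ρ) (run u ρ)
  run (hd t) ρ S = ⇓-seq (run t ρ S) ⇓-assign
  run (tl t) ρ S = ⇓-seq (run t ρ S) ⇓-assign
  run (ite t u v) ρ S = run-ite (⟦ t ⟧ ρ) (run t ρ) (run u ρ) (run v ρ)
  run (call t us) ρ S = ⇓-seq (run* us ρ S) (run t (⟦ us ⟧* ρ) S)
  run (rec t u base down up) ρ S =
    ⇓-seq ⇓-assign (⇓-seq (run-pair (run t ρ) (run u ρ)) (⇓-seq ⇓-assign
      (run-rec (envTree ρ) (λ s → run base (s ∷ ρ)) (λ a l s → run down (a ∷ l ∷ s ∷ ρ))
               (λ r a l s → run up (r ∷ a ∷ l ∷ s ∷ ρ)) (⟦ t ⟧ ρ) (⟦ u ⟧ ρ) S)))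

  run* : ∀ {k j} (ts : Args k j) (ρ : Vec Tree k) (S : Tree) →
         compile* ts ∶ envTree ρ ∷ S ∷ [] ⇓ envTree (⟦ ts ⟧* ρ) ∷ S ∷ [] [ time* ts ρ ]
  run* [] ρ S = ⇓-assign
  run* (t ∷ ts) ρ S = run-pair (run t ρ) (run* ts ρ)

-- Clocked execution and growth

ticks : ℕ → Tree → Tree
ticks zero    t = t
ticks (suc m) t = nil ∙ ticks m t

ticks-+ : ∀ m n t → ticks m (ticks n t) ≡ ticks (m + n) t
ticks-+ zero    n t = refl
ticks-+ (suc m) n t = cong (nil ∙_) (ticks-+ m n t)

shiftE : ∀ {k} → Expr k → Expr (suc k)
shiftE (var i)    = var (suc i)
shiftE nil        = nil
shiftE (cons d e) = cons (shiftE d) (shiftE e)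
shiftE (hd e)     = hd (shiftE e)
shiftE (tl e)     = tl (shiftE e)

eval-shiftE : ∀ {k} (e : Expr k) T s → eval (shiftE e) (T ∷ s) ≡ eval e s
eval-shiftE (var i)    T s = refl
eval-shiftE nil        T s = refl
eval-shiftE (cons d e) T s = cong₂ _∙_ (eval-shiftE d T s) (eval-shiftE e T s)
eval-shiftE (hd e)     T s = cong head (eval-shiftE e T s)
eval-shiftE (tl e)     T s = cong tail (eval-shiftE e T s)

module Clock (C : ℕ) where

  tickE : ∀ {k} → ℕ → Expr (suc k)
  tickE zero    = var zero
  tickE (suc m) = cons nil (tickE m)

  eval-tickE : ∀ {k} m T (s : Store k) → eval (tickE m) (T ∷ s) ≡ ticks m T
  eval-tickE zero    T s = refl
  eval-tickE (suc m) T s = cong (nil ∙_) (eval-tickE m T s)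

  tick : ∀ {k} → ℕ → Cmd (suc k)
  tick m = zero := tickE (C * m)

  -- Each step of the original command prepends `C` copies of `nil` to a new variable 0, while the
  -- steps spent on ticking are not ticked themselves. The number of ticks is thus exactly `C` times
  -- the original running time.
  clock : ∀ {k} → Cmd k → Cmd (suc k)
  clock skip = tick 1
  clock (i := e) = suc i := shiftE e ⨾ tick (suc (cost e))
  clock (c ⨾ d) = clock c ⨾ clock d
  clock (if e then c else d) =
    if shiftE e then (tick (suc (cost e)) ⨾ clock c) else (tick (suc (cost e)) ⨾ clock d)
  clock (while e loop c) = (while shiftE e loop (tick (suc (cost e)) ⨾ clock c)) ⨾ tick (suc (cost e))

  Clocked : ∀ {k} → Cmd (suc k) → Tree → Store k → Store k → ℕ → Set
  Clocked c T s s′ t = ∃[ u ] (c ∶ T ∷ s ⇓ ticks (C * t) T ∷ s′ [ u ])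

  run-tick : ∀ {k} m T (s : Store k) → Clocked (tick m) T s s m
  run-tick m T s = _ , subst (λ x → tick m ∶ T ∷ s ⇓ x ∷ s [ suc (cost (tickE (C * m))) ]) (eval-tickE (C * m) T s) ⇓-assign

  ticks-* : ∀ t u T → ticks (C * u) (ticks (C * t) T) ≡ ticks (C * (t + u)) T
  ticks-* t u T = trans (ticks-+ (C * u) (C * t) T)
    (cong (λ m → ticks m T) (trans (+-comm (C * u) (C * t)) (sym (*-distribˡ-+ C t u))))

  clocked-seq : ∀ {k c d T} {s s′ s″ : Store k} {t u} →
                Clocked c T s s′ t → Clocked d (ticks (C * t) T) s′ s″ u → Clocked (c ⨾ d) T s s″ (t + u)
  clocked-seq {c = c} {d} {T} {s} {_} {s″} {t} {u} (v , p) (w , q) =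
    v + w , subst (λ x → (c ⨾ d) ∶ T ∷ s ⇓ x ∷ s″ [ v + w ]) (ticks-* t u T) (⇓-seq p q)

  mutual
    clock-run : ∀ {k} {c : Cmd k} {s s′ t} → c ∶ s ⇓ s′ [ t ] → ∀ T → Clocked (clock c) T s s′ t
    clock-run ⇓-skip T = run-tick 1 T _
    clock-run (⇓-assign {i} {e} {s}) T =
      _ , ⇓-seq (subst (λ x → (suc i := shiftE e) ∶ T ∷ s ⇓ T ∷ (s [ i ]≔ x) [ suc (cost (shiftE e)) ])
                       (eval-shiftE e T s) ⇓-assign)
                (proj₂ (run-tick (suc (cost e)) T _))
    clock-run (⇓-seq p q) T = clocked-seq (clock-run p T) (clock-run q _)
    clock-run (⇓-then {e} {s = s} eq p) T =
      _ , ⇓-then (trans (eval-shiftE e T s) eq) (proj₂ (clocked-seq (run-tick (suc (cost e)) T s) (clock-run p _)))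
    clock-run (⇓-else {e} {s = s} eq p) T =
      _ , ⇓-else (trans (eval-shiftE e T s) eq) (proj₂ (clocked-seq (run-tick (suc (cost e)) T s) (clock-run p _)))
    clock-run p@(⇓-stop _) T = clock-while p T
    clock-run p@(⇓-loop _ _ _) T = clock-while p T

    clock-while : ∀ {k e} {c : Cmd k} {s s′ t} → (while e loop c) ∶ s ⇓ s′ [ t ] → ∀ T → Clocked (clock (while e loop c)) T s s′ t
    clock-while {e = e} {c} {s} {s′} {t} p T with clock-loop p T
    ... | t′ , eq , q = subst (Clocked (clock (while e loop c)) T s s′) (sym eq) (clocked-seq q (run-tick (suc (cost e)) _ s′))

    -- Inside the clocked loop only successful tests are ticked. The last, failing test is ticked
    -- behind the loop, so its cost is split off here.
    clock-loop : ∀ {k e} {c : Cmd k} {s s′ t} → (while e loop c) ∶ s ⇓ s′ [ t ] → ∀ T →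
      ∃[ t′ ] (t ≡ t′ + suc (cost e) × Clocked (while shiftE e loop (tick (suc (cost e)) ⨾ clock c)) T s s′ t′)
    clock-loop {e = e} {c} {s} (⇓-stop eq) T =
      0 , refl , _ , subst (λ x → (while shiftE e loop (tick (suc (cost e)) ⨾ clock c)) ∶ T ∷ s ⇓ ticks x T ∷ s [ suc (cost (shiftE e)) ])
        (sym (*-zeroʳ C)) (⇓-stop (trans (eval-shiftE e T s) eq))
    clock-loop {e = e} {c} {s} {s″} (⇓-loop {t = t} eq p q) T with clock-loop q (ticks (C * t) (ticks (C * suc (cost e)) T))
    ... | t′ , refl , u , q′ = suc (cost e) + (t + t′) , assoc (suc (cost e)) t t′ ,
          subst (λ x → ∃[ v ] ((while shiftE e loop (tick (suc (cost e)) ⨾ clock c)) ∶ T ∷ s ⇓ x ∷ s″ [ v ]))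
            (trans (cong (ticks (C * t′)) (ticks-* (suc (cost e)) t T))
              (trans (ticks-* (suc (cost e) + t) t′ T) (cong (λ x → ticks (C * x) T) (+-assoc (suc (cost e)) t t′))))
            (_ , ⇓-loop (trans (eval-shiftE e T s) eq) (⇓-seq (proj₂ (run-tick (suc (cost e)) T s)) (proj₂ (clock-run p _))) q′)
      where
      assoc : ∀ x y z → x + (y + (z + x)) ≡ x + (y + z) + x
      assoc = solve-∀

-- A bit weighs the same whether it is 0 or 1, so that bit strings weigh their length.
size : Tree → ℕ
size nil     = 0
size (l ∙ r) = (1 ⊔ size l) + size r

size-∙ : ∀ l r → size (l ∙ r) ≤ suc (size l + size r)
size-∙ l r = +-monoˡ-≤ (size r) (m⊔n≤m+n 1 (size l))

size-head : ∀ t → size (head t) ≤ size t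
size-head nil     = z≤n
size-head (l ∙ r) = ≤-trans (m≤n⊔m 1 (size l)) (m≤m+n _ (size r))

size-tail : ∀ t → size (tail t) ≤ size t
size-tail nil     = z≤n
size-tail (l ∙ r) = m≤n+m (size r) _

sizes : ∀ {k} → Vec Tree k → ℕ
sizes []      = 0
sizes (x ∷ ρ) = size x + sizes ρ

size-lookup : ∀ {k} (ρ : Vec Tree k) i → size (lookup ρ i) ≤ sizes ρ
size-lookup (x ∷ ρ) zero    = m≤m+n (size x) _
size-lookup (x ∷ ρ) (suc i) = ≤-trans (size-lookup ρ i) (m≤n+m _ (size x))

sizes-update : ∀ {k} (ρ : Vec Tree k) i x → sizes (ρ [ i ]≔ x) ≤ sizes ρ + size x
sizes-update (y ∷ ρ) zero x = ≤-trans (≤-reflexive (+-comm (size x) (sizes ρ))) (+-monoˡ-≤ (size x) (m≤n+m (sizes ρ) (size y)))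
sizes-update (y ∷ ρ) (suc i) x =
  ≤-trans (+-monoʳ-≤ (size y) (sizes-update ρ i x)) (≤-reflexive (sym (+-assoc (size y) (sizes ρ) (size x))))

size-eval : ∀ {k} (e : Expr k) s → size (eval e s) ≤ cost e * suc (sizes s)
size-eval (var i) s = ≤-trans (size-lookup s i) (≤-trans (n≤1+n _) (m≤m+n _ 0))
size-eval nil s = z≤n
size-eval (cons d e) s = ≤-trans (size-∙ (eval d s) (eval e s)) (s≤s (≤-trans
  (+-mono-≤ (size-eval d s) (size-eval e s))
  (≤-trans (≤-reflexive (sym (*-distribʳ-+ (suc (sizes s)) (cost d) (cost e)))) (m≤n+m _ (sizes s)))))
size-eval (hd e) s = ≤-trans (size-head (eval e s)) (≤-trans (size-eval e s) (m≤n+m _ (suc (sizes s))))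
size-eval (tl e) s = ≤-trans (size-tail (eval e s)) (≤-trans (size-eval e s) (m≤n+m _ (suc (sizes s))))

n<2^n : ∀ n → n < 2 ^ n
n<2^n zero    = s≤s z≤n
n<2^n (suc n) = ≤-trans (≤-reflexive (sym (+-comm (suc n) 1)))
  (+-mono-≤ (n<2^n n) (≤-trans (≤-trans (s≤s z≤n) (n<2^n n)) (m≤m+n (2 ^ n) 0)))

2^-trans : ∀ {a b c} t u → b ≤ 2 ^ t * a → c ≤ 2 ^ u * b → c ≤ 2 ^ (t + u) * a
2^-trans {a} t u p q = ≤-trans q (≤-trans (*-monoʳ-≤ (2 ^ u) p)
  (≤-reflexive (trans (sym (*-assoc (2 ^ u) (2 ^ t) a))
    (cong (_* a) (trans (*-comm (2 ^ u) (2 ^ t)) (sym (^-distribˡ-+-* 2 t u)))))))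

≤-2^* : ∀ a t → a ≤ 2 ^ t * a
≤-2^* a t = m≤n*m a (2 ^ t) ⦃ m^n≢0 2 t ⦄

-- An assignment with an expression of cost `c` multiplies the size plus 1 by at most `1 + c`, which
-- is below `2 ^ (1 + c)`, and it takes `1 + c` steps. The exponential is genuine: since trees are
-- shared, `cons x x` doubles a nonempty tree in constant time.
growth : ∀ {k} {c : Cmd k} {s s′ t} → c ∶ s ⇓ s′ [ t ] → suc (sizes s′) ≤ 2 ^ t * suc (sizes s)
growth {s = s} ⇓-skip = ≤-2^* _ 1
growth (⇓-assign {i} {e} {s}) = ≤-trans (s≤s (sizes-update s i (eval e s)))
  (≤-trans (+-monoʳ-≤ (suc (sizes s)) (size-eval e s))
    (*-monoˡ-≤ (suc (sizes s)) (<⇒≤ (n<2^n (suc (cost e))))))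
growth (⇓-seq {t = t} {u} p q) = 2^-trans t u (growth p) (growth q)
growth (⇓-then {e} {t = t} _ p) = 2^-trans (suc (cost e)) t (≤-2^* _ (suc (cost e))) (growth p)
growth (⇓-else {e} {t = t} _ p) = 2^-trans (suc (cost e)) t (≤-2^* _ (suc (cost e))) (growth p)
growth (⇓-stop {e} _) = ≤-2^* _ (suc (cost e))
growth (⇓-loop {e} {t = t} {u} _ p q) =
  2^-trans (suc (cost e)) (t + u) (≤-2^* _ (suc (cost e))) (2^-trans t u (growth p) (growth q))

-- Polynomial time and size bounds

-- A single exponent describes the bound: as the base is at least 2, constants, sums and products
-- are absorbed by raising the exponent.
record PolyBounded {k} (g : Vec Tree k → ℕ) : Set where
  constructor polyBounded
  field
    degree : ℕ
    bound  : ∀ ρ → g ρ ≤ (2 + sizes ρ) ^ degree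
open PolyBounded

module _ {k : ℕ} where

  pb-≤ : {g h : Vec Tree k → ℕ} → (∀ ρ → g ρ ≤ h ρ) → PolyBounded h → PolyBounded g
  pb-≤ p (polyBounded c q) = polyBounded c (λ ρ → ≤-trans (p ρ) (q ρ))

  pb-const : ∀ m → PolyBounded {k} (λ _ → m)
  pb-const m = polyBounded m (λ ρ → ≤-trans (<⇒≤ (n<2^n m)) (^-monoˡ-≤ m (m≤m+n 2 (sizes ρ))))

  pb-sizes : PolyBounded {k} sizes
  pb-sizes = polyBounded 1 (λ ρ → ≤-trans (m≤n+m (sizes ρ) 2) (≤-reflexive (sym (*-identityʳ _))))

  pb-* : {g h : Vec Tree k → ℕ} → PolyBounded g → PolyBounded h → PolyBounded (λ ρ → g ρ * h ρ)
  pb-* (polyBounded c p) (polyBounded d q) = polyBounded (c + d) (λ ρ →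
    ≤-trans (*-mono-≤ (p ρ) (q ρ)) (≤-reflexive (sym (^-distribˡ-+-* (2 + sizes ρ) c d))))

  pb-+ : {g h : Vec Tree k → ℕ} → PolyBounded g → PolyBounded h → PolyBounded (λ ρ → g ρ + h ρ)
  pb-+ {g} {h} (polyBounded c p) (polyBounded d q) =
    pb-≤ {h = λ ρ → 2 * ((2 + sizes ρ) ^ c * (2 + sizes ρ) ^ d)}
      (λ ρ → let x = (2 + sizes ρ) ^ c ; y = (2 + sizes ρ) ^ d in
        ≤-trans (+-mono-≤ (p ρ) (q ρ))
        (≤-trans (+-mono-≤ (m≤m*n x y ⦃ m^n≢0 (2 + sizes ρ) d ⦄) (m≤n*m y x ⦃ m^n≢0 (2 + sizes ρ) c ⦄))
          (≤-reflexive (cong (λ z → x * y + z) (sym (+-identityʳ (x * y)))))))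
      (pb-* (pb-const 2) (pb-* (polyBounded c (λ _ → ≤-refl)) (polyBounded d (λ _ → ≤-refl))))

  pb-^ : {g : Vec Tree k → ℕ} → PolyBounded g → ∀ m → PolyBounded (λ ρ → g ρ ^ m)
  pb-^ (polyBounded c p) m = polyBounded (c * m) (λ ρ →
    ≤-trans (^-monoˡ-≤ m (p ρ)) (≤-reflexive (^-*-assoc (2 + sizes ρ) c m)))

  pb-poly : {g : Vec Tree k → ℕ} → PolyBounded g → ∀ m → PolyBounded (λ ρ → (2 + g ρ) ^ m)
  pb-poly p m = pb-^ (pb-+ (pb-const 2) p) m

  pb-∘ : ∀ {j} {g : Vec Tree j → ℕ} → PolyBounded g → (σ : Vec Tree k → Vec Tree j) →
         PolyBounded (λ ρ → sizes (σ ρ)) → PolyBounded (λ ρ → g (σ ρ))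
  pb-∘ (polyBounded c p) σ q = pb-≤ (λ ρ → p (σ ρ)) (pb-poly q c)

-- A `rec` can produce values of exponential size, so no polynomial bound holds for all of `Tm`. The
-- bounds travel with the term and are composed along with it.
record PTm (k : ℕ) : Set where
  constructor ptm
  field
    tm    : Tm k
    timeP : PolyBounded (time tm)
    sizeP : PolyBounded (λ ρ → size (⟦ tm ⟧ ρ))
open PTm public

⟦_⟧ₚ : ∀ {k} → PTm k → Vec Tree k → Tree
⟦ t ⟧ₚ = ⟦ tm t ⟧

data PArgs (k : ℕ) : ℕ → Set where
  []  : PArgs k 0
  _∷_ : ∀ {j} → PTm k → PArgs k j → PArgs k (suc j)

args : ∀ {k j} → PArgs k j → Args k j
args []       = []
args (t ∷ ts) = tm t ∷ args ts

ifT-≤ : ∀ {m n o} t → m ≤ o → n ≤ o → ifT t m n ≤ o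
ifT-≤ nil     p q = q
ifT-≤ (_ ∙ _) p q = p

size-ifT : ∀ t x y {m} → size x ≤ m → size y ≤ m → size (ifT t x y) ≤ m
size-ifT nil     x y p q = q
size-ifT (_ ∙ _) x y p q = p

abstract
  pb-pairTime : ∀ {k} {g h : Vec Tree k → ℕ} → PolyBounded g → PolyBounded h → PolyBounded (λ ρ → pairTime (g ρ) (h ρ))
  pb-pairTime p q = pb-+ (pb-const 4) (pb-+ p (pb-+ (pb-const 4) (pb-+ (pb-const 4) (pb-+ q (pb-const 9)))))

  pb-size-∙ : ∀ {k} {g h : Vec Tree k → Tree} → PolyBounded (λ ρ → size (g ρ)) → PolyBounded (λ ρ → size (h ρ)) →
              PolyBounded (λ ρ → size (g ρ ∙ h ρ))
  pb-size-∙ {g = g} {h} p q = pb-≤ (λ ρ → size-∙ (g ρ) (h ρ)) (pb-+ (pb-const 1) (pb-+ p q))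

  args-size : ∀ {k j} (ts : PArgs k j) → PolyBounded (λ ρ → sizes (⟦ args ts ⟧* ρ))
  args-size []       = pb-const 0
  args-size (t ∷ ts) = pb-+ (sizeP t) (args-size ts)

  args-time : ∀ {k j} (ts : PArgs k j) → PolyBounded (time* (args ts))
  args-time []       = pb-const 2
  args-time (t ∷ ts) = pb-pairTime (timeP t) (args-time ts)

varP : ∀ {k} → Fin k → PTm k
varP i = ptm (var i) (pb-const (suc (cost (varE i xE)))) (pb-≤ (λ ρ → size-lookup ρ i) pb-sizes)

nilP : ∀ {k} → PTm k
nilP = ptm nil (pb-const 2) (pb-const 0)

consP : ∀ {k} → PTm k → PTm k → PTm k
consP t u = ptm (cons (tm t) (tm u)) (pb-pairTime (timeP t) (timeP u)) (pb-size-∙ {g = ⟦ t ⟧ₚ} {⟦ u ⟧ₚ} (sizeP t) (sizeP u))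

hdP tlP : ∀ {k} → PTm k → PTm k
hdP t = ptm (hd (tm t)) (pb-+ (timeP t) (pb-const 3)) (pb-≤ (λ ρ → size-head (⟦ t ⟧ₚ ρ)) (sizeP t))
tlP t = ptm (tl (tm t)) (pb-+ (timeP t) (pb-const 3)) (pb-≤ (λ ρ → size-tail (⟦ t ⟧ₚ ρ)) (sizeP t))

iteP : ∀ {k} → PTm k → PTm k → PTm k → PTm k
iteP t u v = ptm (ite (tm t) (tm u) (tm v))
  (pb-+ (pb-const 4) (pb-+ (timeP t) (pb-+ (pb-const 15)
    (pb-≤ (λ ρ → ifT-≤ (⟦ t ⟧ₚ ρ) (m≤m+n _ _) (m≤n+m _ (time (tm u) ρ))) (pb-+ (timeP u) (timeP v))))))
  (pb-≤ (λ ρ → size-ifT (⟦ t ⟧ₚ ρ) _ _ (m≤m+n _ _) (m≤n+m _ (size (⟦ u ⟧ₚ ρ)))) (pb-+ (sizeP u) (sizeP v)))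

callP : ∀ {k j} → PTm j → PArgs k j → PTm k
callP t us = ptm (call (tm t) (args us))
  (pb-+ (args-time us) (pb-∘ (timeP t) ⟦ args us ⟧* (args-size us)))
  (pb-∘ (sizeP t) ⟦ args us ⟧* (args-size us))

size-step : ∀ a l x → x + size l * x ≤ size (a ∙ l) * x
size-step a l x = *-monoˡ-≤ x (+-monoˡ-≤ (size l) (m≤m⊔n 1 (size a)))

module RecBounds
  {base : Tree → Tree} {down : Tree → Tree → Tree → Tree} {up : Tree → Tree → Tree → Tree → Tree}
  (Λ D : ℕ) (size-down : ∀ a l s → size (a ∙ l) ≤ Λ → size (down a l s) ≤ size s + D) where

  -- Each step of the descent may add `D` to the parameter. Every cell of the list weighs at least
  -- 1, so the weight of the remaining list times `D` is a sufficient reserve within `W`.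
  invariant : ∀ a l s W → size (a ∙ l) ≤ Λ → size s + size (a ∙ l) * D ≤ W → size (down a l s) + size l * D ≤ W
  invariant a l s W p q = ≤-trans (+-monoˡ-≤ (size l * D) (size-down a l s p))
    (≤-trans (≤-reflexive (+-assoc (size s) D _)) (≤-trans (+-monoʳ-≤ (size s) (size-step a l D)) q))

  module _ (W : ℕ) where
    private
      shrink : ∀ a l → size (a ∙ l) ≤ Λ → size l ≤ Λ
      shrink a l = ≤-trans (size-tail (a ∙ l))

      param : ∀ l s → size s + size l * D ≤ W → size s ≤ W
      param l s = ≤-trans (m≤m+n (size s) _)

    baseTimes-≤ : ∀ {tb} TB → (∀ s → size s ≤ W → tb s ≤ TB) →
                  ∀ l s → size l ≤ Λ → size s + size l * D ≤ W → baseTimes down tb l s ≤ TB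
    baseTimes-≤ TB h nil s p q = h s (param nil s q)
    baseTimes-≤ TB h (a ∙ l) s p q = baseTimes-≤ TB h l _ (shrink a l p) (invariant a l s W p q)

    downTimes-≤ : ∀ {td} TD → (∀ a l s → size (a ∙ l) ≤ Λ → size s ≤ W → td a l s ≤ TD) →
                  ∀ l s → size l ≤ Λ → size s + size l * D ≤ W → downTimes down td l s ≤ 3 + size l * (50 + TD)
    downTimes-≤ TD h nil s p q = ≤-refl
    downTimes-≤ {td} TD h (a ∙ l) s p q =
      ≤-trans (+-monoʳ-≤ 3 (+-mono-≤ (+-monoʳ-≤ 23 (+-monoˡ-≤ 24 (h a l s p (param (a ∙ l) s q))))
                                      (downTimes-≤ TD h l _ (shrink a l p) (invariant a l s W p q))))
        (≤-trans (≤-reflexive (shuffle TD (size l * (50 + TD)))) (+-monoʳ-≤ 3 (size-step a l (50 + TD))))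
      where
      shuffle : ∀ t x → 3 + (23 + (t + 24) + (3 + x)) ≡ 3 + (50 + t + x)
      shuffle = solve-∀

    module _ (B U : ℕ) (size-base : ∀ s → size s ≤ W → size (base s) ≤ B)
             (size-up : ∀ r a l s → size (a ∙ l) ≤ Λ → size s ≤ W → size (up r a l s) ≤ size r + U) where

      recTree-≤ : ∀ l s → size l ≤ Λ → size s + size l * D ≤ W → size (recTree base down up l s) ≤ B + size l * U
      recTree-≤ nil s p q = ≤-trans (size-base s (param nil s q)) (m≤m+n B 0)
      recTree-≤ (a ∙ l) s p q = ≤-trans (size-up _ a l s p (param (a ∙ l) s q))
        (≤-trans (+-monoˡ-≤ U (recTree-≤ l _ (shrink a l p) (invariant a l s W p q)))
          (≤-trans (≤-reflexive (trans (+-assoc B _ U) (cong (λ z → B + z) (+-comm _ U)))) (+-monoʳ-≤ B (size-step a l U))))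

      upTimes-≤ : ∀ {tu} TU → (∀ r a l s → size r ≤ B + Λ * U → size (a ∙ l) ≤ Λ → size s ≤ W → tu r a l s ≤ TU) →
                  ∀ l s rest → size l ≤ Λ → size s + size l * D ≤ W →
                  upTimes base down up tu l s rest ≤ rest + size l * (40 + TU)
      upTimes-≤ TU h nil s rest p q = m≤m+n rest 0
      upTimes-≤ {tu} TU h (a ∙ l) s rest p q =
        ≤-trans (upTimes-≤ TU h l _ _ (shrink a l p) (invariant a l s W p q))
          (≤-trans (+-monoˡ-≤ (size l * (40 + TU)) (+-monoʳ-≤ 3 (+-monoˡ-≤ rest (+-monoʳ-≤ 23 (+-monoˡ-≤ 7
             (h _ a l s (≤-trans (recTree-≤ l _ (shrink a l p) (invariant a l s W p q))
                           (+-monoʳ-≤ B (*-monoˡ-≤ U (shrink a l p)))) p (param (a ∙ l) s q)))))))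
            -- An iteration has 33 steps of bookkeeping, rounded up to 40.
            (≤-trans (≤-trans (m≤n+m _ 7) (≤-reflexive (shuffle TU rest (size l * (40 + TU)))))
                     (+-monoʳ-≤ rest (size-step a l (40 + TU)))))
        where
        shuffle : ∀ t r x → 7 + (3 + (23 + (t + 7) + r) + x) ≡ r + (40 + t + x)
        shuffle = solve-∀

-- Loops whose parameter and result grow additively: the increments may depend
-- polynomially on everything except the growing quantity itself.
module _ {k} (list param : PTm k) (base : PTm (1 + k)) (down : PTm (3 + k)) (up : PTm (4 + k))
         {g : Vec Tree (2 + k) → ℕ} (g-poly : PolyBounded g)
         (size-down : ∀ a l s ρ → size (⟦ down ⟧ₚ (a ∷ l ∷ s ∷ ρ)) ≤ size s + g (a ∷ l ∷ ρ))
         {h : Vec Tree (3 + k) → ℕ} (h-poly : PolyBounded h)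
         (size-up : ∀ r a l s ρ → size (⟦ up ⟧ₚ (r ∷ a ∷ l ∷ s ∷ ρ)) ≤ size r + h (a ∷ l ∷ s ∷ ρ)) where

  recTm : Tm k
  recTm = rec (tm list) (tm param) (tm base) (tm down) (tm up)

  private
    -- `W` bounds every parameter met on the way down, `B` the result of the base case and `R` every
    -- result met on the way up; `D` and `U` are the increments per step. The exponents come from
    -- the certificates of the three bodies.
    Λ D W B U R TD TB TU : Vec Tree k → ℕ
    Λ ρ = size (⟦ list ⟧ₚ ρ)
    D ρ = (2 + (Λ ρ + (Λ ρ + sizes ρ))) ^ degree g-poly
    W ρ = size (⟦ param ⟧ₚ ρ) + Λ ρ * D ρ
    B ρ = (2 + (W ρ + sizes ρ)) ^ degree (sizeP base)
    U ρ = (2 + (Λ ρ + (Λ ρ + (W ρ + sizes ρ)))) ^ degree h-poly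
    R ρ = B ρ + Λ ρ * U ρ
    TD ρ = (2 + (Λ ρ + (Λ ρ + (W ρ + sizes ρ)))) ^ degree (timeP down)
    TB ρ = (2 + (W ρ + sizes ρ)) ^ degree (timeP base)
    TU ρ = (2 + (R ρ + (Λ ρ + (Λ ρ + (W ρ + sizes ρ))))) ^ degree (timeP up)

    raise : ∀ {j} {f : Vec Tree j → ℕ} (p : PolyBounded f) ρ {N} → sizes ρ ≤ N → f ρ ≤ (2 + N) ^ degree p
    raise p ρ q = ≤-trans (bound p ρ) (^-monoˡ-≤ (degree p) (+-monoʳ-≤ 2 q))

    cell : ∀ a l {m n o} → size (a ∙ l) ≤ o → m ≤ n → size a + (size l + m) ≤ o + (o + n)
    cell a l p q = +-mono-≤ (≤-trans (size-head (a ∙ l)) p) (+-mono-≤ (≤-trans (size-tail (a ∙ l)) p) q)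

    pbΛ : PolyBounded Λ
    pbΛ = sizeP list
    pbD : PolyBounded D
    pbD = pb-poly (pb-+ pbΛ (pb-+ pbΛ pb-sizes)) (degree g-poly)
    pbW : PolyBounded W
    pbW = pb-+ (sizeP param) (pb-* pbΛ pbD)
    pbB : PolyBounded B
    pbB = pb-poly (pb-+ pbW pb-sizes) (degree (sizeP base))
    pbΛΛW : PolyBounded (λ ρ → Λ ρ + (Λ ρ + (W ρ + sizes ρ)))
    pbΛΛW = pb-+ pbΛ (pb-+ pbΛ (pb-+ pbW pb-sizes))
    pbU : PolyBounded U
    pbU = pb-poly pbΛΛW (degree h-poly)
    pbR : PolyBounded R
    pbR = pb-+ pbB (pb-* pbΛ pbU)

    module Bounds (ρ : Vec Tree k) where
      down-≤ : ∀ a l s → size (a ∙ l) ≤ Λ ρ → size (⟦ down ⟧ₚ (a ∷ l ∷ s ∷ ρ)) ≤ size s + D ρ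
      down-≤ a l s p = ≤-trans (size-down a l s ρ)
        (+-monoʳ-≤ (size s) (raise g-poly (a ∷ l ∷ ρ) (cell a l p ≤-refl)))

      open RecBounds {λ s → ⟦ base ⟧ₚ (s ∷ ρ)} {λ a l s → ⟦ down ⟧ₚ (a ∷ l ∷ s ∷ ρ)}
                     {λ r a l s → ⟦ up ⟧ₚ (r ∷ a ∷ l ∷ s ∷ ρ)} (Λ ρ) (D ρ) down-≤ public

      base-≤ : ∀ s → size s ≤ W ρ → size (⟦ base ⟧ₚ (s ∷ ρ)) ≤ B ρ
      base-≤ s p = raise (sizeP base) (s ∷ ρ) (+-monoˡ-≤ (sizes ρ) p)

      up-≤ : ∀ r a l s → size (a ∙ l) ≤ Λ ρ → size s ≤ W ρ → size (⟦ up ⟧ₚ (r ∷ a ∷ l ∷ s ∷ ρ)) ≤ size r + U ρ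
      up-≤ r a l s p q = ≤-trans (size-up r a l s ρ)
        (+-monoʳ-≤ (size r) (raise h-poly (a ∷ l ∷ s ∷ ρ) (cell a l p (+-monoˡ-≤ (sizes ρ) q))))

  abstract
    recP-size : PolyBounded (λ ρ → size (⟦ recTm ⟧ ρ))
    recP-size = pb-≤ (λ ρ → let open Bounds ρ in
      recTree-≤ (W ρ) (B ρ) (U ρ) base-≤ up-≤ (⟦ list ⟧ₚ ρ) (⟦ param ⟧ₚ ρ) ≤-refl ≤-refl) pbR

    recP-time : PolyBounded (time recTm)
    recP-time = pb-+ (pb-const 4) (pb-+ (pb-pairTime (timeP list) (timeP param)) (pb-+ (pb-const 8) (pb-+
      (pb-≤ (λ ρ → let open Bounds ρ in downTimes-≤ (W ρ) (TD ρ)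
               (λ a l s p q → raise (timeP down) (a ∷ l ∷ s ∷ ρ) (cell a l p (+-monoˡ-≤ (sizes ρ) q)))
               (⟦ list ⟧ₚ ρ) (⟦ param ⟧ₚ ρ) ≤-refl ≤-refl)
            (pb-+ (pb-const 3) (pb-* pbΛ (pb-+ (pb-const 50) (pb-poly pbΛΛW (degree (timeP down)))))))
      (pb-+ (pb-const 6) (pb-+ (pb-const 8) (pb-+
      (pb-≤ (λ ρ → let open Bounds ρ in baseTimes-≤ (W ρ) (TB ρ)
               (λ s p → raise (timeP base) (s ∷ ρ) (+-monoˡ-≤ (sizes ρ) p))
               (⟦ list ⟧ₚ ρ) (⟦ param ⟧ₚ ρ) ≤-refl ≤-refl)
            (pb-poly (pb-+ pbW pb-sizes) (degree (timeP base))))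
      (pb-+
      (pb-≤ (λ ρ → let open Bounds ρ in upTimes-≤ (W ρ) (B ρ) (U ρ) base-≤ up-≤ (TU ρ)
               (λ r a l s o p q → raise (timeP up) (r ∷ a ∷ l ∷ s ∷ ρ)
                  (+-mono-≤ o (cell a l p (+-monoˡ-≤ (sizes ρ) q))))
               (⟦ list ⟧ₚ ρ) (⟦ param ⟧ₚ ρ) 3 ≤-refl ≤-refl)
            (pb-+ (pb-const 3) (pb-* pbΛ (pb-+ (pb-const 40) (pb-poly (pb-+ pbR pbΛΛW) (degree (timeP up)))))))
      (pb-const 4))))))))

  recP : PTm k
  recP = ptm recTm recP-time recP-size

-- Arithmetic

v0 : ∀ {k} → PTm (1 + k)
v0 = varP zero
v1 : ∀ {k} → PTm (2 + k)
v1 = varP (suc zero)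
v2 : ∀ {k} → PTm (3 + k)
v2 = varP (suc (suc zero))
v3 : ∀ {k} → PTm (4 + k)
v3 = varP (suc (suc (suc zero)))
v4 : ∀ {k} → PTm (5 + k)
v4 = varP (suc (suc (suc (suc zero))))
v5 : ∀ {k} → PTm (6 + k)
v5 = varP (suc (suc (suc (suc (suc zero)))))
v6 : ∀ {k} → PTm (7 + k)
v6 = varP (suc (suc (suc (suc (suc (suc zero))))))
v7 : ∀ {k} → PTm (8 + k)
v7 = varP (suc (suc (suc (suc (suc (suc (suc zero)))))))

one : Tree
one = nil ∙ nil

oneP : ∀ {k} → PTm k
oneP = consP nilP nilP

bit : Tree → ℕ
bit nil     = 0
bit (_ ∙ _) = 1

-- Every tree denotes a number: the spine lists its bits, least significant first.
val : Tree → ℕ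
val nil     = 0
val (b ∙ t) = bit b + 2 * val t

val-head-tail : ∀ t → val t ≡ bit (head t) + 2 * val (tail t)
val-head-tail nil     = refl
val-head-tail (_ ∙ _) = refl

bit≤1 : ∀ t → bit t ≤ 1
bit≤1 nil     = z≤n
bit≤1 (_ ∙ _) = ≤-refl

recTree-ind : ∀ {base down up} (P : Tree → Tree → Tree → Set) → (∀ s → P nil s (base s)) →
              (∀ a l s r → P l (down a l s) r → P (a ∙ l) s (up r a l s)) →
              ∀ l s → P l s (recTree base down up l s)
recTree-ind P b u nil     s = b s
recTree-ind P b u (a ∙ l) s = u a l s _ (recTree-ind P b u l _)

data Decides (P : Set) : Tree → Set where
  holds : ∀ {l r} → P → Decides P (l ∙ r)
  fails : ¬ P → Decides P nil

decides-map : ∀ {P P′ t} → (P → P′) → (P′ → P) → Decides P t → Decides P′ t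
decides-map f g (holds p)  = holds (f p)
decides-map f g (fails ¬p) = fails (λ q → ¬p (g q))

notP : ∀ {k} → PTm k → PTm k
notP t = iteP t nilP oneP

andP xorP : ∀ {k} → PTm k → PTm k → PTm k
andP t u = iteP t (iteP u oneP nilP) nilP
xorP t u = iteP t (iteP u nilP oneP) (iteP u oneP nilP)

parityP majorityP : ∀ {k} → PTm k → PTm k → PTm k → PTm k
parityP t u v = iteP t (xorP (notP u) v) (xorP u v)
majorityP t u v = iteP t (iteP u oneP (iteP v oneP nilP)) (andP u v)

size-bit-∙ : ∀ b t → size b ≤ 1 → size (b ∙ t) ≤ size t + 1
size-bit-∙ b t p = ≤-trans (+-monoˡ-≤ (size t) (⊔-lub ≤-refl p)) (≤-reflexive (+-comm 1 (size t)))

size-parity : ∀ a b c → size (⟦ parityP v0 v1 v2 ⟧ₚ (a ∷ b ∷ c ∷ [])) ≤ 1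
size-parity nil     nil     nil     = z≤n
size-parity nil     nil     (_ ∙ _) = ≤-refl
size-parity nil     (_ ∙ _) nil     = ≤-refl
size-parity nil     (_ ∙ _) (_ ∙ _) = z≤n
size-parity (_ ∙ _) nil     nil     = ≤-refl
size-parity (_ ∙ _) nil     (_ ∙ _) = z≤n
size-parity (_ ∙ _) (_ ∙ _) nil     = z≤n
size-parity (_ ∙ _) (_ ∙ _) (_ ∙ _) = ≤-refl

size-majority : ∀ a b c → size (⟦ majorityP v0 v1 v2 ⟧ₚ (a ∷ b ∷ c ∷ [])) ≤ 1
size-majority nil     nil     c       = z≤n
size-majority nil     (_ ∙ _) nil     = z≤n
size-majority nil     (_ ∙ _) (_ ∙ _) = ≤-refl
size-majority (_ ∙ _) nil     nil     = z≤n
size-majority (_ ∙ _) nil     (_ ∙ _) = ≤-refl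
size-majority (_ ∙ _) (_ ∙ _) c       = ≤-refl

size-parity-∙ : ∀ a b c t → size (⟦ parityP v0 v1 v2 ⟧ₚ (a ∷ b ∷ c ∷ []) ∙ t) ≤ size t + 1
size-parity-∙ a b c t = size-bit-∙ (⟦ parityP v0 v1 v2 ⟧ₚ (a ∷ b ∷ c ∷ [])) t (size-parity a b c)

size-majority-∙ : ∀ a b c t → size (⟦ majorityP v0 v1 v2 ⟧ₚ (a ∷ b ∷ c ∷ []) ∙ t) ≤ size t + 1
size-majority-∙ a b c t = size-bit-∙ (⟦ majorityP v0 v1 v2 ⟧ₚ (a ∷ b ∷ c ∷ [])) t (size-majority a b c)

full-adder : ∀ a b c → bit (⟦ parityP v0 v1 v2 ⟧ₚ (a ∷ b ∷ c ∷ [])) + 2 * bit (⟦ majorityP v0 v1 v2 ⟧ₚ (a ∷ b ∷ c ∷ []))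
             ≡ bit a + bit b + bit c
full-adder nil     nil     nil     = refl
full-adder nil     nil     (_ ∙ _) = refl
full-adder nil     (_ ∙ _) nil     = refl
full-adder nil     (_ ∙ _) (_ ∙ _) = refl
full-adder (_ ∙ _) nil     nil     = refl
full-adder (_ ∙ _) nil     (_ ∙ _) = refl
full-adder (_ ∙ _) (_ ∙ _) nil     = refl
full-adder (_ ∙ _) (_ ∙ _) (_ ∙ _) = refl

full-subtractor : ∀ a b c → bit a + 2 * bit (⟦ majorityP (notP v0) v1 v2 ⟧ₚ (a ∷ b ∷ c ∷ []))
                  ≡ bit (⟦ parityP v0 v1 v2 ⟧ₚ (a ∷ b ∷ c ∷ [])) + (bit b + bit c)
full-subtractor nil     nil     nil     = refl
full-subtractor nil     nil     (_ ∙ _) = refl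
full-subtractor nil     (_ ∙ _) nil     = refl
full-subtractor nil     (_ ∙ _) (_ ∙ _) = refl
full-subtractor (_ ∙ _) nil     nil     = refl
full-subtractor (_ ∙ _) nil     (_ ∙ _) = refl
full-subtractor (_ ∙ _) (_ ∙ _) nil     = refl
full-subtractor (_ ∙ _) (_ ∙ _) (_ ∙ _) = refl

opaque
  incP : PTm 2
  incP = recP v0 v1 (iteP v0 (consP oneP nilP) nilP) (andP v0 v2) (consP (xorP v1 v3) v0)
    (pb-const 1) size-down (pb-const 1) size-up
    where
    size-down : ∀ a l s (ρ : Vec Tree 2) → size (⟦ andP v0 v2 ⟧ₚ (a ∷ l ∷ s ∷ ρ)) ≤ size s + 1
    size-down nil     l s       ρ = z≤n
    size-down (_ ∙ _) l nil     ρ = z≤n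
    size-down (_ ∙ _) l (_ ∙ _) ρ = m≤n+m 1 _
    size-up : ∀ r a l s (ρ : Vec Tree 2) → size (⟦ consP (xorP v1 v3) v0 ⟧ₚ (r ∷ a ∷ l ∷ s ∷ ρ)) ≤ size r + 1
    size-up r nil     l nil     ρ = size-bit-∙ nil r z≤n
    size-up r nil     l (_ ∙ _) ρ = size-bit-∙ one r ≤-refl
    size-up r (_ ∙ _) l nil     ρ = size-bit-∙ one r ≤-refl
    size-up r (_ ∙ _) l (_ ∙ _) ρ = size-bit-∙ nil r z≤n

  inc-val : ∀ y c → val (⟦ incP ⟧ₚ (y ∷ c ∷ [])) ≡ val y + bit c
  inc-val nil     nil     = refl
  inc-val nil     (_ ∙ _) = refl
  inc-val (nil ∙ y) nil = trans (cong (2 *_) (trans (inc-val y nil) (+-identityʳ _))) (sym (+-identityʳ _))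
  inc-val (nil ∙ y) (c ∙ d) = trans (cong (λ x → 1 + 2 * x) (trans (inc-val y nil) (+-identityʳ _))) (+-comm 1 (2 * val y))
  inc-val ((_ ∙ _) ∙ y) nil = cong suc (trans (cong (2 *_) (trans (inc-val y nil) (+-identityʳ _))) (sym (+-identityʳ _)))
  inc-val ((_ ∙ _) ∙ y) (_ ∙ _) = trans (cong (2 *_) (inc-val y one)) (carry (val y))
    where
    carry : ∀ x → 2 * (x + 1) ≡ 1 + 2 * x + 1
    carry = solve-∀

  inc-size : ∀ y c → size (⟦ incP ⟧ₚ (y ∷ c ∷ [])) ≤ size y + 1
  inc-size nil     nil     = z≤n
  inc-size nil     (_ ∙ _) = ≤-refl
  inc-size (nil ∙ y) nil = s≤s (inc-size y nil)
  inc-size (nil ∙ y) (c ∙ d) = s≤s (inc-size y nil)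
  inc-size ((a ∙ b) ∙ y) nil = ≤-trans (s≤s (inc-size y nil)) (+-monoˡ-≤ 1 (+-monoˡ-≤ (size y) (m≤m⊔n 1 (size (a ∙ b)))))
  inc-size ((a ∙ b) ∙ y) (_ ∙ _) = ≤-trans (s≤s (inc-size y one)) (+-monoˡ-≤ 1 (+-monoˡ-≤ (size y) (m≤m⊔n 1 (size (a ∙ b)))))

opaque
  private
    addDown addUp : ∀ {k} → PTm (4 + k)
    addDown = consP (majorityP v0 (hdP (tlP v2)) (hdP v2)) (tlP (tlP v2))
    addUp = consP (parityP v1 (hdP (tlP v3)) (hdP v3)) v0

  -- The parameter is carry ∙ rest of the second summand.
  addCarryP : PTm 2
  addCarryP = recP v0 v1 (callP incP (tlP v0 ∷ hdP v0 ∷ [])) addDown addUp (pb-const 1)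
    (λ a l s ρ → ≤-trans (size-majority-∙ a (head (tail s)) (head s) (tail (tail s)))
                         (+-monoˡ-≤ 1 (≤-trans (size-tail (tail s)) (size-tail s))))
    (pb-const 1) (λ r a l s ρ → size-parity-∙ a (head (tail s)) (head s) r)

  addP : PTm 2
  addP = callP addCarryP (v0 ∷ consP nilP v1 ∷ [])

  private
    addCarry-val : ∀ x s → val (⟦ addCarryP ⟧ₚ (x ∷ s ∷ [])) ≡ val x + val (tail s) + bit (head s)
    addCarry-val = recTree-ind (λ x s r → val r ≡ val x + val (tail s) + bit (head s))
      (λ s → inc-val (tail s) (head s)) λ a x s r ih →
      let y = head (tail s) ; ys = tail (tail s) ; c = head s
          p = bit (⟦ parityP v0 v1 v2 ⟧ₚ (a ∷ y ∷ c ∷ []))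
          m = bit (⟦ majorityP v0 v1 v2 ⟧ₚ (a ∷ y ∷ c ∷ [])) in begin
      p + 2 * val r ≡⟨ cong (λ r → p + 2 * r) ih ⟩
      p + 2 * (val x + val ys + m) ≡⟨ shuffle₁ p m (val x) (val ys) ⟩
      p + 2 * m + 2 * (val x + val ys) ≡⟨ cong (_+ 2 * (val x + val ys)) (full-adder a y c) ⟩
      bit a + bit y + bit c + 2 * (val x + val ys) ≡⟨ shuffle₂ (bit a) (bit y) (bit c) (val x) (val ys) ⟩
      bit a + 2 * val x + (bit y + 2 * val ys) + bit c ≡⟨ cong (λ z → bit a + 2 * val x + z + bit c) (sym (val-head-tail (tail s))) ⟩
      bit a + 2 * val x + val (tail s) + bit c ∎
      where
      open ≡-Reasoning
      shuffle₁ : ∀ p m x y → p + 2 * (x + y + m) ≡ p + 2 * m + 2 * (x + y)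
      shuffle₁ = solve-∀
      shuffle₂ : ∀ a b c x y → a + b + c + 2 * (x + y) ≡ a + 2 * x + (b + 2 * y) + c
      shuffle₂ = solve-∀

    addCarry-size : ∀ x s → size (⟦ addCarryP ⟧ₚ (x ∷ s ∷ [])) ≤ size x + (size (tail s) + 1)
    addCarry-size = recTree-ind (λ x s r → size r ≤ size x + (size (tail s) + 1))
      (λ s → inc-size (tail s) (head s)) λ a x s r ih →
      ≤-trans (size-parity-∙ a (head (tail s)) (head s) r)
      (≤-trans (+-monoˡ-≤ 1 ih)
      (≤-trans (≤-reflexive (+-comm (size x + (size (tail (tail s)) + 1)) 1))
        (+-mono-≤ (+-monoˡ-≤ (size x) (m≤m⊔n 1 (size a))) (+-monoˡ-≤ 1 (size-tail (tail s))))))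

  add-val : ∀ x y → val (⟦ addP ⟧ₚ (x ∷ y ∷ [])) ≡ val x + val y
  add-val x y = trans (addCarry-val x (nil ∙ y)) (+-identityʳ _)

  add-size : ∀ x y → size (⟦ addP ⟧ₚ (x ∷ y ∷ [])) ≤ size x + (size y + 1)
  add-size x y = addCarry-size x (nil ∙ y)

opaque
  isZeroP : PTm 1
  isZeroP = recP v0 nilP oneP nilP (iteP v1 nilP v0) (pb-const 0) (λ a l s ρ → z≤n) (pb-const 0)
    (λ r a l s ρ → size-ifT a nil r z≤n (m≤m+n (size r) 0))

  isZero-decides : ∀ x → Decides (val x ≡ 0) (⟦ isZeroP ⟧ₚ (x ∷ []))
  isZero-decides nil = holds refl
  isZero-decides (nil ∙ x) =
    decides-map (cong (2 *_)) (λ p → m+n≡0⇒m≡0 (val x) p) (isZero-decides x)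
  isZero-decides ((_ ∙ _) ∙ x) = fails (λ ())

private
  subDown : ∀ {k} → PTm (4 + k)
  subDown = consP (majorityP (notP v0) (hdP (tlP v2)) (hdP v2)) (tlP (tlP v2))

  size-borrow : ∀ a b c → size (⟦ majorityP (notP v0) v1 v2 ⟧ₚ (a ∷ b ∷ c ∷ [])) ≤ 1
  size-borrow nil     b c = size-majority one b c
  size-borrow (_ ∙ _) b c = size-majority nil b c

  size-subDown : ∀ {k} a l s (ρ : Vec Tree (1 + k)) → size (⟦ subDown ⟧ₚ (a ∷ l ∷ s ∷ ρ)) ≤ size s + 1
  size-subDown a l s ρ = ≤-trans
    (size-bit-∙ (⟦ majorityP (notP v0) v1 v2 ⟧ₚ (a ∷ head (tail s) ∷ head s ∷ [])) (tail (tail s)) (size-borrow a (head (tail s)) (head s)))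
    (+-monoˡ-≤ 1 (≤-trans (size-tail (tail s)) (size-tail s)))

  -- One column of schoolbook subtraction: `a ∙ p` is the minuend, and `s` packs the incoming borrow
  -- with the rest of the subtrahend. `descend` and `ascend` say that "subtrahend plus borrow is at
  -- most the minuend" is equivalent before and after the column, which serves subtraction and
  -- comparison alike.
  module Borrow (a p s : Tree) where
    y = head (tail s)
    q = tail (tail s)
    c = head s
    digit = bit (⟦ parityP v0 v1 v2 ⟧ₚ (a ∷ y ∷ c ∷ []))
    borrow = bit (⟦ majorityP (notP v0) v1 v2 ⟧ₚ (a ∷ y ∷ c ∷ []))

    balance : digit + (val (tail s) + bit c) ≡ bit a + 2 * (val q + borrow)
    balance = begin
      digit + (val (tail s) + bit c) ≡⟨ cong (λ z → digit + (z + bit c)) (val-head-tail (tail s)) ⟩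
      digit + (bit y + 2 * val q + bit c) ≡⟨ shuffle₁ digit (bit y) (val q) (bit c) ⟩
      digit + (bit y + bit c) + 2 * val q ≡⟨ cong (_+ 2 * val q) (sym (full-subtractor a y c)) ⟩
      bit a + 2 * borrow + 2 * val q ≡⟨ shuffle₂ (bit a) borrow (val q) ⟩
      bit a + 2 * (val q + borrow) ∎
      where
      open ≡-Reasoning
      shuffle₁ : ∀ d y q c → d + (y + 2 * q + c) ≡ d + (y + c) + 2 * q
      shuffle₁ = solve-∀
      shuffle₂ : ∀ a b q → a + 2 * b + 2 * q ≡ a + 2 * (q + b)
      shuffle₂ = solve-∀

    descend : val (tail s) + bit c ≤ bit a + 2 * val p → val q + borrow ≤ val p
    descend h = half _ _ (+-cancelˡ-≤ (bit a) _ _ (≤-trans (≤-reflexive (sym balance))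
        (≤-trans (+-mono-≤ (bit≤1 (⟦ parityP v0 v1 v2 ⟧ₚ (a ∷ y ∷ c ∷ []))) h)
                 (≤-reflexive (swap (bit a) (2 * val p))))))
      where
      swap : ∀ a b → 1 + (a + b) ≡ a + (1 + b)
      swap = solve-∀
      half : ∀ m n → 2 * m ≤ 1 + 2 * n → m ≤ n
      half zero n h = z≤n
      half (suc m) zero h with subst (_≤ 1) (*-suc 2 m) h
      ... | s≤s ()
      half (suc m) (suc n) h =
        s≤s (half m n (+-cancelˡ-≤ 2 _ _ (subst (λ z → 2 + 2 * m ≤ z) (cong suc (*-suc 2 n)) (subst (_≤ 1 + 2 * suc n) (*-suc 2 m) h))))

    ascend : val q + borrow ≤ val p → val (tail s) + bit c ≤ bit a + 2 * val p
    ascend h = ≤-trans (m≤n+m _ digit) (≤-trans (≤-reflexive balance) (+-monoʳ-≤ (bit a) (*-monoʳ-≤ 2 h)))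

opaque
  subBorrowP : PTm 2
  subBorrowP = recP v0 v1 nilP subDown (consP (parityP v1 (hdP (tlP v3)) (hdP v3)) v0)
    (pb-const 1) size-subDown (pb-const 1) (λ r a l s ρ → size-parity-∙ a (head (tail s)) (head s) r)

  subP : PTm 2
  subP = callP subBorrowP (v0 ∷ consP nilP v1 ∷ [])

  private
    subBorrow-val : ∀ p s → val (tail s) + bit (head s) ≤ val p →
                    val (⟦ subBorrowP ⟧ₚ (p ∷ s ∷ [])) + (val (tail s) + bit (head s)) ≡ val p
    subBorrow-val = recTree-ind
      (λ p s r → val (tail s) + bit (head s) ≤ val p → val r + (val (tail s) + bit (head s)) ≡ val p)
      (λ s → n≤0⇒n≡0) λ a p s r ih h → let open Borrow a p s in begin
      digit + 2 * val r + (val (tail s) + bit c) ≡⟨ shuffle digit (val r) (val (tail s) + bit c) ⟩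
      digit + (val (tail s) + bit c) + 2 * val r ≡⟨ cong (_+ 2 * val r) balance ⟩
      bit a + 2 * (val q + borrow) + 2 * val r ≡⟨ shuffle′ (bit a) (val q + borrow) (val r) ⟩
      bit a + 2 * (val r + (val q + borrow)) ≡⟨ cong (λ z → bit a + 2 * z) (ih (descend h)) ⟩
      bit a + 2 * val p ∎
      where
      open ≡-Reasoning
      shuffle : ∀ d r x → d + 2 * r + x ≡ d + x + 2 * r
      shuffle = solve-∀
      shuffle′ : ∀ a x r → a + 2 * x + 2 * r ≡ a + 2 * (r + x)
      shuffle′ = solve-∀

  sub-val : ∀ p q → val q ≤ val p → val (⟦ subP ⟧ₚ (p ∷ q ∷ [])) + val q ≡ val p
  sub-val p q h = trans (cong (λ z → val (⟦ subP ⟧ₚ (p ∷ q ∷ [])) + z) (sym (+-identityʳ (val q))))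
    (subBorrow-val p (nil ∙ q) (≤-trans (≤-reflexive (+-identityʳ (val q))) h))

opaque
  leBorrowP : PTm 2
  leBorrowP = recP v0 v1 (iteP (hdP v0) nilP (callP isZeroP (tlP v0 ∷ []))) subDown v0
    (pb-const 1) size-subDown (pb-const 0) (λ r a l s ρ → m≤m+n (size r) 0)

  -- `x ≤ y` is decided by subtracting `x` from `y` without recording digits: when the bits of `y`
  -- are used up, there must be no borrow and no nonzero rest of `x`.
  leP : PTm 2
  leP = callP leBorrowP (v1 ∷ consP nilP v0 ∷ [])

  private
    leBorrow-decides : ∀ p s → Decides (val (tail s) + bit (head s) ≤ val p) (⟦ leBorrowP ⟧ₚ (p ∷ s ∷ []))
    leBorrow-decides = recTree-ind (λ p s r → Decides (val (tail s) + bit (head s) ≤ val p) r)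
      (λ s → base (head s) (tail s)) λ a p s r → let open Borrow a p s in decides-map ascend descend
      where
      base : ∀ c q → Decides (val q + bit c ≤ 0) (ifT c nil (⟦ isZeroP ⟧ₚ (q ∷ [])))
      base nil q = decides-map (λ e → ≤-reflexive (trans (+-identityʳ (val q)) e))
                               (λ h → n≤0⇒n≡0 (≤-trans (m≤m+n (val q) 0) h)) (isZero-decides q)
      base (_ ∙ _) q = fails (λ h → n≮0 (≤-trans (m≤n+m 1 (val q)) h))

  le-decides : ∀ x y → Decides (val x ≤ val y) (⟦ leP ⟧ₚ (x ∷ y ∷ []))
  le-decides x y = decides-map (≤-trans (m≤m+n (val x) 0)) (≤-trans (≤-reflexive (+-identityʳ (val x))))
    (leBorrow-decides y (nil ∙ x))

opaque
  -- Horner's rule in the bits of the first factor. Doubling only prepends `nil`, so each step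
  -- lengthens the result by at most `size y + 2`; this is the additive growth that `recP` asks for.
  mulP : PTm 2
  mulP = recP v0 nilP nilP nilP (iteP v1 (callP addP (v5 ∷ consP nilP v0 ∷ [])) (consP nilP v0))
    (pb-const 0) (λ a l s ρ → z≤n)
    {h = λ ρ → size (lookup ρ (suc (suc (suc (suc zero))))) + 2} (pb-+ (sizeP v4) (pb-const 2)) size-up
    where
    size-up : ∀ r (a l s : Tree) (ρ : Vec Tree 2) →
      size (ifT a (⟦ addP ⟧ₚ (lookup ρ (suc zero) ∷ (nil ∙ r) ∷ [])) (nil ∙ r)) ≤ size r + (size (lookup ρ (suc zero)) + 2)
    size-up r a l s (x ∷ y ∷ []) = size-ifT a (⟦ addP ⟧ₚ (y ∷ (nil ∙ r) ∷ [])) (nil ∙ r)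
      (≤-trans (add-size y (nil ∙ r)) (≤-reflexive (shuffle (size y) (size r))))
      (≤-trans (≤-reflexive (+-comm 1 (size r))) (+-monoʳ-≤ (size r) (≤-trans (s≤s z≤n) (m≤n+m 2 (size y)))))
      where
      shuffle : ∀ y r → y + (1 + r + 1) ≡ r + (y + 2)
      shuffle = solve-∀

  mul-val : ∀ x y → val (⟦ mulP ⟧ₚ (x ∷ y ∷ [])) ≡ val x * val y
  mul-val nil y = refl
  mul-val (nil ∙ x) y = trans (cong (2 *_) (mul-val x y)) (sym (*-assoc 2 (val x) (val y)))
  mul-val ((_ ∙ _) ∙ x) y = trans (add-val y (nil ∙ ⟦ mulP ⟧ₚ (x ∷ y ∷ [])))
    (cong (λ z → val y + z) (trans (cong (2 *_) (mul-val x y)) (sym (*-assoc 2 (val x) (val y)))))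

-- Canonical numerals and division

bits-even : ∀ k → bits (2 * suc k) ≡ false ∷ bits (suc k)
bits-even zero    = refl
bits-even (suc k) = trans (cong bits (*-suc 2 (suc k))) (cong (λ b → increment (increment b)) (bits-even k))

bits-odd : ∀ k → bits (1 + 2 * suc k) ≡ true ∷ bits (suc k)
bits-odd k = cong increment (bits-even k)

-- The output has to be an `encodeVec` literally, so quotients must be free of leading zeros. Zero
-- is the empty list here, although `encodeℕ 0` has one digit; `signedP` repairs this and also
-- prevents a negative zero.
data Canonical : Tree → Set where
  zero : Canonical nil
  pos  : ∀ k → Canonical (encodeℕ (suc k))

canonical-1∙ : ∀ {t} → Canonical t → Canonical (one ∙ t)
canonical-1∙ zero    = pos 0
canonical-1∙ (pos k) = subst Canonical (cong (encodeList encodeBool) (bits-odd k)) (pos (2 * suc k))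

canonical-0∙ : ∀ {t} → Canonical t → Canonical (ifT t (nil ∙ t) nil)
canonical-0∙ zero    = zero
canonical-0∙ (pos k) with encodeℕ (suc k) in eq
... | nil   = zero
-- `2 * suc k` unfolds to `suc (k + suc (k + 0))`.
... | _ ∙ _ = subst Canonical (trans (cong (encodeList encodeBool) (bits-even k)) (cong (nil ∙_) eq)) (pos (k + suc (k + 0)))

val-increment : ∀ bs → val (encodeList encodeBool (increment bs)) ≡ suc (val (encodeList encodeBool bs))
val-increment []           = refl
val-increment (false ∷ bs) = refl
val-increment (true ∷ bs)  = trans (cong (2 *_) (val-increment bs)) (*-suc 2 _)

val-encodeℕ : ∀ n → val (encodeℕ n) ≡ n
val-encodeℕ zero    = refl
val-encodeℕ (suc n) = trans (val-increment (bits n)) (cong suc (val-encodeℕ n))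

opaque
  private
    divUp : PTm 6
    divUp = iteP (callP leP (callP mulP (v5 ∷ consP oneP v0 ∷ []) ∷ consP v1 v2 ∷ [])) (consP oneP v0) (iteP v0 (consP nilP v0) nilP)

  -- Long division from the top bit. If `r` is the quotient of the higher bits, the next bit is
  -- found by comparing `d * (1 + 2 * r)` with the dividend read so far, so the loop passes on the
  -- quotient and no remainder.
  divP : PTm 2
  divP = recP v0 nilP nilP nilP divUp (pb-const 0) (λ a l s ρ → z≤n) (pb-const 1)
    (λ r a l s ρ → size-ifT (⟦ callP leP (callP mulP (v5 ∷ consP oneP v0 ∷ []) ∷ consP v1 v2 ∷ []) ⟧ₚ (r ∷ a ∷ l ∷ s ∷ ρ))
                            (one ∙ r) (ifT r (nil ∙ r) nil) (≤-reflexive (+-comm 1 (size r)))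
                            (size-ifT r (nil ∙ r) nil (≤-reflexive (+-comm 1 (size r))) z≤n))

  div-canonical : ∀ w d → Canonical (⟦ divP ⟧ₚ (w ∷ d ∷ []))
  div-canonical w d = recTree-ind (λ _ _ → Canonical) (λ _ → zero)
    (λ a l s r → step (⟦ leP ⟧ₚ (⟦ mulP ⟧ₚ (d ∷ (one ∙ r) ∷ []) ∷ (a ∙ l) ∷ []))) w nil
    where
    step : ∀ t {r} → Canonical r → Canonical (ifT t (one ∙ r) (ifT r (nil ∙ r) nil))
    step nil     = canonical-0∙
    step (_ ∙ _) = canonical-1∙

  div-bounds : ∀ w d → 0 < val d → let q = val (⟦ divP ⟧ₚ (w ∷ d ∷ [])) in
               val d * q ≤ val w × val w < val d * suc q
  div-bounds w d d>0 = recTree-ind (λ w _ r → val d * val r ≤ val w × val w < val d * suc (val r))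
    (λ _ → ≤-reflexive (*-zeroʳ (val d)) , ≤-trans d>0 (≤-reflexive (sym (*-identityʳ (val d)))))
    (λ a l s r → step a l r (le-decides (⟦ mulP ⟧ₚ (d ∷ (one ∙ r) ∷ [])) (a ∙ l))) w nil
    where
    D : ℕ
    D = val d
    val-0∙ : ∀ r → val (ifT r (nil ∙ r) nil) ≡ 2 * val r
    val-0∙ nil     = refl
    val-0∙ (_ ∙ _) = refl
    double : ∀ d r → d * (2 * r) ≡ 2 * (d * r)
    double = solve-∀
    double-suc : ∀ d r → d * (2 + 2 * r) ≡ 2 * (d * suc r)
    double-suc = solve-∀
    step : ∀ a l r {t} → Decides (val (⟦ mulP ⟧ₚ (d ∷ (one ∙ r) ∷ [])) ≤ val (a ∙ l)) t →
           D * val r ≤ val l × val l < D * suc (val r) →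
           let q = val (ifT t (one ∙ r) (ifT r (nil ∙ r) nil)) in D * q ≤ val (a ∙ l) × val (a ∙ l) < D * suc q
    step a l r (holds p) (_ , hi) = ≤-trans (≤-reflexive (sym (mul-val d (one ∙ r)))) p ,
      ≤-trans (s≤s (+-monoˡ-≤ (2 * val l) (bit≤1 a)))
        (≤-trans (≤-reflexive (sym (*-suc 2 (val l)))) (≤-trans (*-monoʳ-≤ 2 hi) (≤-reflexive (sym (double-suc D (val r))))))
    step a l r (fails ¬p) (lo , _) rewrite val-0∙ r =
      ≤-trans (≤-reflexive (double D (val r))) (≤-trans (*-monoʳ-≤ 2 lo) (m≤n+m _ (bit a))) ,
      ≰⇒> (λ p → ¬p (≤-trans (≤-reflexive (mul-val d (one ∙ r))) p))

div-exact : ∀ w d q → 0 < val d → val w ≡ val d * q → val (⟦ divP ⟧ₚ (w ∷ d ∷ [])) ≡ q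
div-exact w d q d>0 eq with div-bounds w d d>0
... | lo , hi = ≤-antisym (*-cancelˡ-≤ (val d) ⦃ >-nonZero d>0 ⦄ (≤-trans lo (≤-reflexive eq)))
                  (≤-pred (*-cancelˡ-< (val d) q _ (≤-trans (s≤s (≤-reflexive (sym eq))) hi)))

-- Integers occur in two formats: as input, sign ∙ magnitude (valS); in intermediate
-- results, as formal differences p ∙ q of naturals (valD).
valD valS : Tree → ℤ
valD t = + val (head t) ℤ.- + val (tail t)
valS t = ifT (head t) (ℤ.- (+ val (tail t))) (+ val (tail t))

valS-encodeℤ : ∀ z → valS (encodeℤ z) ≡ z
valS-encodeℤ (+ n)    = cong +_ (val-encodeℕ n)
valS-encodeℤ -[1+ n ] = cong (λ m → ℤ.- (+ m)) (val-encodeℕ (suc n))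

opaque
  toDP : PTm 1
  toDP = iteP (hdP v0) (consP nilP (tlP v0)) (consP (tlP v0) nilP)

  toD-val : ∀ t → valD (⟦ toDP ⟧ₚ (t ∷ [])) ≡ valS t
  toD-val t with head t
  ... | nil   = ℤₚ.+-identityʳ _
  ... | _ ∙ _ = ℤₚ.+-identityˡ _

opaque
  addDP : PTm 2
  addDP = consP (callP addP (hdP v0 ∷ hdP v1 ∷ [])) (callP addP (tlP v0 ∷ tlP v1 ∷ []))

  addD-val : ∀ x y → valD (⟦ addDP ⟧ₚ (x ∷ y ∷ [])) ≡ valD x ℤ.+ valD y
  addD-val x y = trans (cong₂ (λ a b → + a ℤ.- + b) (add-val (head x) (head y)) (add-val (tail x) (tail y)))
    (trans (cong₂ ℤ._-_ (ℤₚ.pos-+ (val (head x)) (val (head y))) (ℤₚ.pos-+ (val (tail x)) (val (tail y))))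
           (shuffle (+ val (head x)) (+ val (head y)) (+ val (tail x)) (+ val (tail y))))
    where
    shuffle : ∀ a b c d → (a ℤ.+ b) ℤ.- (c ℤ.+ d) ≡ (a ℤ.- c) ℤ.+ (b ℤ.- d)
    shuffle = ℤ-Ring.solve-∀

  addD-size : ∀ x y → size (⟦ addDP ⟧ₚ (x ∷ y ∷ [])) ≤ size x + (size y + 3)
  addD-size x y = ≤-trans (size-∙ (⟦ addP ⟧ₚ (head x ∷ head y ∷ [])) (⟦ addP ⟧ₚ (tail x ∷ tail y ∷ [])))
    (≤-trans (s≤s (+-mono-≤ (add-size (head x) (head y)) (add-size (tail x) (tail y))))
    (≤-trans (≤-reflexive (shuffle (size (head x)) (size (head y)) (size (tail x)) (size (tail y))))
             (+-mono-≤ (halves x) (+-monoˡ-≤ 3 (halves y)))))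
    where
    halves : ∀ t → size (head t) + size (tail t) ≤ size t
    halves nil     = z≤n
    halves (l ∙ r) = +-monoˡ-≤ (size r) (m≤n⊔m 1 (size l))
    shuffle : ∀ a b c d → 1 + (a + (b + 1) + (c + (d + 1))) ≡ a + c + (b + d + 3)
    shuffle = solve-∀

opaque
  mulDP : PTm 2
  mulDP = consP
    (callP addP (callP mulP (hdP v0 ∷ hdP v1 ∷ []) ∷ callP mulP (tlP v0 ∷ tlP v1 ∷ []) ∷ []))
    (callP addP (callP mulP (hdP v0 ∷ tlP v1 ∷ []) ∷ callP mulP (tlP v0 ∷ hdP v1 ∷ []) ∷ []))

  mulD-val : ∀ x y → valD (⟦ mulDP ⟧ₚ (x ∷ y ∷ [])) ≡ valD x ℤ.* valD y
  mulD-val x y = trans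
    (cong₂ ℤ._-_ (half (head x) (head y) (tail x) (tail y)) (half (head x) (tail y) (tail x) (head y)))
    (shuffle (+ val (head x)) (+ val (head y)) (+ val (tail x)) (+ val (tail y)))
    where
    half : ∀ a b c d → + val (⟦ addP ⟧ₚ (⟦ mulP ⟧ₚ (a ∷ b ∷ []) ∷ ⟦ mulP ⟧ₚ (c ∷ d ∷ []) ∷ []))
                       ≡ + val a ℤ.* + val b ℤ.+ + val c ℤ.* + val d
    half a b c d = trans (cong +_ (trans (add-val _ _) (cong₂ _+_ (mul-val a b) (mul-val c d))))
      (trans (ℤₚ.pos-+ (val a * val b) (val c * val d)) (cong₂ ℤ._+_ (ℤₚ.pos-* (val a) (val b)) (ℤₚ.pos-* (val c) (val d))))
    shuffle : ∀ a b c d → (a ℤ.* b ℤ.+ c ℤ.* d) ℤ.- (a ℤ.* d ℤ.+ c ℤ.* b) ≡ (a ℤ.- c) ℤ.* (b ℤ.- d)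
    shuffle = ℤ-Ring.solve-∀

opaque
  leDP : PTm 2
  leDP = callP leP (callP addP (hdP v0 ∷ tlP v1 ∷ []) ∷ callP addP (hdP v1 ∷ tlP v0 ∷ []) ∷ [])

  leD-decides : ∀ x y → Decides (valD x ℤ.≤ valD y) (⟦ leDP ⟧ₚ (x ∷ y ∷ []))
  leD-decides x y = decides-map to from
    (le-decides (⟦ addP ⟧ₚ (head x ∷ tail y ∷ [])) (⟦ addP ⟧ₚ (head y ∷ tail x ∷ [])))
    where
    a b c d : ℤ
    a = + val (head x)
    b = + val (tail x)
    c = + val (head y)
    d = + val (tail y)
    cross₁ : ∀ a b d → a ℤ.+ d ℤ.+ (ℤ.- b ℤ.- d) ≡ a ℤ.- b
    cross₁ = ℤ-Ring.solve-∀
    cross₂ : ∀ b c d → c ℤ.+ b ℤ.+ (ℤ.- b ℤ.- d) ≡ c ℤ.- d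
    cross₂ = ℤ-Ring.solve-∀
    cross₃ : ∀ a b d → a ℤ.- b ℤ.+ (b ℤ.+ d) ≡ a ℤ.+ d
    cross₃ = ℤ-Ring.solve-∀
    cross₄ : ∀ b c d → c ℤ.- d ℤ.+ (b ℤ.+ d) ≡ c ℤ.+ b
    cross₄ = ℤ-Ring.solve-∀
    sumX : + val (⟦ addP ⟧ₚ (head x ∷ tail y ∷ [])) ≡ a ℤ.+ d
    sumX = trans (cong +_ (add-val (head x) (tail y))) (ℤₚ.pos-+ (val (head x)) (val (tail y)))
    sumY : + val (⟦ addP ⟧ₚ (head y ∷ tail x ∷ [])) ≡ c ℤ.+ b
    sumY = trans (cong +_ (add-val (head y) (tail x))) (ℤₚ.pos-+ (val (head y)) (val (tail x)))
    to : val (⟦ addP ⟧ₚ (head x ∷ tail y ∷ [])) ≤ val (⟦ addP ⟧ₚ (head y ∷ tail x ∷ [])) → valD x ℤ.≤ valD y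
    to h = subst₂ ℤ._≤_ (trans (cong (ℤ._+ (ℤ.- b ℤ.- d)) sumX) (cross₁ a b d))
                        (trans (cong (ℤ._+ (ℤ.- b ℤ.- d)) sumY) (cross₂ b c d))
                        (ℤₚ.+-monoˡ-≤ (ℤ.- b ℤ.- d) (ℤ.+≤+ h))
    from : valD x ℤ.≤ valD y → val (⟦ addP ⟧ₚ (head x ∷ tail y ∷ [])) ≤ val (⟦ addP ⟧ₚ (head y ∷ tail x ∷ []))
    from h = ℤₚ.drop‿+≤+ (subst₂ ℤ._≤_ (trans (cross₃ a b d) (sym sumX)) (trans (cross₄ b c d) (sym sumY))
                        (ℤₚ.+-monoˡ-≤ (b ℤ.+ d) h))

ifT-encodeℕ-suc : ∀ k {X : Set} (x y : X) → ifT (encodeℕ (suc k)) x y ≡ x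
ifT-encodeℕ-suc k x y with bits k
... | []        = refl
... | false ∷ _ = refl
... | true ∷ _  = refl

opaque
  signedP : PTm 2
  signedP = iteP v1 (consP v0 v1) (consP nilP (consP nilP nilP))

  signed-pos : ∀ {t} → Canonical t → ⟦ signedP ⟧ₚ (nil ∷ t ∷ []) ≡ encodeℤ (+ val t)
  signed-pos zero    = refl
  signed-pos (pos k) = trans (ifT-encodeℕ-suc k _ _) (cong (λ m → encodeℤ (+ m)) (sym (val-encodeℕ (suc k))))

  signed-neg : ∀ {t} → Canonical t → ⟦ signedP ⟧ₚ (one ∷ t ∷ []) ≡ encodeℤ (ℤ.- (+ val t))
  signed-neg zero    = refl
  signed-neg (pos k) = trans (ifT-encodeℕ-suc k _ _) (cong (λ m → encodeℤ (ℤ.- (+ m))) (sym (val-encodeℕ (suc k))))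

opaque
  quotP : PTm 2
  quotP = iteP (callP leP (tlP v0 ∷ hdP v0 ∷ []))
    (callP signedP (nilP ∷ callP divP (callP subP (hdP v0 ∷ tlP v0 ∷ []) ∷ v1 ∷ []) ∷ []))
    (callP signedP (oneP ∷ callP divP (callP subP (tlP v0 ∷ hdP v0 ∷ []) ∷ v1 ∷ []) ∷ []))

  -- No exactness and no positivity of `d` is assumed: a candidate that describes no integer point
  -- still yields some integer vector, and it is left to the feasibility test to judge it.
  quot-encoded : ∀ w d → ∃[ z ] (⟦ quotP ⟧ₚ (w ∷ d ∷ []) ≡ encodeℤ z)
  quot-encoded w d with ⟦ leP ⟧ₚ (tail w ∷ head w ∷ [])
  ... | nil   = ℤ.- (+ val (⟦ divP ⟧ₚ (⟦ subP ⟧ₚ (tail w ∷ head w ∷ []) ∷ d ∷ []))) ,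
                signed-neg (div-canonical (⟦ subP ⟧ₚ (tail w ∷ head w ∷ [])) d)
  ... | _ ∙ _ = + val (⟦ divP ⟧ₚ (⟦ subP ⟧ₚ (head w ∷ tail w ∷ []) ∷ d ∷ [])) ,
                signed-pos (div-canonical (⟦ subP ⟧ₚ (head w ∷ tail w ∷ [])) d)

  quot-exact : ∀ w d z → 0 < val d → valD w ≡ + val d ℤ.* z → ⟦ quotP ⟧ₚ (w ∷ d ∷ []) ≡ encodeℤ z
  quot-exact w d z d>0 eq with ⟦ leP ⟧ₚ (tail w ∷ head w ∷ []) | le-decides (tail w) (head w)
  ... | _ ∙ _ | holds q≤p = trans (signed-pos (div-canonical s d))
        (cong encodeℤ (trans (cong +_ (div-exact s d ∣ z ∣ d>0 abs)) (cancel (+ ∣ z ∣)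
          (trans (sym (ℤₚ.pos-* (val d) ∣ z ∣)) (trans (cong +_ (sym abs)) diff)))))
    where
    s : Tree
    s = ⟦ subP ⟧ₚ (head w ∷ tail w ∷ [])
    instance
      d≢0 : ℤ.NonZero (+ val d)
      d≢0 = ℤ.>-nonZero {+ val d} (ℤ.+<+ d>0)
    cancel : ∀ y → + val d ℤ.* y ≡ + val d ℤ.* z → y ≡ z
    cancel y = ℤₚ.*-cancelˡ-≡ (+ val d) y z
    difference : ∀ a b → a ≡ (a ℤ.+ b) ℤ.- b
    difference = ℤ-Ring.solve-∀
    diff : + val s ≡ + val d ℤ.* z
    diff = trans (difference (+ val s) (+ val (tail w)))
      (trans (cong (λ x → x ℤ.- + val (tail w)) (trans (sym (ℤₚ.pos-+ (val s) (val (tail w)))) (cong +_ (sub-val (head w) (tail w) q≤p)))) eq)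
    abs : val s ≡ val d * ∣ z ∣
    abs = trans (cong ∣_∣ diff) (ℤₚ.abs-* (+ val d) z)
  ... | nil | fails q≰p = trans (signed-neg (div-canonical s d))
        (cong encodeℤ (trans (cong (λ m → ℤ.- (+ m)) (div-exact s d ∣ z ∣ d>0 abs)) (cancel (ℤ.- (+ ∣ z ∣))
          (trans (sym (ℤₚ.neg-distribʳ-* (+ val d) (+ ∣ z ∣)))
            (trans (cong ℤ.-_ (trans (sym (ℤₚ.pos-* (val d) ∣ z ∣)) (cong +_ (sym abs)))) diff)))))
    where
    s : Tree
    s = ⟦ subP ⟧ₚ (tail w ∷ head w ∷ [])
    instance
      d≢0 : ℤ.NonZero (+ val d)
      d≢0 = ℤ.>-nonZero {+ val d} (ℤ.+<+ d>0)
    cancel : ∀ y → + val d ℤ.* y ≡ + val d ℤ.* z → y ≡ z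
    cancel y = ℤₚ.*-cancelˡ-≡ (+ val d) y z
    difference : ∀ a b → ℤ.- a ≡ b ℤ.- (a ℤ.+ b)
    difference = ℤ-Ring.solve-∀
    diff : ℤ.- (+ val s) ≡ + val d ℤ.* z
    diff = trans (difference (+ val s) (+ val (head w)))
      (trans (cong (λ x → + val (head w) ℤ.- x) (trans (sym (ℤₚ.pos-+ (val s) (val (head w))))
        (cong +_ (sub-val (tail w) (head w) (<⇒≤ (≰⇒> q≰p)))))) eq)
    abs : val s ≡ val d * ∣ z ∣
    abs = trans (trans (sym (ℤₚ.∣-i∣≡∣i∣ (+ val s))) (cong ∣_∣ diff)) (ℤₚ.abs-* (+ val d) z)

-- Descent to a solution with small coefficients

∑ : ∀ {n} → (Fin n → ℤ) → ℤ
∑ {zero}  f = 0ℤ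
∑ {suc n} f = f zero ℤ.+ ∑ (f ∘ suc)

∑-cong : ∀ {n} {f g : Fin n → ℤ} → (∀ i → f i ≡ g i) → ∑ f ≡ ∑ g
∑-cong {zero}  e = refl
∑-cong {suc n} e = cong₂ ℤ._+_ (e zero) (∑-cong (e ∘ suc))

∑-+ : ∀ {n} (f g : Fin n → ℤ) → ∑ (λ i → f i ℤ.+ g i) ≡ ∑ f ℤ.+ ∑ g
∑-+ {zero}  f g = refl
∑-+ {suc n} f g = trans (cong (λ z → f zero ℤ.+ g zero ℤ.+ z) (∑-+ (f ∘ suc) (g ∘ suc)))
  (shuffle (f zero) (g zero) (∑ (f ∘ suc)) (∑ (g ∘ suc)))
  where
  shuffle : ∀ a b c d → a ℤ.+ b ℤ.+ (c ℤ.+ d) ≡ a ℤ.+ c ℤ.+ (b ℤ.+ d)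
  shuffle = ℤ-Ring.solve-∀

∑-* : ∀ {n} c (f : Fin n → ℤ) → ∑ (λ i → c ℤ.* f i) ≡ c ℤ.* ∑ f
∑-* {zero}  c f = sym (ℤₚ.*-zeroʳ c)
∑-* {suc n} c f = trans (cong (λ z → c ℤ.* f zero ℤ.+ z) (∑-* c (f ∘ suc))) (sym (ℤₚ.*-distribˡ-+ c (f zero) (∑ (f ∘ suc))))

∑-0 : ∀ n → ∑ {n} (λ _ → 0ℤ) ≡ 0ℤ
∑-0 zero    = refl
∑-0 (suc n) = trans (ℤₚ.+-identityˡ _) (∑-0 n)

∑-swap : ∀ {m n} (f : Fin m → Fin n → ℤ) → ∑ (λ i → ∑ (f i)) ≡ ∑ (λ j → ∑ (λ i → f i j))
∑-swap {zero}  {n} f = sym (∑-0 n)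
∑-swap {suc m} f = trans (cong (λ z → ∑ (f zero) ℤ.+ z) (∑-swap (f ∘ suc))) (sym (∑-+ (f zero) (λ j → ∑ (λ i → f (suc i) j))))

∑-bound : ∀ {n} (f : Fin n → ℤ) B → (∀ i → ∣ f i ∣ ≤ B) → ∣ ∑ f ∣ ≤ n * B
∑-bound {zero}  f B p = z≤n
∑-bound {suc n} f B p = ≤-trans (ℤₚ.∣i+j∣≤∣i∣+∣j∣ (f zero) (∑ (f ∘ suc))) (+-mono-≤ (p zero) (∑-bound (f ∘ suc) B (p ∘ suc)))

dot : ∀ {n} → (Fin n → ℤ) → (Fin n → ℤ) → ℤ
dot u v = ∑ (λ i → u i ℤ.* v i)

dot-comm : ∀ {n} (u v : Fin n → ℤ) → dot u v ≡ dot v u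
dot-comm u v = ∑-cong (λ i → ℤₚ.*-comm (u i) (v i))

dot-+ : ∀ {n} (u v w : Fin n → ℤ) → dot u (λ j → v j ℤ.+ w j) ≡ dot u v ℤ.+ dot u w
dot-+ u v w = trans (∑-cong (λ i → ℤₚ.*-distribˡ-+ (u i) (v i) (w i))) (∑-+ (λ i → u i ℤ.* v i) (λ i → u i ℤ.* w i))

dot-* : ∀ {n} (u : Fin n → ℤ) c v → dot u (λ j → c ℤ.* v j) ≡ c ℤ.* dot u v
dot-* u c v = trans (∑-cong (λ i → shuffle (u i) c (v i))) (∑-* c (λ i → u i ℤ.* v i))
  where
  shuffle : ∀ u c v → u ℤ.* (c ℤ.* v) ≡ c ℤ.* (u ℤ.* v)
  shuffle = ℤ-Ring.solve-∀

dot-∑ : ∀ {n r} (u : Fin n → ℤ) (y : Fin r → ℤ) (g : Fin r → Fin n → ℤ) →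
        dot u (λ j → ∑ (λ k → y k ℤ.* g k j)) ≡ ∑ (λ k → y k ℤ.* dot u (g k))
dot-∑ u y g = trans (∑-cong (λ j → sym (∑-* (u j) (λ k → y k ℤ.* g k j))))
  (trans (∑-swap (λ j k → u j ℤ.* (y k ℤ.* g k j))) (∑-cong (λ k → dot-* u (y k) (g k))))

dot-bound : ∀ {n} (u v : Fin n → ℤ) B C → (∀ i → ∣ u i ∣ ≤ B) → (∀ i → ∣ v i ∣ ≤ C) → ∣ dot u v ∣ ≤ n * (B * C)
dot-bound u v B C p q = ∑-bound _ (B * C) (λ i →
  ≤-trans (≤-reflexive (ℤₚ.abs-* (u i) (v i))) (*-mono-≤ (p i) (q i)))

square≥0 : ∀ i → 0ℤ ℤ.≤ i ℤ.* i
square≥0 (+ n) = subst (0ℤ ℤ.≤_) (ℤₚ.pos-* n n) (ℤ.+≤+ z≤n)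
square≥0 -[1+ n ] = ℤ.+≤+ z≤n

dot-self≥0 : ∀ {n} (g : Fin n → ℤ) → 0ℤ ℤ.≤ dot g g
dot-self≥0 {zero}  g = ℤₚ.≤-refl
dot-self≥0 {suc n} g = ℤₚ.+-mono-≤ (square≥0 (g zero)) (dot-self≥0 (g ∘ suc))

dot-self≡0 : ∀ {n} (g : Fin n → ℤ) → dot g g ≡ 0ℤ → ∀ i → g i ≡ 0ℤ
dot-self≡0 {suc n} g e zero = [ (λ x → x) , (λ x → x) ]′ (ℤₚ.i*j≡0⇒i≡0∨j≡0 (g zero) (ℤₚ.≤-antisym
    (ℤₚ.≤-trans (ℤₚ.i≤i+j (g zero ℤ.* g zero) (dot (g ∘ suc) (g ∘ suc)) ⦃ ℤ.nonNegative (dot-self≥0 (g ∘ suc)) ⦄) (ℤₚ.≤-reflexive e))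
    (square≥0 (g zero))))
dot-self≡0 {suc n} g e (suc i) = dot-self≡0 (g ∘ suc) (ℤₚ.≤-antisym
    (ℤₚ.≤-trans (ℤₚ.i≤j+i (dot (g ∘ suc) (g ∘ suc)) (g zero ℤ.* g zero) ⦃ ℤ.nonNegative (square≥0 (g zero)) ⦄) (ℤₚ.≤-reflexive e))
    (dot-self≥0 (g ∘ suc))) i

i≤∣i∣ : ∀ i → i ℤ.≤ + ∣ i ∣
i≤∣i∣ (+ n)    = ℤₚ.≤-refl
i≤∣i∣ -[1+ n ] = ℤ.-≤+

abs-≤ : ∀ i N → ℤ.- i ℤ.≤ + N → i ℤ.≤ + N → ∣ i ∣ ≤ N
abs-≤ (+ n)    N p q = ℤₚ.drop‿+≤+ q
abs-≤ -[1+ n ] N p q = ℤₚ.drop‿+≤+ p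

∣i∣≤∣2i∣ : ∀ i → ∣ i ∣ ≤ ∣ + 2 ℤ.* i ∣
∣i∣≤∣2i∣ i = ≤-trans (m≤n*m ∣ i ∣ 2) (≤-reflexive (sym (ℤₚ.abs-* (+ 2) i)))

double-zero : ∀ i → 0ℤ ℤ.≤ + 2 ℤ.* i → 0ℤ ℤ.≤ ℤ.- (+ 2 ℤ.* i) → i ≡ 0ℤ
double-zero (+ zero)  p q = refl
double-zero (+ suc n) p ()
double-zero -[1+ n ] () q

direction : ∀ i → i ≢ 0ℤ → ∃[ s ] (∣ s ∣ ≤ 1 × 1ℤ ℤ.≤ s ℤ.* i)
direction (+ zero)  i≢0 = ⊥-elim (i≢0 refl)
direction (+ suc n) i≢0 = 1ℤ , ≤-refl , subst (1ℤ ℤ.≤_) (sym (ℤₚ.*-identityˡ (+ suc n))) (ℤ.+≤+ (s≤s z≤n))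
direction -[1+ n ]  i≢0 = -1ℤ , ≤-refl , ℤ.+≤+ (s≤s z≤n)

unit : ∀ {n} → Fin n → Fin n → ℤ
unit zero    zero    = 1ℤ
unit zero    (suc j) = 0ℤ
unit (suc i) zero    = 0ℤ
unit (suc i) (suc j) = unit i j

unit≤1 : ∀ {n} (i j : Fin n) → ∣ unit i j ∣ ≤ 1
unit≤1 zero    zero    = ≤-refl
unit≤1 zero    (suc j) = z≤n
unit≤1 (suc i) zero    = z≤n
unit≤1 (suc i) (suc j) = unit≤1 i j

∑-unit : ∀ {n} (x : Fin n → ℤ) j → ∑ (λ i → x i ℤ.* unit i j) ≡ x j
∑-unit {suc n} x zero = trans (cong₂ ℤ._+_ (ℤₚ.*-identityʳ (x zero))
  (trans (∑-cong (λ i → ℤₚ.*-zeroʳ (x (suc i)))) (∑-0 n))) (ℤₚ.+-identityʳ (x zero))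
∑-unit {suc n} x (suc j) = trans (cong₂ ℤ._+_ (ℤₚ.*-zeroʳ (x zero)) (∑-unit (x ∘ suc) j)) (ℤₚ.+-identityˡ (x (suc j)))

-- The linear map annihilating g when δ = h · g.
project : ∀ {n} → ℤ → (h g u : Fin n → ℤ) → Fin n → ℤ
project δ h g u j = δ ℤ.* u j ℤ.- dot h u ℤ.* g j

module _ {n} (δ : ℤ) (h g : Fin n → ℤ) where
  private T = project δ h g

  project-cong : ∀ {u w} → (∀ j → u j ≡ w j) → ∀ j → T u j ≡ T w j
  project-cong e j = cong₂ (λ a b → δ ℤ.* a ℤ.- b ℤ.* g j) (e j) (∑-cong (λ i → cong (h i ℤ.*_) (e i)))

  project-+ : ∀ u w j → T (λ i → u i ℤ.+ w i) j ≡ T u j ℤ.+ T w j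
  project-+ u w j = trans (cong (λ b → δ ℤ.* (u j ℤ.+ w j) ℤ.- b ℤ.* g j) (dot-+ h u w))
    (shuffle δ (u j) (w j) (dot h u) (dot h w) (g j))
    where
    shuffle : ∀ d u w a b g → d ℤ.* (u ℤ.+ w) ℤ.- (a ℤ.+ b) ℤ.* g ≡ (d ℤ.* u ℤ.- a ℤ.* g) ℤ.+ (d ℤ.* w ℤ.- b ℤ.* g)
    shuffle = ℤ-Ring.solve-∀

  project-* : ∀ c u j → T (λ i → c ℤ.* u i) j ≡ c ℤ.* T u j
  project-* c u j = trans (cong (λ b → δ ℤ.* (c ℤ.* u j) ℤ.- b ℤ.* g j) (dot-* h c u)) (shuffle δ c (u j) (dot h u) (g j))
    where
    shuffle : ∀ d c u a g → d ℤ.* (c ℤ.* u) ℤ.- (c ℤ.* a) ℤ.* g ≡ c ℤ.* (d ℤ.* u ℤ.- a ℤ.* g)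
    shuffle = ℤ-Ring.solve-∀

  project-∑ : ∀ {r} (y : Fin r → ℤ) (u : Fin r → Fin n → ℤ) j →
              T (λ i → ∑ (λ k → y k ℤ.* u k i)) j ≡ ∑ (λ k → y k ℤ.* T (u k) j)
  project-∑ y u j = begin
    δ ℤ.* ∑ (λ k → y k ℤ.* u k j) ℤ.- dot h (λ i → ∑ (λ k → y k ℤ.* u k i)) ℤ.* g j
      ≡⟨ cong₂ (λ a b → a ℤ.- b ℤ.* g j) (sym (∑-* δ (λ k → y k ℤ.* u k j))) (dot-∑ h y u) ⟩
    ∑ (λ k → δ ℤ.* (y k ℤ.* u k j)) ℤ.- ∑ (λ k → y k ℤ.* dot h (u k)) ℤ.* g j
      ≡⟨ cong (λ z → ∑ (λ k → δ ℤ.* (y k ℤ.* u k j)) ℤ.+ z)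
           (trans (swap (∑ (λ k → y k ℤ.* dot h (u k))) (g j)) (sym (∑-* (ℤ.- g j) (λ k → y k ℤ.* dot h (u k))))) ⟩
    ∑ (λ k → δ ℤ.* (y k ℤ.* u k j)) ℤ.+ ∑ (λ k → ℤ.- g j ℤ.* (y k ℤ.* dot h (u k)))
      ≡⟨ sym (∑-+ (λ k → δ ℤ.* (y k ℤ.* u k j)) (λ k → ℤ.- g j ℤ.* (y k ℤ.* dot h (u k)))) ⟩
    ∑ (λ k → δ ℤ.* (y k ℤ.* u k j) ℤ.+ ℤ.- g j ℤ.* (y k ℤ.* dot h (u k)))
      ≡⟨ ∑-cong (λ k → shuffle δ (y k) (u k j) (dot h (u k)) (g j)) ⟩
    ∑ (λ k → y k ℤ.* T (u k) j) ∎
    where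
    open ≡-Reasoning
    swap : ∀ a g → ℤ.- (a ℤ.* g) ≡ ℤ.- g ℤ.* a
    swap = ℤ-Ring.solve-∀
    shuffle : ∀ d y u a g → d ℤ.* (y ℤ.* u) ℤ.+ ℤ.- g ℤ.* (y ℤ.* a) ≡ y ℤ.* (d ℤ.* u ℤ.- a ℤ.* g)
    shuffle = ℤ-Ring.solve-∀

  project-kills : δ ≡ dot h g → ∀ j → T g j ≡ 0ℤ
  project-kills refl j = ℤₚ.+-inverseʳ (dot h g ℤ.* g j)

-- `β nothing` is the value of a dummy slot. It is taken by a direction that is removed without the
-- help of a row, and it enters with coefficient 0, so that the number of slots always equals the
-- number of directions removed. `Q` is a parameter of its own because the argument is later applied
-- to the zero form as well.
module Descent {n m : ℕ} (A : Fin m → Fin n → ℤ) (b : Fin m → ℤ) (Q : Fin n → Fin n → ℤ)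
               (Q-sym : ∀ i j → Q i j ≡ Q j i) (a : ℕ) (A≤a : ∀ i j → ∣ A i j ∣ ≤ a) (Q≤a : ∀ i j → ∣ Q i j ∣ ≤ a)
               (β : Maybe (Fin m) → ℤ) where

  V : Set
  V = Fin n → ℤ

  Feas : V → Set
  Feas x = ∀ i → dot (A i) x ℤ.≤ b i

  Qv : V → V
  Qv x i = dot (Q i) x

  obj : V → ℤ
  obj x = dot x (Qv x)

  adjoint : ∀ u w → dot u (Qv w) ≡ dot w (Qv u)
  adjoint u w = trans (∑-cong (λ i → sym (∑-* (u i) (λ j → Q i j ℤ.* w j))))
    (trans (∑-swap (λ i j → u i ℤ.* (Q i j ℤ.* w j)))
      (∑-cong (λ j → trans (∑-cong (λ i → trans (cong (λ q → u i ℤ.* (q ℤ.* w j)) (Q-sym i j)) (shuffle (u i) (Q j i) (w j))))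
        (∑-* (w j) (λ i → Q j i ℤ.* u i)))))
    where
    shuffle : ∀ u q w → u ℤ.* (q ℤ.* w) ≡ w ℤ.* (q ℤ.* u)
    shuffle = ℤ-Ring.solve-∀

  -- At a feasible `x`, the value `β (just i)` lies between `dot (A i) x` and `b i`. A small slack
  -- against `b i` therefore makes `dot (A i) x` close to `β (just i)`, the only right-hand side
  -- that a candidate can refer to.
  module Tightened (β-upper : ∀ x → Feas x → ∀ i → dot (A i) x ℤ.≤ β (just i)) (β-lower : ∀ i → β (just i) ℤ.≤ b i) where

    -- x lies in the flat d x = v + Σ β(iₖ) cₖ + span gs, described by small coefficients.
    record State (r k B : ℕ) (x : V) : Set where
      field
        d  : ℤ
        v  : V
        is : Fin k → Maybe (Fin m)
        cs : Fin k → V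
        ys : Fin r → ℤ
        gs : Fin r → V
        d≢0 : d ≢ 0ℤ
        d≤B : ∣ d ∣ ≤ B
        v≤B : ∀ j → ∣ v j ∣ ≤ B
        cs≤B : ∀ i j → ∣ cs i j ∣ ≤ B
        gs≤B : ∀ i j → ∣ gs i j ∣ ≤ B
        eq : ∀ j → d ℤ.* x j ≡ v j ℤ.+ (∑ (λ i → β (is i) ℤ.* cs i j) ℤ.+ ∑ (λ i → ys i ℤ.* gs i j))

    module _ (B : ℕ) (2≤B : 2 ≤ B) (n≤B : n ≤ B) (a≤B : a ≤ B) where
      private
        instance
          B≢0 : NonZero B
          B≢0 = >-nonZero (≤-trans (s≤s z≤n) 2≤B)

        B^-mono : ∀ i j → i ≤ j → B ^ i ≤ B ^ j
        B^-mono i j = ^-monoʳ-≤ B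

        double : ∀ {x y} i → x ≤ B ^ i → y ≤ B ^ i → x + y ≤ B ^ suc i
        double i p q = ≤-trans (+-mono-≤ p q) (≤-trans (≤-reflexive (cong (λ z → B ^ i + z) (sym (+-identityʳ (B ^ i))))) (*-monoˡ-≤ (B ^ i) 2≤B))

        times : ∀ {x y} i j → x ≤ B ^ i → y ≤ B ^ j → x * y ≤ B ^ (i + j)
        times i j p q = ≤-trans (*-mono-≤ p q) (≤-reflexive (sym (^-distribˡ-+-* B i j)))

        abs-times : ∀ x y i j → ∣ x ∣ ≤ B ^ i → ∣ y ∣ ≤ B ^ j → ∣ x ℤ.* y ∣ ≤ B ^ (i + j)
        abs-times x y i j p q = ≤-trans (≤-reflexive (ℤₚ.abs-* x y)) (times i j p q)

        one^ : ∀ {x} → x ≤ B → x ≤ B ^ 1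
        one^ p = ≤-trans p (≤-reflexive (sym (*-identityʳ B)))

        dot-≤ : ∀ (u w : V) i j → (∀ l → ∣ u l ∣ ≤ B ^ i) → (∀ l → ∣ w l ∣ ≤ B ^ j) → ∣ dot u w ∣ ≤ B ^ (1 + (i + j))
        dot-≤ u w i j p q = ≤-trans (dot-bound u w _ _ p q)
          (times 1 (i + j) (one^ n≤B) (≤-reflexive (sym (^-distribˡ-+-* B i j))))

      module Reduction {r k x} (σ : State (suc r) k B x) where
        open State σ
        g : V
        g = gs zero

        g≤ : ∀ j → ∣ g j ∣ ≤ B ^ 1
        g≤ j = one^ (gs≤B zero j)

        -- Put `T u = δ u - (h · u) g` with `δ = h · g`. Then `T g = 0`, and
        -- `d δ x = T (d x) + d (h · x) g`; expanding `T (d x)` by the state and `h · x` by the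
        -- given equation leaves the other directions and one new term `β i * (d ε g)`. As for
        -- sizes, `δ` is at most `B ^ 5`, entries of `T u` at most `B ^ 7`, and the new `v`, a sum
        -- of two such terms, at most `B ^ 8`.
        eliminate : ∀ h i ε s → (∀ j → ∣ h j ∣ ≤ B ^ 3) → ∣ ε ∣ ≤ 1 → ∣ s ∣ ≤ B ^ 5 →
                    dot h g ≢ 0ℤ → dot h x ≡ ε ℤ.* β i ℤ.+ s → State r (suc k) (B ^ 8) x
        eliminate h i ε s h≤ ε≤ s≤ δ≢0 hx = record
          { d = d ℤ.* δ
          ; v = λ j → T v j ℤ.+ d ℤ.* s ℤ.* g j
          ; is = i ◂ is
          ; cs = (λ j → d ℤ.* ε ℤ.* g j) ◂ λ l → T (cs l)
          ; ys = ys ∘ suc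
          ; gs = λ l → T (gs (suc l))
          ; d≢0 = λ e → [ d≢0 , δ≢0 ]′ (ℤₚ.i*j≡0⇒i≡0∨j≡0 d e)
          ; d≤B = ≤-trans (abs-times d δ 1 5 (one^ d≤B) δ≤) (B^-mono 6 8 (m≤m+n 6 2))
          ; v≤B = λ j → ≤-trans (ℤₚ.∣i+j∣≤∣i∣+∣j∣ (T v j) (d ℤ.* s ℤ.* g j))
              (double 7 (T≤ v v≤B j) (abs-times (d ℤ.* s) (g j) 6 1 (abs-times d s 1 5 (one^ d≤B) s≤) (g≤ j)))
          ; cs≤B = cs≤
          ; gs≤B = λ l j → ≤-trans (T≤ (gs (suc l)) (gs≤B (suc l)) j) (B^-mono 7 8 (n≤1+n 7))
          ; eq = eq′
          }
          where
          δ = dot h g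
          T = project δ h g
          δ≤ : ∣ δ ∣ ≤ B ^ 5
          δ≤ = dot-≤ h g 3 1 h≤ g≤
          T≤ : ∀ u → (∀ j → ∣ u j ∣ ≤ B) → ∀ j → ∣ T u j ∣ ≤ B ^ 7
          T≤ u u≤ j = ≤-trans (ℤₚ.∣i-j∣≤∣i∣+∣j∣ (δ ℤ.* u j) (dot h u ℤ.* g j))
            (double 6 (abs-times δ (u j) 5 1 δ≤ (one^ (u≤ j)))
                      (abs-times (dot h u) (g j) 5 1 (dot-≤ h u 3 1 h≤ (one^ ∘ u≤)) (g≤ j)))
          cs≤ : ∀ l j → ∣ ((λ j → d ℤ.* ε ℤ.* g j) ◂ λ l → T (cs l)) l j ∣ ≤ B ^ 8
          cs≤ zero j = ≤-trans (abs-times (d ℤ.* ε) (g j) 1 1 (abs-times d ε 1 0 (one^ d≤B) ε≤) (g≤ j)) (B^-mono 2 8 (m≤m+n 2 6))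
          cs≤ (suc l) j = ≤-trans (T≤ (cs l) (cs≤B l) j) (B^-mono 7 8 (n≤1+n 7))
          C G : V
          C j = ∑ (λ l → β (is l) ℤ.* cs l j)
          G j = ∑ (λ l → ys (suc l) ℤ.* gs (suc l) j)
          split : ∀ j → T (λ j → d ℤ.* x j) j ≡
                  T v j ℤ.+ (∑ (λ l → β (is l) ℤ.* T (cs l) j) ℤ.+ ∑ (λ l → ys (suc l) ℤ.* T (gs (suc l)) j))
          split j = begin
            T (λ j → d ℤ.* x j) j ≡⟨ project-cong δ h g eq j ⟩
            T (λ j → v j ℤ.+ (C j ℤ.+ (ys zero ℤ.* g j ℤ.+ G j))) j ≡⟨ project-+ δ h g v _ j ⟩
            T v j ℤ.+ T (λ j → C j ℤ.+ (ys zero ℤ.* g j ℤ.+ G j)) j ≡⟨ cong (λ z → T v j ℤ.+ z) (project-+ δ h g C _ j) ⟩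
            T v j ℤ.+ (T C j ℤ.+ T (λ j → ys zero ℤ.* g j ℤ.+ G j) j)
              ≡⟨ cong (λ z → T v j ℤ.+ (T C j ℤ.+ z)) (project-+ δ h g (λ j → ys zero ℤ.* g j) G j) ⟩
            T v j ℤ.+ (T C j ℤ.+ (T (λ j → ys zero ℤ.* g j) j ℤ.+ T G j))
              ≡⟨ cong (λ z → T v j ℤ.+ (T C j ℤ.+ (z ℤ.+ T G j))) (trans (project-* δ h g (ys zero) g j)
                   (trans (cong (ys zero ℤ.*_) (project-kills δ h g refl j)) (ℤₚ.*-zeroʳ (ys zero)))) ⟩
            T v j ℤ.+ (T C j ℤ.+ (0ℤ ℤ.+ T G j))
              ≡⟨ cong₂ (λ y z → T v j ℤ.+ (y ℤ.+ z)) (project-∑ δ h g (β ∘ is) cs j)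
                   (trans (ℤₚ.+-identityˡ _) (project-∑ δ h g (ys ∘ suc) (gs ∘ suc) j)) ⟩
            _ ∎
            where open ≡-Reasoning
          eq′ : ∀ j → d ℤ.* δ ℤ.* x j ≡ (T v j ℤ.+ d ℤ.* s ℤ.* g j) ℤ.+
                ((β i ℤ.* (d ℤ.* ε ℤ.* g j) ℤ.+ ∑ (λ l → β (is l) ℤ.* T (cs l) j)) ℤ.+ ∑ (λ l → ys (suc l) ℤ.* T (gs (suc l)) j))
          eq′ j = begin
            d ℤ.* δ ℤ.* x j ≡⟨ shuffle₁ d δ (x j) (dot h x) (g j) ⟩
            (δ ℤ.* (d ℤ.* x j) ℤ.- d ℤ.* dot h x ℤ.* g j) ℤ.+ d ℤ.* dot h x ℤ.* g j
              ≡⟨ cong₂ (λ y z → (δ ℤ.* (d ℤ.* x j) ℤ.- y ℤ.* g j) ℤ.+ d ℤ.* z ℤ.* g j) (sym (dot-* h d x)) hx ⟩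
            T (λ j → d ℤ.* x j) j ℤ.+ d ℤ.* (ε ℤ.* β i ℤ.+ s) ℤ.* g j ≡⟨ cong (λ z → z ℤ.+ d ℤ.* (ε ℤ.* β i ℤ.+ s) ℤ.* g j) (split j) ⟩
            (T v j ℤ.+ (∑ (λ l → β (is l) ℤ.* T (cs l) j) ℤ.+ ∑ (λ l → ys (suc l) ℤ.* T (gs (suc l)) j))) ℤ.+ d ℤ.* (ε ℤ.* β i ℤ.+ s) ℤ.* g j
              ≡⟨ shuffle₂ (T v j) (∑ (λ l → β (is l) ℤ.* T (cs l) j)) (∑ (λ l → ys (suc l) ℤ.* T (gs (suc l)) j)) d ε (β i) s (g j) ⟩
            _ ∎
            where
            open ≡-Reasoning
            shuffle₁ : ∀ d δ x a g → d ℤ.* δ ℤ.* x ≡ (δ ℤ.* (d ℤ.* x) ℤ.- d ℤ.* a ℤ.* g) ℤ.+ d ℤ.* a ℤ.* g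
            shuffle₁ = ℤ-Ring.solve-∀
            shuffle₂ : ∀ t c y d e b s g → (t ℤ.+ (c ℤ.+ y)) ℤ.+ d ℤ.* (e ℤ.* b ℤ.+ s) ℤ.* g ≡
                       (t ℤ.+ d ℤ.* s ℤ.* g) ℤ.+ ((b ℤ.* (d ℤ.* e ℤ.* g) ℤ.+ c) ℤ.+ y)
            shuffle₂ = ℤ-Ring.solve-∀

        -- A zero direction contributes nothing, but a slot must still be filled to keep `r + k`
        -- constant; the dummy gets coefficient 0.
        drop : (∀ j → g j ≡ 0ℤ) → State r (suc k) (B ^ 8) x
        drop g≡0 = record
          { d = d ; v = v ; is = nothing ◂ is ; cs = (λ _ → 0ℤ) ◂ cs ; ys = ys ∘ suc ; gs = gs ∘ suc ; d≢0 = d≢0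
          ; d≤B = ≤-trans d≤B B≤B⁸
          ; v≤B = λ j → ≤-trans (v≤B j) B≤B⁸
          ; cs≤B = λ { zero j → z≤n ; (suc l) j → ≤-trans (cs≤B l j) B≤B⁸ }
          ; gs≤B = λ l j → ≤-trans (gs≤B (suc l) j) B≤B⁸
          ; eq = λ j → trans (eq j) (trans
              (cong (λ z → v j ℤ.+ (∑ (λ i → β (is i) ℤ.* cs i j) ℤ.+ (ys zero ℤ.* z ℤ.+ ∑ (λ i → ys (suc i) ℤ.* gs (suc i) j)))) (g≡0 j))
              (shuffle (v j) (∑ (λ i → β (is i) ℤ.* cs i j)) (ys zero) (∑ (λ i → ys (suc i) ℤ.* gs (suc i) j)) (β nothing)))
          }
          where
          B≤B⁸ : B ≤ B ^ 8
          B≤B⁸ = ≤-trans (one^ ≤-refl) (B^-mono 1 8 (m≤m+n 1 7))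
          shuffle : ∀ v c y s b → v ℤ.+ (c ℤ.+ (y ℤ.* 0ℤ ℤ.+ s)) ≡ v ℤ.+ ((b ℤ.* 0ℤ ℤ.+ c) ℤ.+ s)
          shuffle = ℤ-Ring.solve-∀

        move : ℤ → V
        move t j = x j ℤ.+ t ℤ.* g j

        -- Moving along `g` changes only its coefficient in `ys`, and the `ys` are the part of a
        -- state that is not bounded.
        shift : ∀ t → State (suc r) k B (move t)
        shift t = record
          { d = d ; v = v ; is = is ; cs = cs ; ys = (ys zero ℤ.+ d ℤ.* t) ◂ (ys ∘ suc) ; gs = gs ; d≢0 = d≢0
          ; d≤B = d≤B ; v≤B = v≤B ; cs≤B = cs≤B ; gs≤B = gs≤B
          ; eq = λ j → trans (ℤₚ.*-distribˡ-+ d (x j) (t ℤ.* g j)) (trans (cong (λ z → z ℤ.+ d ℤ.* (t ℤ.* g j)) (eq j))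
              (shuffle (v j) (∑ (λ i → β (is i) ℤ.* cs i j)) (ys zero) (g j) (∑ (λ i → ys (suc i) ℤ.* gs (suc i) j)) d t))
          }
          where
          shuffle : ∀ v c y g s d t → (v ℤ.+ (c ℤ.+ (y ℤ.* g ℤ.+ s))) ℤ.+ d ℤ.* (t ℤ.* g) ≡
                    v ℤ.+ (c ℤ.+ ((y ℤ.+ d ℤ.* t) ℤ.* g ℤ.+ s))
          shuffle = ℤ-Ring.solve-∀

      module _ {r k x} (σ : State (suc r) k B x) where
        open Reduction σ

        h : V
        h = Qv g

        dot-move : ∀ u t → dot u (move t) ≡ dot u x ℤ.+ t ℤ.* dot u g
        dot-move u t = trans (dot-+ u x (λ j → t ℤ.* g j)) (cong (λ z → dot u x ℤ.+ z) (dot-* u t g))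

        dot-move-+ : ∀ u t s → dot u (move (t ℤ.+ s)) ≡ dot u (move t) ℤ.+ s ℤ.* dot u g
        dot-move-+ u t s = trans (dot-move u (t ℤ.+ s))
          (trans (shuffle (dot u x) t s (dot u g)) (cong (λ z → z ℤ.+ s ℤ.* dot u g) (sym (dot-move u t))))
          where
          shuffle : ∀ a t s c → a ℤ.+ (t ℤ.+ s) ℤ.* c ≡ a ℤ.+ t ℤ.* c ℤ.+ s ℤ.* c
          shuffle = ℤ-Ring.solve-∀

        -- Here `h = Qg`; the symmetry of `Q` merges the two cross terms into `2 t (h · x)`.
        obj-move : ∀ t → obj (move t) ≡ obj x ℤ.+ (t ℤ.* (+ 2 ℤ.* dot h x) ℤ.+ t ℤ.* t ℤ.* dot h g)
        obj-move t = begin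
          dot (move t) (Qv (move t)) ≡⟨ ∑-cong (λ i → cong (move t i ℤ.*_) (dot-move (Q i) t)) ⟩
          dot (move t) (λ i → Qv x i ℤ.+ t ℤ.* h i) ≡⟨ dot-comm (move t) (λ i → Qv x i ℤ.+ t ℤ.* h i) ⟩
          dot q (move t) ≡⟨ dot-move q t ⟩
          dot q x ℤ.+ t ℤ.* dot q g
            ≡⟨ cong₂ (λ a b → a ℤ.+ t ℤ.* b) (expand x) (expand g) ⟩
          dot x (Qv x) ℤ.+ t ℤ.* dot h x ℤ.+ t ℤ.* (dot g (Qv x) ℤ.+ t ℤ.* dot h g)
            ≡⟨ cong (λ z → dot x (Qv x) ℤ.+ t ℤ.* dot h x ℤ.+ t ℤ.* (z ℤ.+ t ℤ.* dot h g)) (trans (adjoint g x) (dot-comm x h)) ⟩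
          dot x (Qv x) ℤ.+ t ℤ.* dot h x ℤ.+ t ℤ.* (dot h x ℤ.+ t ℤ.* dot h g) ≡⟨ shuffle (obj x) t (dot h x) (dot h g) ⟩
          _ ∎
          where
          open ≡-Reasoning
          q : V
          q i = Qv x i ℤ.+ t ℤ.* h i
          expand : ∀ w → dot q w ≡ dot w (Qv x) ℤ.+ t ℤ.* dot h w
          expand w = trans (dot-comm q w) (trans (dot-+ w (Qv x) (λ i → t ℤ.* h i))
            (cong (λ z → dot w (Qv x) ℤ.+ z) (trans (dot-* w t h) (cong (t ℤ.*_) (dot-comm w h)))))
          shuffle : ∀ o t a c → o ℤ.+ t ℤ.* a ℤ.+ t ℤ.* (a ℤ.+ t ℤ.* c) ≡ o ℤ.+ (t ℤ.* (+ 2 ℤ.* a) ℤ.+ t ℤ.* t ℤ.* c)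
          shuffle = ℤ-Ring.solve-∀

        -- `B ^ 3` bounds every `∣ dot (A i) g ∣`, by `n * (a * B)`. So if each row with
        -- `dot (A i) g ≢ 0ℤ` has slack at least `M`, a step by `g` in either direction preserves
        -- feasibility.
        M : ℤ
        M = + (B ^ 3)

        NearTight : V → Set
        NearTight z = ∃[ i ] (dot (A i) g ≢ 0ℤ × b i ℤ.- dot (A i) z ℤ.< M)

        nearTight? : ∀ z → Dec (NearTight z)
        nearTight? z = any? (λ i → ¬? (dot (A i) g ℤ.≟ 0ℤ) ×-dec (b i ℤ.- dot (A i) z ℤ.<? M))

        private
          A≤ : ∀ i j → ∣ A i j ∣ ≤ B ^ 1
          A≤ i j = one^ (≤-trans (A≤a i j) a≤B)

          h≤ : ∀ j → ∣ h j ∣ ≤ B ^ 3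
          h≤ j = dot-≤ (Q j) g 1 1 (λ l → one^ (≤-trans (Q≤a j l) a≤B)) g≤

        tighten : ∀ t → Feas (move t) → NearTight (move t) → State r (suc k) (B ^ 8) (move t)
        tighten t f (i , ag≢0 , near) =
          Reduction.eliminate (shift t) (A i) (just i) 1ℤ (ax ℤ.- β (just i)) (λ j → ≤-trans (A≤ i j) (B^-mono 1 3 (m≤m+n 1 2))) ≤-refl
            (≤-trans (abs-≤ (ax ℤ.- β (just i)) (B ^ 3) lower upper) (B^-mono 3 5 (m≤m+n 3 2))) ag≢0
            (shuffle ax (β (just i)))
          where
          ax : ℤ
          ax = dot (A i) (move t)
          shuffle : ∀ a b → a ≡ 1ℤ ℤ.* b ℤ.+ (a ℤ.- b)
          shuffle = ℤ-Ring.solve-∀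
          negate : ∀ a b → ℤ.- (a ℤ.- b) ≡ b ℤ.- a
          negate = ℤ-Ring.solve-∀
          upper : ax ℤ.- β (just i) ℤ.≤ + (B ^ 3)
          upper = ℤₚ.≤-trans (ℤₚ.i≤j⇒i-j≤0 (β-upper (move t) f i)) (ℤ.+≤+ z≤n)
          lower : ℤ.- (ax ℤ.- β (just i)) ℤ.≤ + (B ^ 3)
          lower = ℤₚ.≤-trans (ℤₚ.≤-reflexive (negate ax (β (just i))))
            (ℤₚ.≤-trans (ℤₚ.+-monoˡ-≤ (ℤ.- ax) (β-lower i)) (ℤₚ.<⇒≤ near))

        slide : ∀ t s → ∣ s ∣ ≤ 1 → Feas (move t) → ¬ NearTight (move t) → Feas (move (t ℤ.+ s))
        slide t s s≤1 f far i with dot (A i) g ℤ.≟ 0ℤ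
        ... | yes ag≡0 = ℤₚ.≤-trans (ℤₚ.≤-reflexive (trans (dot-move-+ (A i) t s)
                (trans (cong (λ z → dot (A i) (move t) ℤ.+ s ℤ.* z) ag≡0) (vanish (dot (A i) (move t)) s)))) (f i)
          where
          vanish : ∀ a s → a ℤ.+ s ℤ.* 0ℤ ≡ a
          vanish = ℤ-Ring.solve-∀
        ... | no ag≢0 = ℤₚ.≤-trans (ℤₚ.≤-reflexive (dot-move-+ (A i) t s))
                (ℤₚ.≤-trans (ℤₚ.+-monoʳ-≤ (dot (A i) (move t)) (ℤₚ.≤-trans small room))
                  (ℤₚ.≤-reflexive (restore (dot (A i) (move t)) (b i))))
          where
          restore : ∀ a b → a ℤ.+ (b ℤ.- a) ≡ b
          restore = ℤ-Ring.solve-∀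
          small : s ℤ.* dot (A i) g ℤ.≤ M
          small = ℤₚ.≤-trans (i≤∣i∣ _) (ℤ.+≤+ (≤-trans (≤-reflexive (ℤₚ.abs-* s (dot (A i) g)))
            (≤-trans (*-mono-≤ s≤1 (dot-≤ (A i) g 1 1 (A≤ i) g≤)) (≤-reflexive (*-identityˡ _)))))
          room : M ℤ.≤ b i ℤ.- dot (A i) (move t)
          room = ℤₚ.≮⇒≥ (λ near → far (i , ag≢0 , near))

        -- `fuel` bounds the slack of row `i`, and every step lowers that slack by at least 1.
        -- Unless another row becomes nearly tight earlier, row `i` does so at the latest when its
        -- slack is no longer positive.
        walk : ∀ i s → ∣ s ∣ ≤ 1 → 1ℤ ℤ.≤ s ℤ.* dot (A i) g → dot (A i) g ≢ 0ℤ →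
               ∀ fuel t → Feas (move t) → b i ℤ.- dot (A i) (move t) ℤ.≤ + fuel → ∃[ u ] (Feas (move u) × NearTight (move u))
        walk i s s≤1 up ag≢0 zero t f slack = t , f , i , ag≢0 ,
          ℤₚ.≤-<-trans slack (ℤ.+<+ (m^n>0 B 3))
        walk i s s≤1 up ag≢0 (suc fuel) t f slack with nearTight? (move t)
        ... | yes near = t , f , near
        ... | no far = walk i s s≤1 up ag≢0 fuel (t ℤ.+ s) (slide t s s≤1 f far)
              (ℤₚ.≤-trans (ℤₚ.≤-reflexive (trans (cong (λ z → b i ℤ.- z) (dot-move-+ (A i) t s))
                                                 (regroup (b i) (dot (A i) (move t)) (s ℤ.* dot (A i) g))))
                          (ℤₚ.+-mono-≤ slack (ℤₚ.neg-mono-≤ up)))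
          where
          regroup : ∀ b a c → b ℤ.- (a ℤ.+ c) ≡ (b ℤ.- a) ℤ.- c
          regroup = ℤ-Ring.solve-∀

        -- `w` is the objective value from which the current reduction started. Measuring against
        -- `w` instead of `obj x` ensures that an improvement found after `x` has moved is still one
        -- over the starting point.
        Step : ℤ → Set
        Step w = ∃[ z ] (Feas z × obj z ℤ.≤ w × State r (suc k) (B ^ 8) z)

        module _ (w : ℤ) (f : Feas x) (obj≤w : obj x ℤ.≤ w) where
          private
            origin : ∀ u → dot u (move 0ℤ) ≡ dot u x
            origin u = trans (dot-move u 0ℤ) (ℤₚ.+-identityʳ _)

            f₀ : Feas (move 0ℤ)
            f₀ i = ℤₚ.≤-trans (ℤₚ.≤-reflexive (origin (A i))) (f i)

            level : ∀ t → t ℤ.* (+ 2 ℤ.* dot h x) ℤ.+ t ℤ.* t ℤ.* dot h g ≡ 0ℤ → obj (move t) ℤ.≤ w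
            level t e = ℤₚ.≤-trans (ℤₚ.≤-reflexive (trans (obj-move t)
              (trans (cong (λ z → obj x ℤ.+ z) e) (ℤₚ.+-identityʳ (obj x))))) obj≤w

            stationary : dot h g ≡ 0ℤ → dot h x ≡ 0ℤ → ∀ t → obj (move t) ℤ.≤ w
            stationary hg hx t = level t (trans (cong₂ (λ a c → t ℤ.* (+ 2 ℤ.* a) ℤ.+ t ℤ.* t ℤ.* c) hx hg) (zeros t))
              where
              zeros : ∀ t → t ℤ.* (+ 2 ℤ.* 0ℤ) ℤ.+ t ℤ.* t ℤ.* 0ℤ ≡ 0ℤ
              zeros = ℤ-Ring.solve-∀

            flat : dot h g ≡ 0ℤ → dot h x ≡ 0ℤ → Step w
            flat hg hx with any? (λ i → ¬? (dot (A i) g ℤ.≟ 0ℤ))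
            ... | yes (i , ag≢0) = let u , fu , near = start (direction (dot (A i) g) ag≢0) in
                  move u , fu , stationary hg hx u , tighten u fu near
              where
              start : (∃[ s ] (∣ s ∣ ≤ 1 × 1ℤ ℤ.≤ s ℤ.* dot (A i) g)) → ∃[ u ] (Feas (move u) × NearTight (move u))
              start (s , s≤1 , up) = walk i s s≤1 up ag≢0 ∣ b i ℤ.- dot (A i) (move 0ℤ) ∣ 0ℤ f₀ (i≤∣i∣ _)
            ... | no none with dot g g ℤ.≟ 0ℤ
            ...   | yes gg = x , f , obj≤w , drop (dot-self≡0 g gg)
            ...   | no gg≢0 = move t , ft , stationary hg hx t ,
                    Reduction.eliminate (shift t) g nothing 0ℤ (dot g (move t)) (λ j → ≤-trans (g≤ j) (B^-mono 1 3 (m≤m+n 1 2))) z≤n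
                      (≤-trans small (B^-mono 3 5 (m≤m+n 3 2))) gg≢0 (sym (ℤₚ.+-identityˡ (dot g (move t))))
              where
              instance
                gg-nonZero : ℤ.NonZero (dot g g)
                gg-nonZero = ℤ.≢-nonZero gg≢0
              -- Minus the quotient of `dot g x` by `dot g g`: then `dot g (move t)` is the
              -- remainder, the small `s` that `eliminate` needs with `h = g`.
              t : ℤ
              t = ℤ.- (dot g x ℤ./ dot g g)
              ag≡0 : ∀ i → dot (A i) g ≡ 0ℤ
              ag≡0 i = decidable-stable (dot (A i) g ℤ.≟ 0ℤ) (λ ag≢0 → none (i , ag≢0))
              ft : Feas (move t)
              ft i = ℤₚ.≤-trans (ℤₚ.≤-reflexive (trans (dot-move (A i) t)
                (trans (cong (λ z → dot (A i) x ℤ.+ t ℤ.* z) (ag≡0 i))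
                  (trans (cong (λ z → dot (A i) x ℤ.+ z) (ℤₚ.*-zeroʳ t)) (ℤₚ.+-identityʳ _))))) (f i)
              remainder : ∀ x r q g → x ≡ r ℤ.+ q ℤ.* g → x ℤ.+ ℤ.- q ℤ.* g ≡ r
              remainder x r q g refl = cancel r q g
                where
                cancel : ∀ r q g → r ℤ.+ q ℤ.* g ℤ.+ ℤ.- q ℤ.* g ≡ r
                cancel = ℤ-Ring.solve-∀
              small : ∣ dot g (move t) ∣ ≤ B ^ 3
              small = ≤-trans (≤-reflexive (cong ∣_∣ (trans (dot-move g t)
                  (remainder (dot g x) (+ (dot g x ℤ.% dot g g)) (dot g x ℤ./ dot g g) (dot g g) (ℤ.a≡a%n+[a/n]*n (dot g x) (dot g g))))))
                (≤-trans (<⇒≤ (ℤ.n%d<d (dot g x) (dot g g))) (dot-≤ g g 1 1 g≤ g≤))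

            curved : 0ℤ ℤ.≤ + 2 ℤ.* dot h x ℤ.+ dot h g → 0ℤ ℤ.≤ ℤ.- (+ 2 ℤ.* dot h x) ℤ.+ dot h g → Step w
            curved lo hi with dot h g ℤ.≟ 0ℤ
            ... | no hg≢0 = x , f , obj≤w , eliminate h nothing 0ℤ (dot h x) h≤ z≤n
                  -- The chain is `∣ h·x ∣ ≤ ∣ 2 h·x ∣ ≤ ∣ h·g ∣ ≤ B ^ 5`. This case accounts for
                  -- the exponents 3 for `h` and 5 for `s` in `eliminate`.
                  (≤-trans (∣i∣≤∣2i∣ (dot h x)) (≤-trans (abs-≤ (+ 2 ℤ.* dot h x) ∣ dot h g ∣
                      (ℤₚ.≤-trans (below (ℤ.- (+ 2 ℤ.* dot h x)) (dot h g)
                                     (subst (λ z → 0ℤ ℤ.≤ z ℤ.+ dot h g) (sym (ℤₚ.neg-involutive (+ 2 ℤ.* dot h x))) lo)) (i≤∣i∣ _))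
                      (ℤₚ.≤-trans (below (+ 2 ℤ.* dot h x) (dot h g) hi) (i≤∣i∣ _)))
                    (dot-≤ h g 3 1 h≤ g≤)))
                  hg≢0 (sym (ℤₚ.+-identityˡ (dot h x)))
              where
              below : ∀ a c → 0ℤ ℤ.≤ ℤ.- a ℤ.+ c → a ℤ.≤ c
              below a c p = ℤₚ.0≤i-j⇒j≤i (subst (0ℤ ℤ.≤_) (ℤₚ.+-comm (ℤ.- a) c) p)
            ... | yes hg = flat hg (double-zero (dot h x)
                  (subst (0ℤ ℤ.≤_) (trans (cong (λ z → + 2 ℤ.* dot h x ℤ.+ z) hg) (ℤₚ.+-identityʳ _)) lo)
                  (subst (0ℤ ℤ.≤_) (trans (cong (λ z → ℤ.- (+ 2 ℤ.* dot h x) ℤ.+ z) hg) (ℤₚ.+-identityʳ _)) hi))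

            gain : ∀ t → w ℤ.≤ obj (move t) → 0ℤ ℤ.≤ t ℤ.* (+ 2 ℤ.* dot h x) ℤ.+ t ℤ.* t ℤ.* dot h g
            gain t w≤ = ℤₚ.≤-trans (ℤₚ.i≤j⇒0≤j-i (ℤₚ.≤-trans obj≤w w≤))
              (ℤₚ.≤-reflexive (trans (cong (λ z → z ℤ.- obj x) (obj-move t)) (cancel (obj x) _)))
              where
              cancel : ∀ o z → o ℤ.+ z ℤ.- o ≡ z
              cancel = ℤ-Ring.solve-∀

          step : (∃[ z ] (Feas z × obj z ℤ.< w)) ⊎ Step w
          step with nearTight? (move 0ℤ)
          -- `move 0ℤ` agrees with `x` only pointwise, so feasibility and objective are transferred
          -- by `f₀` and `level`.
          ... | yes near = inj₂ (move 0ℤ , f₀ , level 0ℤ refl , tighten 0ℤ f₀ near)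
          ... | no far with obj (move 1ℤ) ℤ.<? w | obj (move -1ℤ) ℤ.<? w
          ...   | yes p | _     = inj₁ (move 1ℤ , slide 0ℤ 1ℤ ≤-refl f₀ far , p)
          ...   | no _  | yes p = inj₁ (move -1ℤ , slide 0ℤ -1ℤ ≤-refl f₀ far , p)
          ...   | no p  | no q  = inj₂ (curved
                  (subst (0ℤ ℤ.≤_) (plus (dot h x) (dot h g)) (gain 1ℤ (ℤₚ.≮⇒≥ p)))
                  (subst (0ℤ ℤ.≤_) (minus (dot h x) (dot h g)) (gain -1ℤ (ℤₚ.≮⇒≥ q))))
            where
            plus : ∀ a c → 1ℤ ℤ.* (+ 2 ℤ.* a) ℤ.+ 1ℤ ℤ.* 1ℤ ℤ.* c ≡ + 2 ℤ.* a ℤ.+ c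
            plus = ℤ-Ring.solve-∀
            minus : ∀ a c → -1ℤ ℤ.* (+ 2 ℤ.* a) ℤ.+ -1ℤ ℤ.* -1ℤ ℤ.* c ≡ ℤ.- (+ 2 ℤ.* a) ℤ.+ c
            minus = ℤ-Ring.solve-∀

    Better : ℤ → Set
    Better w = ∃[ z ] (Feas z × obj z ℤ.< w)

    Result : ℤ → ℕ → Set
    Result w B = ∃[ z ] (Feas z × obj z ℤ.≤ w × State 0 n B z)

    reduce : ∀ w r k B → r + k ≡ n → 2 ≤ B → n ≤ B → a ≤ B → ∀ x → Feas x → obj x ℤ.≤ w → State r k B x →
             Better w ⊎ Result w (B ^ (8 ^ r))
    reduce w zero k B refl 2≤B n≤B a≤B x f o σ = inj₂ (x , f , o , subst (λ B → State 0 n B x) (sym (*-identityʳ B)) σ)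
    reduce w (suc r) k B eq 2≤B n≤B a≤B x f o σ with step B 2≤B n≤B a≤B σ w f o
    ... | inj₁ better = inj₁ better
    ... | inj₂ (x′ , f′ , o′ , σ′) = subst (λ e → Better w ⊎ Result w e) (^-*-assoc B 8 (8 ^ r))
          (reduce w r (suc k) (B ^ 8) (trans (+-suc r k) eq) (≤-trans 2≤B B≤B⁸) (≤-trans n≤B B≤B⁸) (≤-trans a≤B B≤B⁸) x′ f′ o′ σ′)
      where
      B≤B⁸ : B ≤ B ^ 8
      B≤B⁸ = m≤m*n B (B ^ 7) ⦃ m^n≢0 B 7 ⦃ >-nonZero (≤-trans (s≤s z≤n) 2≤B) ⦄ ⦄

    initial : ∀ B → 1 ≤ B → ∀ x → State n 0 B x
    initial B 1≤B x = record
      { d = 1ℤ ; v = λ _ → 0ℤ ; is = λ () ; cs = λ () ; ys = x ; gs = unit ; d≢0 = λ ()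
      ; d≤B = 1≤B ; v≤B = λ _ → z≤n ; cs≤B = λ () ; gs≤B = λ i j → ≤-trans (unit≤1 i j) 1≤B
      ; eq = λ j → trans (ℤₚ.*-identityˡ (x j)) (sym (trans (ℤₚ.+-identityˡ _) (trans (ℤₚ.+-identityˡ _) (∑-unit x j))))
      }

    module _ (B : ℕ) (2≤B : 2 ≤ B) (n≤B : n ≤ B) (a≤B : a ≤ B) where
      -- The objective is an integer, so each improvement uses up one unit of the distance to `lb`.
      -- After an improvement the reduction starts afresh from the unit vectors; hence the
      -- coefficient bound does not depend on the number of improvements.
      descend : ∀ lb fuel y → Feas y → obj y ℤ.≤ lb ℤ.+ + fuel →
                (∃[ z ] (Feas z × obj z ℤ.≤ lb)) ⊎ Result (obj y) (B ^ (8 ^ n))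
      descend lb zero y f o = inj₁ (y , f , ℤₚ.≤-trans o (ℤₚ.≤-reflexive (ℤₚ.+-identityʳ lb)))
      descend lb (suc fuel) y f o
        with reduce (obj y) n 0 B (+-identityʳ n) 2≤B n≤B a≤B y f ℤₚ.≤-refl (initial B (≤-trans (s≤s z≤n) 2≤B) y)
      ... | inj₂ result = inj₂ result
      ... | inj₁ (z , fz , z<y) with descend lb fuel z fz (ℤₚ.≤-trans (ℤₚ.i<j⇒i≤pred[j] (ℤₚ.<-≤-trans z<y o))
                                      (ℤₚ.≤-reflexive (pred-suc lb (+ fuel))))
        where
        pred-suc : ∀ l f → -1ℤ ℤ.+ (l ℤ.+ (1ℤ ℤ.+ f)) ≡ l ℤ.+ f
        pred-suc = ℤ-Ring.solve-∀
      ...   | inj₁ low = inj₁ low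
      ...   | inj₂ (x , fx , ox , σ) = inj₂ (x , fx , ℤₚ.≤-trans ox (ℤₚ.<⇒≤ z<y) , σ)

-- Evaluation of candidates

-- Enumerated coefficients have a fixed width, with leading zeros, and so need not be of the form
-- `encodeℤ`. They are handled by value only.
readS : ∀ n → Tree → Vec ℤ n
readS zero    t = []
readS (suc n) t = valS (head t) ∷ readS n (tail t)

readS-encodeVec : ∀ {n} (v : Vec ℤ n) → readS n (encodeVec v) ≡ v
readS-encodeVec []      = refl
readS-encodeVec (z ∷ v) = cong₂ _∷_ (valS-encodeℤ z) (readS-encodeVec v)

opaque
  private
    termP : PTm 5
    termP = callP mulDP (callP toDP (v0 ∷ []) ∷ callP toDP (hdP v2 ∷ []) ∷ [])

  dotP : PTm 2
  dotP = recP v0 v1 nilP (tlP v2)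
    (callP addDP (v0 ∷ callP mulDP (callP toDP (v1 ∷ []) ∷ callP toDP (hdP v3 ∷ []) ∷ []) ∷ []))
    (pb-const 0) (λ a l s ρ → ≤-trans (size-tail s) (m≤m+n (size s) 0))
    (pb-+ (sizeP termP) (pb-const 3))
    (λ r a l s ρ → addD-size r (⟦ termP ⟧ₚ (a ∷ l ∷ s ∷ ρ)))

  dot-val : ∀ {n} (u : Vec ℤ n) t → valD (⟦ dotP ⟧ₚ (encodeVec u ∷ t ∷ [])) ≡ u · readS n t
  dot-val [] t = refl
  dot-val (z ∷ u) t =
    trans (addD-val (⟦ dotP ⟧ₚ (encodeVec u ∷ tail t ∷ []))
                    (⟦ mulDP ⟧ₚ (⟦ toDP ⟧ₚ (encodeℤ z ∷ []) ∷ ⟦ toDP ⟧ₚ (head t ∷ []) ∷ [])))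
    (trans (ℤₚ.+-comm (valD (⟦ dotP ⟧ₚ (encodeVec u ∷ tail t ∷ []))) _)
    (cong₂ ℤ._+_
      (trans (mulD-val (⟦ toDP ⟧ₚ (encodeℤ z ∷ [])) (⟦ toDP ⟧ₚ (head t ∷ [])))
             (cong₂ ℤ._*_ (trans (toD-val (encodeℤ z)) (valS-encodeℤ z)) (toD-val (head t))))
      (dot-val u (tail t))))

dot-encode : ∀ {n} (u v : Vec ℤ n) → valD (⟦ dotP ⟧ₚ (encodeVec u ∷ encodeVec v ∷ [])) ≡ u · v
dot-encode u v = trans (dot-val u (encodeVec v)) (cong (u ·_) (readS-encodeVec v))

leSP : ∀ {k} → PTm k → PTm k → PTm k
leSP t u = callP leDP (callP toDP (t ∷ []) ∷ callP toDP (u ∷ []) ∷ [])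

leS-decides : ∀ s t → Decides (valS s ℤ.≤ valS t) (⟦ leDP ⟧ₚ (⟦ toDP ⟧ₚ (s ∷ []) ∷ ⟦ toDP ⟧ₚ (t ∷ []) ∷ []))
leS-decides s t = subst₂ (λ x y → Decides (x ℤ.≤ y) (⟦ leDP ⟧ₚ (⟦ toDP ⟧ₚ (s ∷ []) ∷ ⟦ toDP ⟧ₚ (t ∷ []) ∷ [])))
  (toD-val s) (toD-val t) (leD-decides (⟦ toDP ⟧ₚ (s ∷ [])) (⟦ toDP ⟧ₚ (t ∷ [])))

opaque
  eqP : PTm 2
  eqP = recP v0 v1 oneP (tlP v2) (iteP (leSP v1 (hdP v3)) (iteP (leSP (hdP v3) v1) v0 nilP) nilP)
    (pb-const 0) (λ a l s ρ → ≤-trans (size-tail s) (m≤m+n (size s) 0))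
    (pb-const 0) (λ r a l s ρ → size-ifT (⟦ leDP ⟧ₚ (⟦ toDP ⟧ₚ (a ∷ []) ∷ ⟦ toDP ⟧ₚ (head s ∷ []) ∷ [])) _ nil
      (size-ifT (⟦ leDP ⟧ₚ (⟦ toDP ⟧ₚ (head s ∷ []) ∷ ⟦ toDP ⟧ₚ (a ∷ []) ∷ [])) r nil (m≤m+n (size r) 0) z≤n) z≤n)

  eq-decides : ∀ {n} (u : Vec ℤ n) t → Decides (u ≡ readS n t) (⟦ eqP ⟧ₚ (encodeVec u ∷ t ∷ []))
  eq-decides [] t = holds refl
  eq-decides {suc n} (z ∷ u) t = combine (leS-decides (encodeℤ z) (head t)) (leS-decides (head t) (encodeℤ z)) (eq-decides u (tail t))
    where
    combine : ∀ {p q r} → Decides (valS (encodeℤ z) ℤ.≤ valS (head t)) p → Decides (valS (head t) ℤ.≤ valS (encodeℤ z)) q →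
              Decides (u ≡ readS n (tail t)) r → Decides (z ∷ u ≡ readS (suc n) t) (ifT p (ifT q r nil) nil)
    combine (holds p) (holds q) (holds e) = holds (cong₂ _∷_ (trans (sym (valS-encodeℤ z)) (ℤₚ.≤-antisym p q)) e)
    combine (holds p) (holds q) (fails e) = fails (λ eq → e (∷-injectiveʳ eq))
    combine (holds p) (fails q) _ = fails (λ eq → q (ℤₚ.≤-reflexive (sym (trans (valS-encodeℤ z) (∷-injectiveˡ eq)))))
    combine (fails p) _ _ = fails (λ eq → p (ℤₚ.≤-reflexive (trans (valS-encodeℤ z) (∷-injectiveˡ eq))))

opaque
  feasP : PTm 3
  feasP = recP v0 v1 oneP (tlP v2) (iteP (callP leDP (callP dotP (v1 ∷ v6 ∷ []) ∷ callP toDP (hdP v3 ∷ []) ∷ [])) v0 nilP)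
    (pb-const 0) (λ a l s ρ → ≤-trans (size-tail s) (m≤m+n (size s) 0))
    (pb-const 0) (λ r a l s ρ → size-ifT
      (⟦ callP leDP (callP dotP (v1 ∷ v6 ∷ []) ∷ callP toDP (hdP v3 ∷ []) ∷ []) ⟧ₚ (r ∷ a ∷ l ∷ s ∷ ρ)) r nil (m≤m+n (size r) 0) z≤n)

  feas-decides : ∀ {m n} (A : Matrix m n) (b : Vec ℤ m) (x : Vec ℤ n) →
    Decides (Pointwise ℤ._≤_ (A *ᵥ x) b) (⟦ feasP ⟧ₚ (encodeMatrix A ∷ encodeVec b ∷ encodeVec x ∷ []))
  feas-decides [] [] x = holds []
  feas-decides (u ∷ A) (z ∷ b) x = combine
    (subst₂ (λ p q → Decides (p ℤ.≤ q) (⟦ leDP ⟧ₚ (⟦ dotP ⟧ₚ (encodeVec u ∷ encodeVec x ∷ []) ∷ ⟦ toDP ⟧ₚ (encodeℤ z ∷ []) ∷ [])))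
            (dot-encode u x) (trans (toD-val (encodeℤ z)) (valS-encodeℤ z))
            (leD-decides (⟦ dotP ⟧ₚ (encodeVec u ∷ encodeVec x ∷ [])) (⟦ toDP ⟧ₚ (encodeℤ z ∷ []))))
    (feas-decides A b x)
    where
    combine : ∀ {p r} → Decides (u · x ℤ.≤ z) p → Decides (Pointwise ℤ._≤_ (A *ᵥ x) b) r →
              Decides (Pointwise ℤ._≤_ ((u ∷ A) *ᵥ x) (z ∷ b)) (ifT p r nil)
    combine (holds p) (holds q) = holds (p ∷ q)
    combine (holds p) (fails q) = fails (λ { (_ ∷ q′) → q q′ })
    combine (fails p) _ = fails (λ { (p′ ∷ _) → p p′ })

opaque
  private
    rowP : PTm 6
    rowP = callP mulDP (callP toDP (hdP v2 ∷ []) ∷ callP dotP (v0 ∷ v5 ∷ []) ∷ [])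

  bilinearP : PTm 3
  bilinearP = recP v0 v1 nilP (tlP v2)
    (callP addDP (v0 ∷ callP mulDP (callP toDP (hdP v3 ∷ []) ∷ callP dotP (v1 ∷ v6 ∷ []) ∷ []) ∷ []))
    (pb-const 0) (λ a l s ρ → ≤-trans (size-tail s) (m≤m+n (size s) 0))
    (pb-+ (sizeP rowP) (pb-const 3))
    (λ r a l s ρ → addD-size r (⟦ rowP ⟧ₚ (a ∷ l ∷ s ∷ ρ)))

  bilinear-val : ∀ {k n} (M : Matrix k n) (y : Vec ℤ k) (x : Vec ℤ n) →
    valD (⟦ bilinearP ⟧ₚ (encodeMatrix M ∷ encodeVec y ∷ encodeVec x ∷ [])) ≡ y · (M *ᵥ x)
  bilinear-val [] [] x = refl
  bilinear-val (u ∷ M) (z ∷ y) x =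
    trans (addD-val (⟦ bilinearP ⟧ₚ (encodeMatrix M ∷ encodeVec y ∷ encodeVec x ∷ []))
                    (⟦ mulDP ⟧ₚ (⟦ toDP ⟧ₚ (encodeℤ z ∷ []) ∷ ⟦ dotP ⟧ₚ (encodeVec u ∷ encodeVec x ∷ []) ∷ [])))
    (trans (ℤₚ.+-comm (valD (⟦ bilinearP ⟧ₚ (encodeMatrix M ∷ encodeVec y ∷ encodeVec x ∷ []))) _)
    (cong₂ ℤ._+_
      (trans (mulD-val (⟦ toDP ⟧ₚ (encodeℤ z ∷ [])) (⟦ dotP ⟧ₚ (encodeVec u ∷ encodeVec x ∷ [])))
             (cong₂ ℤ._*_ (trans (toD-val (encodeℤ z)) (valS-encodeℤ z)) (dot-encode u x)))
      (bilinear-val M y x)))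

encodeMaybe : Maybe ℤ → Tree
encodeMaybe nothing  = nil
encodeMaybe (just z) = encodeℤ z

smaller : Maybe ℤ → ℤ → ℤ
smaller nothing  z = z
smaller (just y) z with y ℤ.≤? z
... | yes _ = y
... | no  _ = z

tightest : ∀ {m n} → Matrix m n → Vec ℤ m → Vec ℤ n → Maybe ℤ
tightest []      []      a = nothing
tightest (u ∷ A) (z ∷ b) a with ≡-dec ℤ._≟_ u a
... | yes _ = just (smaller (tightest A b a) z)
... | no  _ = tightest A b a

-- A vector that is not a row of `A` gets the value 0. What matters is that the evaluation of
-- candidates and the descent share this convention.
rhs : ∀ {m n} → Matrix m n → Vec ℤ m → Vec ℤ n → ℤ
rhs A b a with tightest A b a
... | nothing = 0ℤ
... | just z  = z

opaque
  private
    minP : PTm 2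
    minP = iteP v0 (iteP (leSP v0 v1) v0 v1) v1

    minP-encode : ∀ y z → ⟦ minP ⟧ₚ (encodeMaybe y ∷ encodeℤ z ∷ []) ≡ encodeℤ (smaller y z)
    minP-encode nothing z = refl
    minP-encode (just y) z with y ℤ.≤? z
    ... | yes y≤z = choose (leS-decides (encodeℤ y) (encodeℤ z))
      where
      choose : ∀ {t} → Decides (valS (encodeℤ y) ℤ.≤ valS (encodeℤ z)) t → ifT t (encodeℤ y) (encodeℤ z) ≡ encodeℤ y
      choose (holds _) = refl
      choose (fails p) = ⊥-elim (p (subst₂ ℤ._≤_ (sym (valS-encodeℤ y)) (sym (valS-encodeℤ z)) y≤z))
    ... | no y≰z = choose (leS-decides (encodeℤ y) (encodeℤ z))
      where
      choose : ∀ {t} → Decides (valS (encodeℤ y) ℤ.≤ valS (encodeℤ z)) t → ifT t (encodeℤ y) (encodeℤ z) ≡ encodeℤ z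
      choose (holds p) = ⊥-elim (y≰z (subst₂ ℤ._≤_ (valS-encodeℤ y) (valS-encodeℤ z) p))
      choose (fails _) = refl

    size-min : ∀ x y → size (⟦ minP ⟧ₚ (x ∷ y ∷ [])) ≤ size x + size y
    size-min x y = size-ifT x _ y
      (size-ifT (⟦ leDP ⟧ₚ (⟦ toDP ⟧ₚ (x ∷ []) ∷ ⟦ toDP ⟧ₚ (y ∷ []) ∷ [])) x y (m≤m+n (size x) (size y)) (m≤n+m (size y) (size x)))
      (m≤n+m (size y) (size x))

  tightestP : PTm 3
  tightestP = recP v0 v1 nilP (tlP v2) (iteP (callP eqP (v1 ∷ v6 ∷ [])) (callP minP (v0 ∷ hdP v3 ∷ [])) v0)
    (pb-const 0) (λ a l s ρ → ≤-trans (size-tail s) (m≤m+n (size s) 0))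
    {h = λ ρ → size (lookup ρ (suc (suc zero)))} (sizeP v2)
    (λ r a l s ρ → size-ifT (⟦ callP eqP (v1 ∷ v6 ∷ []) ⟧ₚ (r ∷ a ∷ l ∷ s ∷ ρ)) (⟦ minP ⟧ₚ (r ∷ head s ∷ [])) r
      (≤-trans (size-min r (head s)) (+-monoʳ-≤ (size r) (size-head s))) (m≤m+n (size r) (size s)))

  tightestP-encode : ∀ {m n} (A : Matrix m n) b t →
    ⟦ tightestP ⟧ₚ (encodeMatrix A ∷ encodeVec b ∷ t ∷ []) ≡ encodeMaybe (tightest A b (readS n t))
  tightestP-encode [] [] t = refl
  tightestP-encode {n = n} (u ∷ A) (z ∷ b) t with ≡-dec ℤ._≟_ u (readS n t)
  ... | yes e = choose (eq-decides u t)
    where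
    choose : ∀ {q} → Decides (u ≡ readS n t) q →
      ifT q (⟦ minP ⟧ₚ (⟦ tightestP ⟧ₚ (encodeMatrix A ∷ encodeVec b ∷ t ∷ []) ∷ encodeℤ z ∷ []))
            (⟦ tightestP ⟧ₚ (encodeMatrix A ∷ encodeVec b ∷ t ∷ [])) ≡ encodeℤ (smaller (tightest A b (readS n t)) z)
    choose (holds _) = trans (cong (λ r → ⟦ minP ⟧ₚ (r ∷ encodeℤ z ∷ [])) (tightestP-encode A b t)) (minP-encode (tightest A b (readS n t)) z)
    choose (fails p) = ⊥-elim (p e)
  ... | no ¬e = choose (eq-decides u t)
    where
    choose : ∀ {q} → Decides (u ≡ readS n t) q →
      ifT q (⟦ minP ⟧ₚ (⟦ tightestP ⟧ₚ (encodeMatrix A ∷ encodeVec b ∷ t ∷ []) ∷ encodeℤ z ∷ []))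
            (⟦ tightestP ⟧ₚ (encodeMatrix A ∷ encodeVec b ∷ t ∷ [])) ≡ encodeMaybe (tightest A b (readS n t))
    choose (holds p) = ⊥-elim (¬e p)
    choose (fails _) = tightestP-encode A b t

zeroP : ∀ {k} → PTm k
zeroP = consP nilP (consP nilP nilP)

opaque
  rhsP : PTm 3
  rhsP = iteP (callP tightestP (v0 ∷ v1 ∷ v2 ∷ [])) (callP tightestP (v0 ∷ v1 ∷ v2 ∷ [])) zeroP

  rhsP-encode : ∀ {m n} (A : Matrix m n) b t →
    ⟦ rhsP ⟧ₚ (encodeMatrix A ∷ encodeVec b ∷ t ∷ []) ≡ encodeℤ (rhs A b (readS n t))
  rhsP-encode {n = n} A b t rewrite tightestP-encode A b t with tightest A b (readS n t)
  ... | nothing = refl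
  ... | just z  = refl

rhss : ∀ {m n} → Matrix m n → Vec ℤ m → ∀ k → Tree → Vec ℤ k
rhss A b zero    t = []
rhss {n = n} A b (suc k) t = rhs A b (readS n (head t)) ∷ rhss A b k (tail t)

opaque
  private
    entryP : PTm 7
    entryP = callP rhsP (v5 ∷ v6 ∷ hdP v2 ∷ [])

  -- The first argument only provides the length of the result.
  rhssP : PTm 4
  rhssP = recP v0 v1 nilP (tlP v2) (consP (callP rhsP (v6 ∷ v7 ∷ hdP v3 ∷ [])) v0)
    (pb-const 0) (λ a l s ρ → ≤-trans (size-tail s) (m≤m+n (size s) 0))
    (pb-+ (pb-const 1) (sizeP entryP))
    (λ r a l s ρ → ≤-trans (size-∙ (⟦ entryP ⟧ₚ (a ∷ l ∷ s ∷ ρ)) r)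
                           (≤-reflexive (+-comm (1 + size (⟦ entryP ⟧ₚ (a ∷ l ∷ s ∷ ρ))) (size r))))

  rhssP-encode : ∀ {k p m n} (M : Matrix k p) (A : Matrix m n) b t →
    ⟦ rhssP ⟧ₚ (encodeMatrix M ∷ t ∷ encodeMatrix A ∷ encodeVec b ∷ []) ≡ encodeVec (rhss A b k t)
  rhssP-encode [] A b t = refl
  rhssP-encode (u ∷ M) A b t = cong₂ _∙_ (rhsP-encode A b (head t)) (rhssP-encode M A b (tail t))

-- Coordinate j is exact when d · xⱼ = vⱼ + β · Nⱼ, the pair vⱼ ∙ Nⱼ being entry j of the tree t.
Exact : ∀ {k n} → Vec ℤ n → Tree → Tree → Vec ℤ k → Set
Exact {n = n} β d t []      = 0 < val d
Exact {n = n} β d t (z ∷ x) =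
  valS (head (head t)) ℤ.+ β · readS n (tail (head t)) ≡ + val d ℤ.* z × Exact β d (tail t) x

exact⇒positive : ∀ {k n} (β : Vec ℤ n) d t (x : Vec ℤ k) → Exact β d t x → 0 < val d
exact⇒positive β d t []      e       = e
exact⇒positive β d t (z ∷ x) (_ , e) = exact⇒positive β d (tail t) x e

opaque
  private
    affineP : ∀ {k} → PTm k → PTm k → PTm k
    affineP β row = callP addDP (callP toDP (hdP row ∷ []) ∷ callP dotP (β ∷ tlP row ∷ []) ∷ [])

    coordinateP : PTm 7
    coordinateP = callP quotP (affineP v6 (hdP v2) ∷ v5 ∷ [])

    affine : Tree → Tree → Tree
    affine β row = ⟦ affineP v0 v1 ⟧ₚ (β ∷ row ∷ [])

  coordinatesP : PTm 4
  coordinatesP = recP v0 v1 nilP (tlP v2) (consP (callP quotP (affineP v7 (hdP v3) ∷ v6 ∷ [])) v0)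
    (pb-const 0) (λ a l s ρ → ≤-trans (size-tail s) (m≤m+n (size s) 0))
    (pb-+ (pb-const 1) (sizeP coordinateP))
    (λ r a l s ρ → ≤-trans (size-∙ (⟦ coordinateP ⟧ₚ (a ∷ l ∷ s ∷ ρ)) r)
                           (≤-reflexive (+-comm (1 + size (⟦ coordinateP ⟧ₚ (a ∷ l ∷ s ∷ ρ))) (size r))))

  coordinates-encoded : ∀ {k p} (M : Matrix k p) t d β →
    ∃[ x ] (⟦ coordinatesP ⟧ₚ (encodeMatrix M ∷ t ∷ d ∷ β ∷ []) ≡ encodeVec {k} x)
  coordinates-encoded [] t d β = [] , refl
  coordinates-encoded (u ∷ M) t d β =
    let z , e = quot-encoded (affine β (head t)) d
        x , f = coordinates-encoded M (tail t) d β
    in z ∷ x , cong₂ _∙_ e f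

  coordinates-exact : ∀ {k p n} (M : Matrix k p) t d (β : Vec ℤ n) x → Exact β d t x →
    ⟦ coordinatesP ⟧ₚ (encodeMatrix M ∷ t ∷ d ∷ encodeVec β ∷ []) ≡ encodeVec {k} x
  coordinates-exact [] t d β [] _ = refl
  coordinates-exact (u ∷ M) t d β (z ∷ x) (e , es) = cong₂ _∙_
    (quot-exact (affine (encodeVec β) (head t)) d z (exact⇒positive β d (tail t) x es)
      (trans (addD-val (⟦ toDP ⟧ₚ (head (head t) ∷ [])) (⟦ dotP ⟧ₚ (encodeVec β ∷ tail (head t) ∷ [])))
        (trans (cong₂ ℤ._+_ (toD-val (head (head t))) (dot-val β (tail (head t)))) e)))
    (coordinates-exact M (tail t) d β x es)

opaque
  -- A candidate d ∙ as ∙ rows stands for the vector (v + N β) / d, where β lists the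
  -- right-hand sides of the rows as and rows lists the pairs vⱼ ∙ Nⱼ.
  candidateP : PTm 4
  candidateP = callP coordinatesP
    (v0 ∷ tlP (tlP v3) ∷ hdP v3 ∷ callP rhssP (v0 ∷ hdP (tlP v3) ∷ v1 ∷ v2 ∷ []) ∷ [])

  candidate-encoded : ∀ {k p} (M : Matrix k p) A b t →
    ∃[ x ] (⟦ candidateP ⟧ₚ (encodeMatrix M ∷ A ∷ b ∷ t ∷ []) ≡ encodeVec {k} x)
  candidate-encoded M A b t = coordinates-encoded M (tail (tail t)) (head t) (⟦ rhssP ⟧ₚ (encodeMatrix M ∷ head (tail t) ∷ A ∷ b ∷ []))

  candidate-exact : ∀ {k p m n} (M : Matrix k p) (A : Matrix m n) b d as rows x → Exact (rhss A b k as) d rows x →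
    ⟦ candidateP ⟧ₚ (encodeMatrix M ∷ encodeMatrix A ∷ encodeVec b ∷ (d ∙ as ∙ rows) ∷ []) ≡ encodeVec {k} x
  candidate-exact M A b d as rows x e =
    trans (cong (λ β → ⟦ coordinatesP ⟧ₚ (encodeMatrix M ∷ rows ∷ d ∷ β ∷ [])) (rhssP-encode M A b as))
          (coordinates-exact M rows d _ x e)

data _∈T_ (t : Tree) : Tree → Set where
  here  : ∀ {l} → t ∈T (t ∙ l)
  there : ∀ {a l} → t ∈T l → t ∈T (a ∙ l)

opaque
  zerosP : PTm 1
  zerosP = recP v0 nilP nilP nilP (consP zeroP v0) (pb-const 0) (λ a l s ρ → z≤n)
    (pb-const 2) (λ r a l s ρ → ≤-reflexive (+-comm 2 (size r)))

  zeros-encode : ∀ {k p} (M : Matrix k p) → ⟦ zerosP ⟧ₚ (encodeMatrix M ∷ []) ≡ encodeVec (Vec.replicate k 0ℤ)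
  zeros-encode []      = refl
  zeros-encode (u ∷ M) = cong (encodeℤ 0ℤ ∙_) (zeros-encode M)

-- Selection of the best candidate

module _ {n m} (I : Instance n m) where
  open Instance I

  -- Stated as an implication because the search starts from the zero vector, which may be
  -- infeasible, and meets infeasible candidates.
  Improves : Vec ℤ n → Vec ℤ n → Set
  Improves w y = Feasible I y → Feasible I w × objective I w ℤ.≤ objective I y

  improves-refl : ∀ y → Improves y y
  improves-refl y f = f , ℤₚ.≤-refl

  improves-trans : ∀ {x y z} → Improves x y → Improves y z → Improves x z
  improves-trans p q f = let g , o = q f ; h , o′ = p g in h , ℤₚ.≤-trans o′ o

opaque
  selectP : PTm 5
  selectP = iteP (callP feasP (v1 ∷ v2 ∷ v4 ∷ []))
    (iteP (callP feasP (v1 ∷ v2 ∷ v3 ∷ []))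
      (iteP (callP leDP (callP bilinearP (v0 ∷ v3 ∷ v3 ∷ []) ∷ callP bilinearP (v0 ∷ v4 ∷ v4 ∷ []) ∷ [])) v3 v4) v4) v3

  select-size : ∀ q a b s x → size (⟦ selectP ⟧ₚ (q ∷ a ∷ b ∷ s ∷ x ∷ [])) ≤ size s + size x
  select-size q a b s x = size-ifT (⟦ feasP ⟧ₚ (a ∷ b ∷ x ∷ [])) _ s
    (size-ifT (⟦ feasP ⟧ₚ (a ∷ b ∷ s ∷ [])) _ x
      (size-ifT (⟦ leDP ⟧ₚ (⟦ bilinearP ⟧ₚ (q ∷ s ∷ s ∷ []) ∷ ⟦ bilinearP ⟧ₚ (q ∷ x ∷ x ∷ []) ∷ [])) s x p q′) q′) p
    where
    p : size s ≤ size s + size x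
    p = m≤m+n (size s) (size x)
    q′ : size x ≤ size s + size x
    q′ = m≤n+m (size x) (size s)

  select-improves : ∀ {n m} (I : Instance n m) y z → let open Instance I in
    ∃[ w ] (⟦ selectP ⟧ₚ (encodeMatrix Q ∷ encodeMatrix A ∷ encodeVec b ∷ encodeVec y ∷ encodeVec z ∷ []) ≡ encodeVec w ×
            Improves I w y × Improves I w z)
  select-improves I y z = choose (feas-decides A b z) (feas-decides A b y)
    (subst₂ (λ p q → Decides (p ℤ.≤ q) (⟦ leDP ⟧ₚ (oy ∷ oz ∷ []))) (bilinear-val Q y y) (bilinear-val Q z z) (leD-decides oy oz))
    where
    open Instance I
    oy oz : Tree
    oy = ⟦ bilinearP ⟧ₚ (encodeMatrix Q ∷ encodeVec y ∷ encodeVec y ∷ [])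
    oz = ⟦ bilinearP ⟧ₚ (encodeMatrix Q ∷ encodeVec z ∷ encodeVec z ∷ [])
    choose : ∀ {p q r} → Decides (Feasible I z) p → Decides (Feasible I y) q → Decides (objective I y ℤ.≤ objective I z) r →
      ∃[ w ] (ifT p (ifT q (ifT r (encodeVec y) (encodeVec z)) (encodeVec z)) (encodeVec y) ≡ encodeVec w ×
              Improves I w y × Improves I w z)
    choose (fails ¬f) _ _ = y , refl , improves-refl I y , λ f → ⊥-elim (¬f f)
    choose (holds _) (fails ¬f) _ = z , refl , (λ f → ⊥-elim (¬f f)) , improves-refl I z
    choose (holds _) (holds f) (holds o) = y , refl , improves-refl I y , λ _ → f , o
    choose (holds f) (holds _) (fails ¬o) = z , refl , (λ _ → f , ℤₚ.<⇒≤ (ℤₚ.≰⇒> ¬o)) , improves-refl I z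

opaque
  private
    candidate′P : PTm 6
    candidate′P = callP candidateP (v2 ∷ v3 ∷ v4 ∷ v0 ∷ [])

  -- The best vector so far is the parameter of the loop. The crude bound of `select-size`, a sum
  -- instead of a maximum, is just the additive growth that `recP` allows.
  bestP : PTm 4
  bestP = recP v3 (callP zerosP (v0 ∷ [])) v0
    (callP selectP (v3 ∷ v4 ∷ v5 ∷ v2 ∷ callP candidateP (v3 ∷ v4 ∷ v5 ∷ v0 ∷ []) ∷ [])) v0
    (sizeP candidate′P) (λ { a l s ρ@(q ∷ a′ ∷ b ∷ _ ∷ []) → select-size q a′ b s (⟦ candidate′P ⟧ₚ (a ∷ l ∷ ρ)) })
    (pb-const 0) (λ r a l s ρ → m≤m+n (size r) 0)

  best-improves : ∀ {n m} (I : Instance n m) P → let open Instance I in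
    ∃[ w ] (⟦ bestP ⟧ₚ (encodeMatrix Q ∷ encodeMatrix A ∷ encodeVec b ∷ P ∷ []) ≡ encodeVec w ×
            (∀ t → t ∈T P → ∀ x → ⟦ candidateP ⟧ₚ (encodeMatrix Q ∷ encodeMatrix A ∷ encodeVec b ∷ t ∷ []) ≡ encodeVec x →
             Improves I w x))
  best-improves {n} I P =
    let w , e , _ , im = recTree-ind (λ l s r → ∀ y → s ≡ encodeVec y → Best l y r)
          (λ { s y e → y , e , improves-refl I y , λ _ () }) step P (⟦ zerosP ⟧ₚ (encodeMatrix Q ∷ []))
          (Vec.replicate n 0ℤ) (zeros-encode Q)
    in w , e , im
    where
    open Instance I
    cand : Tree → Tree
    cand t = ⟦ candidateP ⟧ₚ (encodeMatrix Q ∷ encodeMatrix A ∷ encodeVec b ∷ t ∷ [])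
    select : Tree → Tree → Tree
    select s x = ⟦ selectP ⟧ₚ (encodeMatrix Q ∷ encodeMatrix A ∷ encodeVec b ∷ s ∷ x ∷ [])
    Best : Tree → Vec ℤ n → Tree → Set
    Best l y r = ∃[ w ] (r ≡ encodeVec w × Improves I w y × (∀ t → t ∈T l → ∀ x → cand t ≡ encodeVec x → Improves I w x))
    step : ∀ a l s r → (∀ y → select s (cand a) ≡ encodeVec y → Best l y r) → ∀ y → s ≡ encodeVec y → Best (a ∙ l) y r
    step a l s r ih y refl =
      let z , ez = candidate-encoded Q (encodeMatrix A) (encodeVec b) a
          v , ev , v≤y , v≤z = select-improves I y z
          w , ew , w≤v , rest = ih v (trans (cong (select (encodeVec y)) ez) ev)
      in w , ew , improves-trans I w≤v v≤y , λ
         { t here x ex → improves-trans I w≤v (subst (Improves I v) (encodeVec-injective z x (trans (sym ez) ex)) v≤z)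
         ; t (there p) x ex → rest t p x ex }
      where
      encodeVec-injective : ∀ {k} (u v : Vec ℤ k) → encodeVec u ≡ encodeVec v → u ≡ v
      encodeVec-injective {k} u v e = trans (sym (readS-encodeVec u)) (trans (cong (readS k) e) (readS-encodeVec v))

-- Unary lengths of the parameters

unary : ℕ → Tree
unary m = ticks m nil

opaque
  lengthP : PTm 1
  lengthP = recP v0 nilP nilP nilP (consP nilP v0) (pb-const 0) (λ a l s ρ → z≤n)
    (pb-const 1) (λ r a l s ρ → ≤-reflexive (+-comm 1 (size r)))

  length-matrix : ∀ {k p} (M : Matrix k p) → ⟦ lengthP ⟧ₚ (encodeMatrix M ∷ []) ≡ unary k
  length-matrix []      = refl
  length-matrix (u ∷ M) = cong (nil ∙_) (length-matrix M)

  length-list : ∀ {X : Set} (enc : X → Tree) xs → ⟦ lengthP ⟧ₚ (encodeList enc xs ∷ []) ≡ unary (List.length xs)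
  length-list enc []       = refl
  length-list enc (x ∷ xs) = cong (nil ∙_) (length-list enc xs)

opaque
  -- Only the bit length of `α` is required, and the length of a maximum is the maximum of the
  -- lengths; so lengths are compared and never numerals.
  longerP : PTm 2
  longerP = recP v0 v1 v0 (tlP v2) (consP nilP v0)
    (pb-const 0) (λ a l s ρ → ≤-trans (size-tail s) (m≤m+n (size s) 0))
    (pb-const 1) (λ r a l s ρ → ≤-reflexive (+-comm 1 (size r)))

  longer-size : ∀ x y → size (⟦ longerP ⟧ₚ (x ∷ y ∷ [])) ≤ size y + size x
  longer-size = recTree-ind (λ x y r → size r ≤ size y + size x) (λ y → m≤m+n (size y) 0)
    (λ a l y r ih → ≤-trans (s≤s (≤-trans ih (+-monoˡ-≤ (size l) (size-tail y))))
      (≤-trans (≤-reflexive (sym (+-suc (size y) (size l)))) (+-monoʳ-≤ (size y) (+-monoˡ-≤ (size l) (m≤m⊔n 1 (size a))))))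

  longer-unary : ∀ {X : Set} (enc : X → Tree) xs k → ⟦ longerP ⟧ₚ (encodeList enc xs ∷ unary k ∷ []) ≡ unary (List.length xs ⊔ k)
  longer-unary enc []       k       = refl
  longer-unary enc (x ∷ xs) zero    = cong (nil ∙_) (trans (longer-unary enc xs zero) (cong unary (⊔-identityʳ (List.length xs))))
  longer-unary enc (x ∷ xs) (suc k) = cong (nil ∙_) (longer-unary enc xs k)

sizeℕ-mono : ∀ {m n} → m ≤ n → sizeℕ m ≤ sizeℕ n
sizeℕ-mono {m} {n} m≤n = mono (≤⇒≤′ m≤n)
  where
  length-increment : ∀ bs → List.length bs ≤ List.length (increment bs)
  length-increment []           = z≤n
  length-increment (false ∷ bs) = ≤-refl
  length-increment (true ∷ bs)  = s≤s (length-increment bs)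
  mono : ∀ {n} → m ≤′ n → sizeℕ m ≤ sizeℕ n
  mono ≤′-refl = ≤-refl
  mono {suc n} (≤′-step p) = ≤-trans (mono p) (length-increment (bits n))

sizeℕ-⊔ : ∀ m n → sizeℕ (m ⊔ n) ≡ sizeℕ m ⊔ sizeℕ n
sizeℕ-⊔ = mono-≤-distrib-⊔ sizeℕ-mono

maxRow : ∀ {n} → Vec ℤ n → ℕ
maxRow r = Vec.foldr (λ _ → ℕ) _⊔_ 0 (Vec.map ∣_∣ r)

opaque
  rowMaxP : PTm 2
  rowMaxP = recP v0 v1 v0 (callP longerP (tlP v0 ∷ v2 ∷ [])) v0
    {g = λ ρ → size (lookup ρ zero)} (sizeP v0) (λ a l s ρ → ≤-trans (longer-size (tail a) s) (+-monoʳ-≤ (size s) (size-tail a)))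
    (pb-const 0) (λ r a l s ρ → m≤m+n (size r) 0)

  rowMax-size : ∀ x y → size (⟦ rowMaxP ⟧ₚ (x ∷ y ∷ [])) ≤ size y + size x
  rowMax-size = recTree-ind (λ x y r → size r ≤ size y + size x) (λ y → m≤m+n (size y) 0)
    (λ a l y r ih → ≤-trans ih (≤-trans (+-monoˡ-≤ (size l)
      (≤-trans (longer-size (tail a) y) (+-monoʳ-≤ (size y) (≤-trans (size-tail a) (m≤n⊔m 1 (size a))))))
      (≤-reflexive (+-assoc (size y) (1 ⊔ size a) (size l)))))

  rowMax-unary : ∀ {n} (u : Vec ℤ n) k → ⟦ rowMaxP ⟧ₚ (encodeVec u ∷ unary (sizeℕ k) ∷ []) ≡ unary (sizeℕ (maxRow u ⊔ k))
  rowMax-unary []      k = refl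
  rowMax-unary (z ∷ u) k = trans (cong (λ s → ⟦ rowMaxP ⟧ₚ (encodeVec u ∷ s ∷ []))
      (trans (longer-unary encodeBool (bits ∣ z ∣) (sizeℕ k)) (cong unary (sym (sizeℕ-⊔ ∣ z ∣ k)))))
    (trans (rowMax-unary u (∣ z ∣ ⊔ k)) (cong (λ e → unary (sizeℕ e))
      (trans (sym (⊔-assoc (maxRow u) ∣ z ∣ k)) (cong (_⊔ k) (⊔-comm (maxRow u) ∣ z ∣)))))

opaque
  matrixMaxP : PTm 2
  matrixMaxP = recP v0 v1 v0 (callP rowMaxP (v0 ∷ v2 ∷ [])) v0
    {g = λ ρ → size (lookup ρ zero)} (sizeP v0) (λ a l s ρ → rowMax-size a s)
    (pb-const 0) (λ r a l s ρ → m≤m+n (size r) 0)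

  matrixMax-unary : ∀ {k n} (M : Matrix k n) a → ⟦ matrixMaxP ⟧ₚ (encodeMatrix M ∷ unary (sizeℕ a) ∷ []) ≡ unary (sizeℕ (maxAbs M ⊔ a))
  matrixMax-unary []      a = refl
  matrixMax-unary (u ∷ M) a = trans (cong (λ s → ⟦ matrixMaxP ⟧ₚ (encodeMatrix M ∷ s ∷ [])) (rowMax-unary u a))
    (trans (matrixMax-unary M (maxRow u ⊔ a)) (cong (λ e → unary (sizeℕ e))
      (trans (sym (⊔-assoc (maxAbs M) (maxRow u) a)) (cong (_⊔ a) (⊔-comm (maxAbs M) (maxRow u))))))

opaque
  alphaP : PTm 2
  -- The initial value `consP nilP nilP` is `unary (sizeℕ 0)`, as the numeral of 0 has one digit.
  alphaP = callP matrixMaxP (v0 ∷ callP matrixMaxP (v1 ∷ consP nilP nilP ∷ []) ∷ [])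

  alpha-unary : ∀ {n m} (I : Instance n m) → let open Instance I in
    ⟦ alphaP ⟧ₚ (encodeMatrix Q ∷ encodeMatrix A ∷ []) ≡ unary (sizeℕ (α I))
  alpha-unary I = trans (cong (λ s → ⟦ matrixMaxP ⟧ₚ (encodeMatrix Q ∷ s ∷ []))
      (trans (matrixMax-unary A 0) (cong (λ e → unary (sizeℕ e)) (⊔-identityʳ (maxAbs A)))))
    (matrixMax-unary Q (maxAbs A))
    where open Instance I

-- Enumeration of candidates

x0 : ∀ {k} → Tm (1 + k)
x0 = var zero
x1 : ∀ {k} → Tm (2 + k)
x1 = var (suc zero)
x2 : ∀ {k} → Tm (3 + k)
x2 = var (suc (suc zero))
x3 : ∀ {k} → Tm (4 + k)
x3 = var (suc (suc (suc zero)))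
x5 : ∀ {k} → Tm (6 + k)
x5 = var (suc (suc (suc (suc (suc zero)))))

opaque
  prefixAllT : Tm 3
  prefixAllT = rec x0 nil x3 nil (cons (cons x5 x1) x0)

  prefixAll-new : ∀ {t L} s acc → t ∈T L → (s ∙ t) ∈T ⟦ prefixAllT ⟧ (L ∷ s ∷ acc ∷ [])
  prefixAll-new s acc here      = here
  prefixAll-new s acc (there p) = there (prefixAll-new s acc p)

  prefixAll-old : ∀ {t} L s acc → t ∈T acc → t ∈T ⟦ prefixAllT ⟧ (L ∷ s ∷ acc ∷ [])
  prefixAll-old nil     s acc p = p
  prefixAll-old (a ∙ L) s acc p = there (prefixAll-old L s acc p)

opaque
  productT : Tm 2
  productT = rec x0 nil nil nil (call prefixAllT (x5 ∷ x1 ∷ x0 ∷ []))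

  product-∈ : ∀ {s t S} L → s ∈T S → t ∈T L → (s ∙ t) ∈T ⟦ productT ⟧ (S ∷ L ∷ [])
  product-∈ {s} {S = _ ∙ S} L here      q = prefixAll-new s (⟦ productT ⟧ (S ∷ L ∷ [])) q
  product-∈ {S = a ∙ S}     L (there p) q = prefixAll-old L a (⟦ productT ⟧ (S ∷ L ∷ [])) (product-∈ L p q)

opaque
  powerT : Tm 2
  powerT = rec x0 nil (cons nil nil) nil (call productT (x5 ∷ x0 ∷ []))

  power-∈ : ∀ {k} (ρ : Vec Tree k) S → All (_∈T S) ρ → envTree ρ ∈T ⟦ powerT ⟧ (unary k ∷ S ∷ [])
  power-∈ []      S []       = here
  power-∈ {suc k} (x ∷ ρ) S (p ∷ ps) = product-∈ (⟦ powerT ⟧ (unary k ∷ S ∷ [])) p (power-∈ ρ S ps)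

opaque
  appendT : Tm 2
  appendT = rec x0 nil x2 nil (cons nil x0)

  append-unary : ∀ k l → ⟦ appendT ⟧ (unary k ∷ unary l ∷ []) ≡ unary (k + l)
  append-unary zero    l = refl
  append-unary (suc k) l = cong (nil ∙_) (append-unary k l)

doubleT : Tm 1
doubleT = call appendT (x0 ∷ x0 ∷ [])

κ : ℕ → ℕ → ℕ
κ n ℓ = (n + ℓ + 1) * 8 ^ n

opaque
  κT : Tm 2
  κT = rec x0 nil (cons nil (call appendT (x1 ∷ x2 ∷ []))) nil (call doubleT (call doubleT (call doubleT (x0 ∷ []) ∷ []) ∷ []))

  κ-unary : ∀ n ℓ → ⟦ κT ⟧ (unary n ∷ unary ℓ ∷ []) ≡ unary (κ n ℓ)
  κ-unary n ℓ = iterate n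
    where
    base : Tree
    base = nil ∙ ⟦ appendT ⟧ (unary n ∷ unary ℓ ∷ [])
    double : Tree → Tree
    double t = ⟦ doubleT ⟧ (t ∷ [])
    iter : ℕ → Tree
    iter k = recTree (λ _ → base) (λ _ _ _ → nil) (λ r _ _ _ → double (double (double r))) (unary k) nil
    eight : ∀ a b → a * b + a * b + (a * b + a * b) + (a * b + a * b + (a * b + a * b)) ≡ a * (8 * b)
    eight = solve-∀
    iterate : ∀ k → iter k ≡ unary ((n + ℓ + 1) * 8 ^ k)
    iterate zero    = trans (cong (nil ∙_) (append-unary n ℓ))
      (cong unary (trans (+-comm 1 (n + ℓ)) (sym (*-identityʳ (n + ℓ + 1)))))
    iterate (suc k) = trans (cong (λ t → double (double (double t))) (iterate k))
      (trans (cong (λ t → double (double t)) (append-unary e e))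
      (trans (cong double (append-unary (e + e) (e + e)))
      (trans (append-unary (e + e + (e + e)) (e + e + (e + e))) (cong unary (eight (n + ℓ + 1) (8 ^ k))))))
      where
      e : ℕ
      e = (n + ℓ + 1) * 8 ^ k

twoBits : Tree
twoBits = nil ∙ one ∙ nil

-- A fixed width makes every number below `2 ^ k` a `k`-tuple over `twoBits`, which `powerT`
-- enumerates.
binary : ∀ k → ℕ → Vec Tree k
binary zero    m = []
binary (suc k) m with m % 2
... | zero  = nil ∷ binary k (m / 2)
... | suc _ = one ∷ binary k (m / 2)

binary-∈ : ∀ k m → All (_∈T twoBits) (binary k m)
binary-∈ zero    m = []
binary-∈ (suc k) m with m % 2
... | zero  = here ∷ binary-∈ k (m / 2)
... | suc _ = there here ∷ binary-∈ k (m / 2)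

binary-val : ∀ k m → m < 2 ^ k → val (envTree (binary k m)) ≡ m
binary-val zero    zero    p = refl
binary-val zero    (suc m) (s≤s ())
binary-val (suc k) m p with m % 2 | m≡m%n+[m/n]*n m 2 | m%n<n m 2
... | zero | eq | _ = trans (cong (2 *_) (binary-val k (m / 2) (m<n*o⇒m/o<n (≤-trans p (≤-reflexive (*-comm 2 (2 ^ k)))))))
                        (trans (*-comm 2 (m / 2)) (sym eq))
... | suc zero | eq | _ = trans (cong (λ v → 1 + 2 * v) (binary-val k (m / 2) (m<n*o⇒m/o<n (≤-trans p (≤-reflexive (*-comm 2 (2 ^ k)))))))
                            (trans (cong suc (*-comm 2 (m / 2))) (sym eq))
... | suc (suc _) | _ | s≤s (s≤s ())

module Trees (K : ℕ) where

  Small : ℤ → Set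
  Small z = ∣ z ∣ < 2 ^ K

  coefficient : ℤ → Tree
  coefficient z = encodeBool (isNegative z) ∙ envTree (binary K ∣ z ∣)

  vector : ∀ {k} → Vec ℤ k → Tree
  vector u = envTree (Vec.map coefficient u)

  rows : ∀ {k n} → Vec ℤ k → Matrix k n → Tree
  rows v N = envTree (Vec.zipWith (λ z u → coefficient z ∙ vector u) v N)

  valS-coefficient : ∀ z → Small z → valS (coefficient z) ≡ z
  valS-coefficient (+ m)    p = cong +_ (binary-val K m p)
  valS-coefficient -[1+ m ] p = cong (λ v → ℤ.- (+ v)) (binary-val K (suc m) p)

  readS-vector : ∀ {k} (u : Vec ℤ k) → All Small u → readS k (vector u) ≡ u
  readS-vector []      []       = refl
  readS-vector (z ∷ u) (p ∷ ps) = cong₂ _∷_ (valS-coefficient z p) (readS-vector u ps)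

  rhss-vectors : ∀ {m n k} (A : Matrix m n) b (as : Matrix k n) → All (All Small) as →
                 rhss A b k (envTree (Vec.map vector as)) ≡ Vec.map (rhs A b) as
  rhss-vectors A b []       []       = refl
  rhss-vectors A b (a ∷ as) (p ∷ ps) = cong₂ _∷_ (cong (rhs A b) (readS-vector a p)) (rhss-vectors A b as ps)

  exact-rows : ∀ {k n} (β : Vec ℤ n) d v (N : Matrix k n) x → d < 2 ^ K → 0 < d → All Small v → All (All Small) N →
               (∀ j → lookup v j ℤ.+ β · lookup N j ≡ + d ℤ.* lookup x j) →
               Exact β (envTree (binary K d)) (rows v N) x
  exact-rows β d [] [] [] d< d>0 _ _ e = ≤-trans d>0 (≤-reflexive (sym (binary-val K d d<)))
  exact-rows {n = n} β d (z ∷ v) (u ∷ N) (w ∷ x) d< d>0 (p ∷ ps) (q ∷ qs) e =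
    trans (cong₂ (λ a c → a ℤ.+ β · c) (valS-coefficient z p) (readS-vector u q))
      (trans (e zero) (cong (λ a → + a ℤ.* w) (sym (binary-val K d d<)))) ,
    exact-rows β d v N x d< d>0 ps qs (λ j → e (suc j))

opaque
  -- The nested calls act as `let`: bit strings, signed coefficients and vectors are each listed
  -- once and then shared. Denominator, rows and pairs `vⱼ ∙ Nⱼ` are chosen independently; most
  -- choices describe no integer point, which does no harm.
  enumerateT : Tm 2
  enumerateT = call strings (x0 ∷ call powerT (cons nil (call κT (x0 ∷ x1 ∷ [])) ∷ cons nil (cons (cons nil nil) nil) ∷ []) ∷ [])
    where
    candidates : Tm 4
    candidates = call productT (x1 ∷ call productT
      (call powerT (x0 ∷ x3 ∷ []) ∷ call powerT (x0 ∷ call productT (x2 ∷ x3 ∷ []) ∷ []) ∷ []) ∷ [])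
    vectors : Tm 3
    vectors = call candidates (x0 ∷ x1 ∷ x2 ∷ call powerT (x0 ∷ x2 ∷ []) ∷ [])
    strings : Tm 2
    strings = call vectors (x0 ∷ x1 ∷ call productT (cons nil (cons (cons nil nil) nil) ∷ x1 ∷ []) ∷ [])

  enumerate-∈ : ∀ n ℓ → let open Trees (suc (κ n ℓ)) in (d : ℕ) (as : Matrix n n) (v : Vec ℤ n) (N : Matrix n n) →
    (envTree (binary (suc (κ n ℓ)) d) ∙ envTree (Vec.map vector as) ∙ rows v N) ∈T ⟦ enumerateT ⟧ (unary n ∷ unary ℓ ∷ [])
  enumerate-∈ n ℓ d as v N =
    product-∈ _ (string-∈ d) (product-∈ _ (power-∈ (Vec.map vector as) vecs (all-map vector as vector-∈))
      (power-∈ (Vec.zipWith (λ z u → coefficient z ∙ vector u) v N) (⟦ productT ⟧ (coefs ∷ vecs ∷ [])) (rows-∈ v N)))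
    where
    K : ℕ
    K = suc (κ n ℓ)
    open Trees K
    strs coefs vecs : Tree
    strs = ⟦ powerT ⟧ ((nil ∙ ⟦ κT ⟧ (unary n ∷ unary ℓ ∷ [])) ∷ twoBits ∷ [])
    coefs = ⟦ productT ⟧ (twoBits ∷ strs ∷ [])
    vecs = ⟦ powerT ⟧ (unary n ∷ coefs ∷ [])
    string-∈ : ∀ m → envTree (binary K m) ∈T strs
    string-∈ m = subst (λ u → envTree (binary K m) ∈T ⟦ powerT ⟧ ((nil ∙ u) ∷ twoBits ∷ [])) (sym (κ-unary n ℓ))
      (power-∈ (binary K m) twoBits (binary-∈ K m))
    sign-∈ : ∀ s → encodeBool s ∈T twoBits
    sign-∈ false = here
    sign-∈ true  = there here
    coefficient-∈ : ∀ z → coefficient z ∈T coefs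
    coefficient-∈ z = product-∈ strs (sign-∈ (isNegative z)) (string-∈ ∣ z ∣)
    all-map : ∀ {X : Set} {S k} (f : X → Tree) (xs : Vec X k) → (∀ x → f x ∈T S) → All (_∈T S) (Vec.map f xs)
    all-map f []       h = []
    all-map f (x ∷ xs) h = h x ∷ all-map f xs h
    vector-∈ : ∀ (u : Vec ℤ n) → vector u ∈T vecs
    vector-∈ u = power-∈ (Vec.map coefficient u) coefs (all-map coefficient u coefficient-∈)
    rows-∈ : ∀ {k} (v : Vec ℤ k) (N : Matrix k n) →
             All (_∈T ⟦ productT ⟧ (coefs ∷ vecs ∷ [])) (Vec.zipWith (λ z u → coefficient z ∙ vector u) v N)
    rows-∈ []      []      = []
    rows-∈ (z ∷ v) (u ∷ N) = product-∈ vecs (coefficient-∈ z) (vector-∈ u) ∷ rows-∈ v N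

opaque
  -- Exponential in the length of the numeral. It occurs only in the computation of the
  -- parameter-dependent factor; the solver obtains `unary n` as the number of rows of `Q`.
  fromBinaryT : Tm 1
  fromBinaryT = rec x0 nil nil nil (ite x1 (cons nil (call doubleT (x0 ∷ []))) (call doubleT (x0 ∷ [])))

  fromBinary-val : ∀ t → ⟦ fromBinaryT ⟧ (t ∷ []) ≡ unary (val t)
  fromBinary-val t = recTree-ind (λ t _ r → r ≡ unary (val t)) (λ _ → refl) step t nil
    where
    double : ∀ v → ⟦ doubleT ⟧ (unary v ∷ []) ≡ unary (2 * v)
    double v = trans (append-unary v v) (cong (λ w → unary (v + w)) (sym (+-identityʳ v)))
    step : ∀ a l (s r : Tree) → r ≡ unary (val l) → ifT a (nil ∙ ⟦ doubleT ⟧ (r ∷ [])) (⟦ doubleT ⟧ (r ∷ [])) ≡ unary (val (a ∙ l))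
    step nil     l s r refl = double (val l)
    step (_ ∙ _) l s r refl = cong (nil ∙_) (double (val l))

-- Completeness of the enumeration

·-dot : ∀ {n} (u v : Vec ℤ n) → u · v ≡ dot (lookup u) (lookup v)
·-dot []      []      = refl
·-dot (x ∷ u) (y ∷ v) = cong (λ z → x ℤ.* y ℤ.+ z) (·-dot u v)

·-tabulate : ∀ {n} (u : Vec ℤ n) (x : Fin n → ℤ) → u · tabulate x ≡ dot (lookup u) x
·-tabulate u x = trans (·-dot u (tabulate x)) (∑-cong (λ i → cong (lookup u i ℤ.*_) (lookup∘tabulate x i)))

pointwise-tabulate : ∀ {m n} (A : Matrix m n) b (x : Vec ℤ n) → (∀ i → lookup A i · x ℤ.≤ lookup b i) → Pointwise ℤ._≤_ (A *ᵥ x) b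
pointwise-tabulate []      []      x h = []
pointwise-tabulate (u ∷ A) (z ∷ b) x h = h zero ∷ pointwise-tabulate A b x (h ∘ suc)

pointwise-lookup : ∀ {m n} (A : Matrix m n) b (x : Vec ℤ n) → Pointwise ℤ._≤_ (A *ᵥ x) b → ∀ i → lookup A i · x ℤ.≤ lookup b i
pointwise-lookup (u ∷ A) (z ∷ b) x (p ∷ _)  zero    = p
pointwise-lookup (u ∷ A) (z ∷ b) x (_ ∷ ps) (suc i) = pointwise-lookup A b x ps i

maxRow-bound : ∀ {n} (u : Vec ℤ n) j → ∣ lookup u j ∣ ≤ maxRow u
maxRow-bound (z ∷ u) zero    = m≤m⊔n ∣ z ∣ (maxRow u)
maxRow-bound (z ∷ u) (suc j) = ≤-trans (maxRow-bound u j) (m≤n⊔m ∣ z ∣ (maxRow u))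

maxAbs-bound : ∀ {m n} (M : Matrix m n) i j → ∣ lookup (lookup M i) j ∣ ≤ maxAbs M
maxAbs-bound (u ∷ M) zero    j = ≤-trans (maxRow-bound u j) (m≤m⊔n (maxRow u) (maxAbs M))
maxAbs-bound (u ∷ M) (suc i) j = ≤-trans (maxAbs-bound M i j) (m≤n⊔m (maxRow u) (maxAbs M))

n<2^sizeℕ : ∀ n → n < 2 ^ sizeℕ n
n<2^sizeℕ n = subst (_< 2 ^ sizeℕ n) (val-encodeℕ n) (val<2^length (bits n))
  where
  double : ∀ {v w} c → c ≤ 1 → v < w → c + 2 * v < 2 * w
  double {v} c c≤1 v<w = ≤-trans (s≤s (+-monoˡ-≤ (2 * v) c≤1)) (≤-trans (≤-reflexive (sym (*-suc 2 v))) (*-monoʳ-≤ 2 v<w))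
  val<2^length : ∀ bs → val (encodeList encodeBool bs) < 2 ^ List.length bs
  val<2^length []       = s≤s z≤n
  val<2^length (c ∷ bs) = double (bit (encodeBool c)) (bit≤1 (encodeBool c)) (val<2^length bs)

smaller-≤ˡ : ∀ y z → smaller (just y) z ℤ.≤ y
smaller-≤ˡ y z with y ℤ.≤? z
... | yes _  = ℤₚ.≤-refl
... | no y≰z = ℤₚ.<⇒≤ (ℤₚ.≰⇒> y≰z)

smaller-≤ʳ : ∀ y z → smaller y z ℤ.≤ z
smaller-≤ʳ nothing  z = ℤₚ.≤-refl
smaller-≤ʳ (just y) z with y ℤ.≤? z
... | yes y≤z = y≤z
... | no  _   = ℤₚ.≤-refl

tightest-least : ∀ {m n} (A : Matrix m n) b a i → lookup A i ≡ a → ∃[ z ] (tightest A b a ≡ just z × z ℤ.≤ lookup b i)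
tightest-least (u ∷ A) (z ∷ b) a i e with ≡-dec ℤ._≟_ u a
tightest-least (u ∷ A) (z ∷ b) a zero    e | yes _ = _ , refl , smaller-≤ʳ (tightest A b a) z
tightest-least (u ∷ A) (z ∷ b) a (suc i) e | yes _ with tightest A b a | tightest-least A b a i e
... | .(just y) | y , refl , y≤ = _ , refl , ℤₚ.≤-trans (smaller-≤ˡ y z) y≤
tightest-least (u ∷ A) (z ∷ b) a zero    e | no u≢a = ⊥-elim (u≢a e)
tightest-least (u ∷ A) (z ∷ b) a (suc i) e | no _ = tightest-least A b a i e

tightest-attained : ∀ {m n} (A : Matrix m n) b a z → tightest A b a ≡ just z → ∃[ i ] (lookup A i ≡ a × lookup b i ≡ z)
tightest-attained [] [] a z ()
tightest-attained (u ∷ A) (y ∷ b) a z e with ≡-dec ℤ._≟_ u a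
tightest-attained (u ∷ A) (y ∷ b) a z e | no _ = let i , p , q = tightest-attained A b a z e in suc i , p , q
tightest-attained (u ∷ A) (y ∷ b) a z e | yes u≡a with tightest A b a in eq
tightest-attained (u ∷ A) (y ∷ b) a .y refl | yes u≡a | nothing = zero , u≡a , refl
tightest-attained (u ∷ A) (y ∷ b) a z e | yes u≡a | just w with w ℤ.≤? y
tightest-attained (u ∷ A) (y ∷ b) a .w refl | yes u≡a | just w | yes _ = let i , p , q = tightest-attained A b a w eq in suc i , p , q
tightest-attained (u ∷ A) (y ∷ b) a .y refl | yes u≡a | just w | no _ = zero , u≡a , refl

rhs-least : ∀ {m n} (A : Matrix m n) b i → rhs A b (lookup A i) ℤ.≤ lookup b i
rhs-least A b i with tightest A b (lookup A i) | tightest-least A b (lookup A i) i refl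
... | .(just z) | z , refl , z≤ = z≤

-- Because the least right-hand side is attained by an equal row, feasible points satisfy row `i`
-- with `b i` replaced by this smaller value.
rhs-attained : ∀ {m n} (A : Matrix m n) b i → ∃[ j ] (lookup A j ≡ lookup A i × lookup b j ≡ rhs A b (lookup A i))
rhs-attained A b i with tightest A b (lookup A i) in eq | tightest-least A b (lookup A i) i refl
... | .(just z) | z , refl , _ = tightest-attained A b (lookup A i) z eq

all-tabulate : ∀ {X : Set} {P : X → Set} {k} (f : Fin k → X) → (∀ i → P (f i)) → All P (tabulate f)
all-tabulate {k = zero}  f h = []
all-tabulate {k = suc k} f h = h zero ∷ all-tabulate (f ∘ suc) (h ∘ suc)

-- The denominator of a candidate is a natural number, so the equation of a state is multiplied by
-- the sign `σ` of `d`.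
unsign : ∀ d → d ≢ 0ℤ → ∃[ σ ] (∣ σ ∣ ≡ 1 × σ ℤ.* d ≡ + ∣ d ∣ × 0 < ∣ d ∣)
unsign (+ zero)  d≢0 = ⊥-elim (d≢0 refl)
unsign (+ suc k) d≢0 = 1ℤ , refl , ℤₚ.*-identityˡ _ , s≤s z≤n
unsign -[1+ k ]  d≢0 = -1ℤ , refl , cong (λ e → + suc e) (+-identityʳ k) , s≤s z≤n

module Candidates {n m} (I : Instance n m) where
  open Instance I

  ℓ : ℕ
  ℓ = sizeℕ (α I)

  enumeration : Tree
  enumeration = ⟦ enumerateT ⟧ (unary n ∷ unary ℓ ∷ [])

  IsCandidate : Vec ℤ n → Set
  IsCandidate x = ∃[ t ] (t ∈T enumeration × ⟦ candidateP ⟧ₚ (encodeMatrix Q ∷ encodeMatrix A ∷ encodeVec b ∷ t ∷ []) ≡ encodeVec x)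

  rowOf : Maybe (Fin m) → Vec ℤ n
  rowOf nothing  = Vec.replicate n 0ℤ
  rowOf (just i) = lookup A i

  -- The dummy slot is named by the zero vector, so that the candidate evaluation, which knows rows
  -- only by their entries, assigns it the same value.
  β : Maybe (Fin m) → ℤ
  β i = rhs A b (rowOf i)

  B : ℕ
  B = 2 ^ (n + ℓ + 1)

  private
    2^-≤ : ∀ {k e} → e ≤ n + ℓ + 1 → k ≤ 2 ^ e → k ≤ B
    2^-≤ p q = ≤-trans q (^-monoʳ-≤ 2 p)

  2≤B : 2 ≤ B
  2≤B = 2^-≤ {e = 1} (m≤n+m 1 (n + ℓ)) ≤-refl

  n≤B : n ≤ B
  n≤B = 2^-≤ {e = n} (≤-trans (m≤m+n n ℓ) (m≤m+n (n + ℓ) 1)) (<⇒≤ (n<2^n n))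

  α≤B : α I ≤ B
  α≤B = 2^-≤ {e = ℓ} (≤-trans (m≤n+m ℓ n) (m≤m+n (n + ℓ) 1)) (<⇒≤ (n<2^sizeℕ (α I)))

  A≤α : ∀ i j → ∣ lookup (lookup A i) j ∣ ≤ α I
  A≤α i j = ≤-trans (maxAbs-bound A i j) (m≤n⊔m (maxAbs Q) (maxAbs A))

  Q≤α : ∀ i j → ∣ lookup (lookup Q i) j ∣ ≤ α I
  Q≤α i j = ≤-trans (maxAbs-bound Q i j) (m≤m⊔n (maxAbs Q) (maxAbs A))

  module _ (Q′ : Fin n → Fin n → ℤ) (Q′-sym : ∀ i j → Q′ i j ≡ Q′ j i) (Q′≤α : ∀ i j → ∣ Q′ i j ∣ ≤ α I) where
    open Descent (λ i → lookup (lookup A i)) (lookup b) Q′ Q′-sym (α I) A≤α Q′≤α β using (Feas; obj; module Tightened)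

    feas⇒feasible : ∀ x → Feas x → Feasible I (tabulate x)
    feas⇒feasible x f = pointwise-tabulate A b (tabulate x) (λ i → ℤₚ.≤-trans (ℤₚ.≤-reflexive (·-tabulate (lookup A i) x)) (f i))

    feasible⇒feas : ∀ y → Feasible I y → Feas (lookup y)
    feasible⇒feas y f i = ℤₚ.≤-trans (ℤₚ.≤-reflexive (sym (·-dot (lookup A i) y))) (pointwise-lookup A b y f i)

    β-upper : ∀ x → Feas x → ∀ i → dot (lookup (lookup A i)) x ℤ.≤ β (just i)
    β-upper x f i = let j , e , e′ = rhs-attained A b i in
      subst₂ (λ u z → dot (lookup u) x ℤ.≤ z) e e′ (f j)

    open Tightened β-upper (rhs-least A b) using (State; descend)

    -- With no direction left the flat is a single point. `N` is the transpose of `cs`, since a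
    -- candidate is organised by coordinates.
    state⇒candidate : ∀ x → State 0 n (B ^ (8 ^ n)) x → IsCandidate (tabulate x)
    state⇒candidate x st = envTree (binary K ∣ d ∣) ∙ envTree (Vec.map vector as) ∙ rows v′ N , enumerate-∈ n ℓ ∣ d ∣ as v′ N ,
      candidate-exact Q A b (envTree (binary K ∣ d ∣)) (envTree (Vec.map vector as)) (rows v′ N) (tabulate x)
        (subst (λ r → Exact r (envTree (binary K ∣ d ∣)) (rows v′ N) (tabulate x)) (sym (rhss-vectors A b as as-small))
        (exact-rows (Vec.map (rhs A b) as) ∣ d ∣ v′ N (tabulate x) (small d≤B) d>0
          (all-tabulate _ (λ j → scaled (v j) (v≤B j)))
          (all-tabulate _ (λ j → all-tabulate _ (λ i → scaled (cs i j) (cs≤B i j)))) equation))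
      where
      open State st
      K : ℕ
      K = suc (κ n ℓ)
      open Trees K
      σ : ℤ
      σ = proj₁ (unsign d d≢0)
      ∣σ∣≡1 : ∣ σ ∣ ≡ 1
      ∣σ∣≡1 = proj₁ (proj₂ (unsign d d≢0))
      σd≡∣d∣ : σ ℤ.* d ≡ + ∣ d ∣
      σd≡∣d∣ = proj₁ (proj₂ (proj₂ (unsign d d≢0)))
      d>0 : 0 < ∣ d ∣
      d>0 = proj₂ (proj₂ (proj₂ (unsign d d≢0)))
      as : Matrix n n
      as = tabulate (λ i → rowOf (is i))
      v′ : Vec ℤ n
      v′ = tabulate (λ j → σ ℤ.* v j)
      N : Matrix n n
      N = tabulate (λ j → tabulate (λ i → σ ℤ.* cs i j))
      -- The bounds of a state are inclusive, so the value `2 ^ κ n ℓ` itself may occur; this is the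
      -- reason for the extra bit in `K`.
      small : ∀ {k} → k ≤ B ^ (8 ^ n) → k < 2 ^ K
      small p = ≤-trans (s≤s (≤-trans p (≤-reflexive (^-*-assoc 2 (n + ℓ + 1) (8 ^ n)))))
        (≤-trans (+-monoˡ-≤ (2 ^ κ n ℓ) (m^n>0 2 (κ n ℓ))) (+-monoʳ-≤ (2 ^ κ n ℓ) (m≤m+n (2 ^ κ n ℓ) 0)))
      scaled : ∀ z → ∣ z ∣ ≤ B ^ (8 ^ n) → Small (σ ℤ.* z)
      scaled z p = small (≤-trans (≤-reflexive (trans (ℤₚ.abs-* σ z) (trans (cong (_* ∣ z ∣) ∣σ∣≡1) (*-identityˡ ∣ z ∣)))) p)
      B≤ : B ≤ B ^ (8 ^ n)
      B≤ = ≤-trans (≤-reflexive (sym (*-identityʳ B))) (^-monoʳ-≤ B ⦃ >-nonZero (≤-trans (s≤s z≤n) 2≤B) ⦄ (m^n>0 8 n))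
      row-small : ∀ i j → Small (lookup (rowOf i) j)
      row-small nothing  j = subst Small (sym (lookup-replicate j 0ℤ)) (small {0} z≤n)
      row-small (just i) j = small (≤-trans (A≤α i j) (≤-trans α≤B B≤))
      as-small : All (All Small) as
      as-small = all-tabulate _ (λ i → subst (All Small) (tabulate∘lookup (rowOf (is i))) 
        (all-tabulate (lookup (rowOf (is i))) (row-small (is i))))
      equation : ∀ j → lookup v′ j ℤ.+ Vec.map (rhs A b) as · lookup N j ≡ + ∣ d ∣ ℤ.* lookup (tabulate x) j
      equation j = begin
        lookup v′ j ℤ.+ Vec.map (rhs A b) as · lookup N j
          ≡⟨ cong₂ ℤ._+_ (lookup∘tabulate _ j) (cong₂ _·_ (sym (tabulate-∘ (rhs A b) (λ i → rowOf (is i)))) (lookup∘tabulate _ j)) ⟩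
        σ ℤ.* v j ℤ.+ tabulate (λ i → β (is i)) · tabulate (λ i → σ ℤ.* cs i j)
          ≡⟨ cong (λ z → σ ℤ.* v j ℤ.+ z) (trans (·-tabulate (tabulate (λ i → β (is i))) (λ i → σ ℤ.* cs i j))
               (∑-cong (λ i → cong (ℤ._* (σ ℤ.* cs i j)) (lookup∘tabulate (λ i → β (is i)) i)))) ⟩
        σ ℤ.* v j ℤ.+ dot (λ i → β (is i)) (λ i → σ ℤ.* cs i j)
          ≡⟨ cong (λ z → σ ℤ.* v j ℤ.+ z) (dot-* (λ i → β (is i)) σ (λ i → cs i j)) ⟩
        σ ℤ.* v j ℤ.+ σ ℤ.* C ≡⟨ shuffle σ (v j) C ⟩
        σ ℤ.* (v j ℤ.+ (C ℤ.+ 0ℤ)) ≡⟨ cong (σ ℤ.*_) (sym (eq j)) ⟩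
        σ ℤ.* (d ℤ.* x j) ≡⟨ sym (ℤₚ.*-assoc σ d (x j)) ⟩
        σ ℤ.* d ℤ.* x j ≡⟨ cong₂ ℤ._*_ σd≡∣d∣ (sym (lookup∘tabulate x j)) ⟩
        + ∣ d ∣ ℤ.* lookup (tabulate x) j ∎
        where
        open ≡-Reasoning
        C : ℤ
        C = dot (λ i → β (is i)) (λ i → cs i j)
        shuffle : ∀ s v c → s ℤ.* v ℤ.+ s ℤ.* c ≡ s ℤ.* (v ℤ.+ (c ℤ.+ 0ℤ))
        shuffle = ℤ-Ring.solve-∀

    -- For a fixed `lb` the descent can be run to its end, so no decision whether the instance is
    -- unbounded is involved. The fuel is the distance from the objective of `y` to `lb`.
    dichotomy : ∀ lb y → Feasible I y → (∃[ z ] (Feasible I (tabulate z) × obj z ℤ.≤ lb)) ⊎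
                (∃[ z ] (IsCandidate (tabulate z) × Feasible I (tabulate z) × obj z ℤ.≤ obj (lookup y)))
    dichotomy lb y f with descend B 2≤B n≤B α≤B lb ∣ obj (lookup y) ℤ.- lb ∣ (lookup y) (feasible⇒feas y f)
                            (ℤₚ.≤-trans (ℤₚ.≤-reflexive (restore (obj (lookup y)) lb)) (ℤₚ.+-monoʳ-≤ lb (i≤∣i∣ _)))
      where
      restore : ∀ o l → o ≡ l ℤ.+ (o ℤ.- l)
      restore = ℤ-Ring.solve-∀
    ... | inj₁ (z , fz , o)      = inj₁ (z , feas⇒feasible z fz , o)
    ... | inj₂ (z , fz , o , st) = inj₂ (z , state⇒candidate z st , feas⇒feasible z fz , o)

  objective-lookup : ∀ y → objective I y ≡ dot (lookup y) (λ i → dot (lookup (lookup Q i)) (lookup y))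
  objective-lookup y = trans (·-dot y (Q *ᵥ y)) (∑-cong (λ i → cong (lookup y i ℤ.*_) (trans (lookup-map i (_· y) Q) (·-dot (lookup Q i) y))))

  objective-tabulate : ∀ x → objective I (tabulate x) ≡ dot x (λ i → dot (lookup (lookup Q i)) x)
  objective-tabulate x = trans (objective-lookup (tabulate x)) (∑-cong (λ i →
    cong₂ ℤ._*_ (lookup∘tabulate x i) (∑-cong (λ j → cong (lookup (lookup Q i) j ℤ.*_) (lookup∘tabulate x j)))))

  -- Feasibility is optimality for the zero objective.
  feasible-candidate : HasFeasible I → ∃[ x ] (IsCandidate x × Feasible I x)
  feasible-candidate (y , f) with dichotomy (λ _ _ → 0ℤ) (λ _ _ → refl) (λ _ _ → z≤n) -1ℤ y f
  ... | inj₂ (z , c , fz , _) = tabulate z , c , fz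
  ... | inj₁ (z , _ , o) with subst (ℤ._≤ -1ℤ) (vanish z) o
    where
    vanish : ∀ z → dot z (λ _ → dot (λ _ → 0ℤ) z) ≡ 0ℤ
    vanish z = trans (∑-cong (λ i → trans (cong (z i ℤ.*_) (trans (∑-cong (λ j → ℤₚ.*-zeroˡ (z j))) (∑-0 n))) (ℤₚ.*-zeroʳ (z i)))) (∑-0 n)
  ... | ()

  module _ (x : Vec ℤ n) (best : ∀ y → IsCandidate y → Improves I x y) where

    best-feasible : HasFeasible I → Feasible I x
    best-feasible h = let y , c , f = feasible-candidate h in proj₁ (best y c f)

    -- Suppose a feasible `y` beats `x`. No candidate is as good as `y`, so for every `lb` the
    -- dichotomy must return a point below `lb`, and the instance is unbounded. The comparison is
    -- decidable, hence stable under double negation.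
    best-optimal : HasFeasible I → ¬ Unbounded I → Optimal I x
    best-optimal h bounded = best-feasible h , λ y f → decidable-stable (objective I x ℤ.≤? objective I y)
      (λ x≰y → bounded (λ lb → descent lb y f x≰y (dichotomy (λ i j → lookup (lookup Q i) j) Q-sym Q≤α lb y f)))
      where
      descent : ∀ lb y → Feasible I y → ¬ (objective I x ℤ.≤ objective I y) → _ → ∃[ z ] (Feasible I z × objective I z ℤ.≤ lb)
      descent lb y f x≰y (inj₁ (z , fz , o)) = tabulate z , fz , ℤₚ.≤-trans (ℤₚ.≤-reflexive (objective-tabulate z)) o
      descent lb y f x≰y (inj₂ (z , c , fz , o)) = ⊥-elim (x≰y (ℤₚ.≤-trans (proj₂ (best (tabulate z) c fz))
        (ℤₚ.≤-trans (ℤₚ.≤-reflexive (objective-tabulate z)) (ℤₚ.≤-trans o (ℤₚ.≤-reflexive (sym (objective-lookup y)))))))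

-- The time bound

size-bits : ∀ bs → size (encodeList encodeBool bs) ≡ List.length bs
size-bits []           = refl
size-bits (false ∷ bs) = cong suc (size-bits bs)
size-bits (true ∷ bs)  = cong suc (size-bits bs)

size-encodeℤ : ∀ z → size (encodeℤ z) ≡ sizeℤ z
size-encodeℤ (+ k)    = cong suc (size-bits (bits k))
size-encodeℤ -[1+ k ] = cong suc (size-bits (bits (suc k)))

size-encodeVec : ∀ {n} (v : Vec ℤ n) → size (encodeVec v) ≡ sizeVec v
size-encodeVec []      = refl
size-encodeVec (z ∷ v) = cong₂ _+_ (cong (1 ⊔_) (size-encodeℤ z)) (size-encodeVec v)

-- Each row of a matrix costs at least one node, even an empty one, which L does not count.
size-encodeMatrix : ∀ {k n} (M : Matrix k n) → size (encodeMatrix M) ≤ k + sizeMatrix M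
size-encodeMatrix [] = z≤n
size-encodeMatrix {suc k} (u ∷ M) = ≤-trans
  (+-mono-≤ (≤-trans (m⊔n≤m+n 1 (size (encodeVec u))) (+-monoʳ-≤ 1 (≤-reflexive (size-encodeVec u)))) (size-encodeMatrix M))
  (≤-reflexive (shuffle (sizeVec u) k (sizeMatrix M)))
  where
  shuffle : ∀ u k m → 1 + u + (k + m) ≡ 1 + k + (u + m)
  shuffle = solve-∀

size-encodeSquare : ∀ {n} (M : Matrix n n) → size (encodeMatrix M) ≤ sizeMatrix M
size-encodeSquare {zero}  [] = z≤n
size-encodeSquare {suc n} M  = ≤-reflexive (nonempty M)
  where
  nonempty : ∀ {k} (M : Matrix k (suc n)) → size (encodeMatrix M) ≡ sizeMatrix M
  nonempty []            = refl
  nonempty ((z ∷ u) ∷ M) = cong₂ _+_ (cong (1 ⊔_) (size-encodeVec (z ∷ u))) (nonempty M)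

length≤sizeVec : ∀ {k} (v : Vec ℤ k) → k ≤ sizeVec v
length≤sizeVec []      = z≤n
length≤sizeVec (z ∷ v) = s≤s (≤-trans (length≤sizeVec v) (m≤n+m (sizeVec v) (sizeℕ ∣ z ∣)))

1≤sizeℕ : ∀ k → 1 ≤ sizeℕ k
1≤sizeℕ k = sizeℕ-mono (z≤n {k})

-- The 1 accounts for the empty row, whose maximum 0 has a numeral of one digit.
sizeℕ-maxRow : ∀ {n} (u : Vec ℤ n) → sizeℕ (maxRow u) ≤ 1 + sizeVec u
sizeℕ-maxRow []      = ≤-refl
sizeℕ-maxRow (z ∷ u) = ≤-trans (≤-reflexive (sizeℕ-⊔ ∣ z ∣ (maxRow u)))
  (⊔-lub (≤-trans (m≤n+m (sizeℕ ∣ z ∣) 2) (+-monoʳ-≤ 2 (m≤m+n (sizeℕ ∣ z ∣) (sizeVec u))))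
         (≤-trans (sizeℕ-maxRow u) (+-monoʳ-≤ 1 (m≤n+m (sizeVec u) (sizeℤ z)))))

sizeℕ-maxAbs : ∀ {k n} (M : Matrix k n) → sizeℕ (maxAbs M) ≤ 1 + sizeMatrix M
sizeℕ-maxAbs []      = ≤-refl
sizeℕ-maxAbs (u ∷ M) = ≤-trans (≤-reflexive (sizeℕ-⊔ (maxRow u) (maxAbs M)))
  (⊔-lub (≤-trans (sizeℕ-maxRow u) (+-monoʳ-≤ 1 (m≤m+n (sizeVec u) (sizeMatrix M))))
         (≤-trans (sizeℕ-maxAbs M) (+-monoʳ-≤ 1 (m≤n+m (sizeMatrix M) (sizeVec u)))))

module _ {n m} (I : Instance n m) where
  open Instance I
  private
    q a r : ℕ
    q = sizeMatrix Q
    a = sizeMatrix A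
    r = sizeVec b

  2≤L : 2 ≤ L I
  2≤L = ≤-trans (+-mono-≤ (1≤sizeℕ n) (1≤sizeℕ m))
    (≤-trans (m≤m+n (sizeℕ n + sizeℕ m) q) (≤-trans (m≤m+n _ a) (m≤m+n _ r)))

  sizeℕ-n≤L : sizeℕ n ≤ L I
  sizeℕ-n≤L = ≤-trans (m≤m+n (sizeℕ n) (sizeℕ m)) (≤-trans (m≤m+n _ q) (≤-trans (m≤m+n _ a) (m≤m+n _ r)))

  sizeℕ-α≤L : sizeℕ (α I) ≤ 1 + L I
  sizeℕ-α≤L = ≤-trans (≤-reflexive (sizeℕ-⊔ (maxAbs Q) (maxAbs A)))
    (⊔-lub (≤-trans (sizeℕ-maxAbs Q) (s≤s (≤-trans (m≤n+m q _) (≤-trans (m≤m+n _ a) (m≤m+n _ r)))))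
           (≤-trans (sizeℕ-maxAbs A) (s≤s (≤-trans (m≤n+m a _) (m≤m+n _ r)))))

  -- For `n = 0` the `m` empty rows of `A` occupy nodes without containing bits; the entries of `b`,
  -- at least one bit each, pay for them.
  size-encode : size (encode I) ≤ 4 + 2 * L I
  size-encode = ≤-trans (cell (encodeℕ n) (encodeℕ m ∙ encodeMatrix Q ∙ encodeMatrix A ∙ encodeVec b)
    (≤-reflexive (size-bits (bits n)))
    (cell (encodeℕ m) (encodeMatrix Q ∙ encodeMatrix A ∙ encodeVec b) (≤-reflexive (size-bits (bits m)))
    (cell (encodeMatrix Q) (encodeMatrix A ∙ encodeVec b) (size-encodeSquare Q)
    (cell (encodeMatrix A) (encodeVec b) (≤-trans (size-encodeMatrix A) (+-monoˡ-≤ a (length≤sizeVec b)))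
          (≤-reflexive (size-encodeVec b))))))
    (≤-trans (m≤m+n _ (sizeℕ n + sizeℕ m + q + a)) (≤-reflexive (shuffle (sizeℕ n) (sizeℕ m) q a r)))
    where
    cell : ∀ s t {x y} → size s ≤ x → size t ≤ y → size (s ∙ t) ≤ suc (x + y)
    cell s t p p′ = ≤-trans (size-∙ s t) (s≤s (+-mono-≤ p p′))
    shuffle : ∀ x y q a r → suc (x + suc (y + suc (q + suc (r + a + r)))) + (x + y + q + a) ≡ 4 + 2 * (x + y + q + a + r)
    shuffle = solve-∀

env₂ : Tree → Tree → Vec Tree 2
env₂ x y = x ∷ y ∷ []

QP AP bP : PTm 1
QP = hdP (tlP (tlP v0))
AP = hdP (tlP (tlP (tlP v0)))
bP = tlP (tlP (tlP (tlP v0)))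

lengthQP alphaQAP : PTm 1
lengthQP = callP lengthP (QP ∷ [])
alphaQAP = callP alphaP (QP ∷ AP ∷ [])

opaque
  solveT : Tm 1
  solveT = call (tm bestP) (tm QP ∷ tm AP ∷ tm bP ∷ call enumerateT (tm lengthQP ∷ tm alphaQAP ∷ []) ∷ [])

solver : Program
solver = record { extraVars = 1 ; body = X′ := cons xE nil ⨾ compile solveT }

opaque
  -- Repeats the enumeration from n and α alone; its running time governs the
  -- parameter-dependent factor of the time bound.
  enumerateBinaryT : Tm 1
  enumerateBinaryT = call enumerateT (call fromBinaryT (hd x0 ∷ []) ∷ call (tm lengthP) (tl x0 ∷ []) ∷ [])

τ : ℕ → ℕ → ℕ
τ n a = time enumerateBinaryT ((encodeℕ n ∙ encodeℕ a) ∷ [])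

private
  enumerateBinary-args : ∀ n a →
    ⟦ fromBinaryT ⟧ (encodeℕ n ∷ []) ∷ ⟦ lengthP ⟧ₚ (encodeℕ a ∷ []) ∷ [] ≡ unary n ∷ unary (sizeℕ a) ∷ []
  enumerateBinary-args n a = cong₂ env₂
    (trans (fromBinary-val (encodeℕ n)) (cong unary (val-encodeℕ n))) (length-list encodeBool (bits a))

opaque
  unfolding enumerateBinaryT

  enumerateBinary-value : ∀ n a → ⟦ enumerateBinaryT ⟧ ((encodeℕ n ∙ encodeℕ a) ∷ []) ≡ ⟦ enumerateT ⟧ (unary n ∷ unary (sizeℕ a) ∷ [])
  enumerateBinary-value n a = cong ⟦ enumerateT ⟧ (enumerateBinary-args n a)

  -- `time` depends only on the term and its environment. The solver and `enumerateBinaryT` derive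
  -- the unary arguments in different ways but call `enumerateT` on the same trees.
  time-enumerate : ∀ n a → time enumerateT (unary n ∷ unary (sizeℕ a) ∷ []) ≤ τ n a
  time-enumerate n a = ≤-trans (≤-reflexive (cong (time enumerateT) (sym (enumerateBinary-args n a))))
    (m≤n+m (time enumerateT (⟦ fromBinaryT ⟧ (encodeℕ n ∷ []) ∷ ⟦ lengthP ⟧ₚ (encodeℕ a ∷ []) ∷ []))
           (time* (call fromBinaryT (hd x0 ∷ []) ∷ call (tm lengthP) (tl x0 ∷ []) ∷ []) ((encodeℕ n ∙ encodeℕ a) ∷ [])))

size-⟦⟧ : ∀ {k} (t : Tm k) ρ → size (⟦ t ⟧ ρ) ≤ 2 ^ time t ρ * suc (size (envTree ρ) + 0)
size-⟦⟧ t ρ = ≤-trans (≤-trans (m≤m+n (size (⟦ t ⟧ ρ)) 0) (n≤1+n _)) (growth (run t ρ nil))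

-- The candidates are never counted: the running time already bounds the size of what is built,
-- through `growth`.
size-enumerate : ∀ n a → size (⟦ enumerateT ⟧ (unary n ∷ unary (sizeℕ a) ∷ [])) ≤ 2 ^ τ n a * (3 + (sizeℕ n + sizeℕ a))
size-enumerate n a =
  ≤-trans (≤-reflexive (cong size (sym (enumerateBinary-value n a))))
  (≤-trans (size-⟦⟧ enumerateBinaryT (input ∷ [])) (*-monoʳ-≤ (2 ^ τ n a) (s≤s input-size)))
  where
  input : Tree
  input = encodeℕ n ∙ encodeℕ a
  input-size : size (input ∙ nil) + 0 ≤ 2 + (sizeℕ n + sizeℕ a)
  input-size = ≤-trans (≤-reflexive (+-identityʳ (size (input ∙ nil)))) (≤-trans (size-∙ input nil)
    (s≤s (≤-trans (≤-reflexive (+-identityʳ (size input))) (≤-trans (size-∙ (encodeℕ n) (encodeℕ a))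
      (s≤s (≤-reflexive (cong₂ _+_ (size-bits (bits n)) (size-bits (bits a)))))))))

-- Numerals start with the least significant bit, so prepending `nil` doubles a positive number.
ticks-encode : ∀ k → ticks k (encodeℕ 1) ≡ encodeℕ (2 ^ k)
ticks-encode zero    = refl
ticks-encode (suc k) = trans (cong (nil ∙_) (ticks-encode k)) (sym (encode-double (2 ^ k) (m^n>0 2 k)))
  where
  encode-double : ∀ j → 0 < j → encodeℕ (2 * j) ≡ nil ∙ encodeℕ j
  encode-double (suc j) _ = cong (encodeList encodeBool) (bits-even j)

clock-computable : ∀ C → Computable₂ (λ n a → 2 ^ (C * τ n a))
clock-computable C = record { extraVars = 2 ; body = body } , λ n a →
  let u , p = clock-run (run enumerateBinaryT ((encodeℕ n ∙ encodeℕ a) ∷ []) nil) (encodeℕ 1)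
  in 4 + (6 + u) , ticks (C * τ n a) (encodeℕ 1) ∷ ⟦ enumerateBinaryT ⟧ ((encodeℕ n ∙ encodeℕ a) ∷ []) ∷ nil ∷ [] ,
     ⇓-seq ⇓-assign (⇓-seq ⇓-assign p) , ticks-encode (C * τ n a)
  where
  open Clock C
  body : Cmd 3
  -- The input moves from variable 0 into the environment in variable 1; variable 0 then becomes the
  -- clock, starting from the numeral of 1, and is the output.
  body = suc zero := cons (var zero) nil ⨾ zero := cons (cons nil nil) nil ⨾ clock (compile enumerateBinaryT)

overheadTime : Vec Tree 1 → ℕ
-- Six argument pairings at 21 steps, two empty argument lists at 2, and the initial assignment of
-- the solver at 4.
overheadTime ρ = 134 + (time (tm QP) ρ + (time (tm AP) ρ + (time (tm bP) ρ + (time (tm lengthQP) ρ + time (tm alphaQAP) ρ))))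

opaque
  overhead-poly : PolyBounded overheadTime
  overhead-poly = pb-+ (pb-const 134) (pb-+ (timeP QP) (pb-+ (timeP AP) (pb-+ (timeP bP) (pb-+ (timeP lengthQP) (timeP alphaQAP)))))

module _ {n m} (I : Instance n m) where
  open Instance I
  open Candidates I

  private
    args≡ : ⟦ lengthP ⟧ₚ (encodeMatrix Q ∷ []) ∷ ⟦ alphaP ⟧ₚ (encodeMatrix Q ∷ encodeMatrix A ∷ []) ∷ [] ≡ unary n ∷ unary ℓ ∷ []
    args≡ = cong₂ env₂ (length-matrix Q) (alpha-unary I)

    bestEnv : Vec Tree 4
    bestEnv = encodeMatrix Q ∷ encodeMatrix A ∷ encodeVec b ∷ enumeration ∷ []

  opaque
    unfolding solveT

    solveT-value : ⟦ solveT ⟧ (encode I ∷ []) ≡ ⟦ bestP ⟧ₚ bestEnv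
    solveT-value = cong (λ ρ → ⟦ bestP ⟧ₚ (encodeMatrix Q ∷ encodeMatrix A ∷ encodeVec b ∷ ⟦ enumerateT ⟧ ρ ∷ [])) args≡
  
    solveT-time : 4 + time solveT (encode I ∷ []) ≡ overheadTime (encode I ∷ []) +
                  (time enumerateT (unary n ∷ unary ℓ ∷ []) + time (tm bestP) bestEnv)
    solveT-time = trans
      (cong (λ ρ → 4 + (pairTime (T QP) (pairTime (T AP) (pairTime (T bP)
               (pairTime (pairTime (T lengthQP) (pairTime (T alphaQAP) 2) + time enumerateT ρ) 2)))
               + time (tm bestP) (encodeMatrix Q ∷ encodeMatrix A ∷ encodeVec b ∷ ⟦ enumerateT ⟧ ρ ∷ []))) args≡)
      (shuffle (T QP) (T AP) (T bP) (T lengthQP) (T alphaQAP) (time enumerateT (unary n ∷ unary ℓ ∷ [])) (time (tm bestP) bestEnv))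
      where
      T : PTm 1 → ℕ
      T t = time (tm t) (encode I ∷ [])
      -- The left-hand side is the nested pairTime above, unfolded because the solver does not do so.
      shuffle : ∀ q a b l α e t →
        4 + ((4 + (q + (4 + (4 + ((4 + (a + (4 + (4 + ((4 + (b + (4 + (4 +
          ((4 + (((4 + (l + (4 + (4 + ((4 + (α + (4 + (4 + (2 + 9))))) + 9))))) + e) + (4 + (4 + (2 + 9)))))
          + 9))))) + 9))))) + 9))))) + t)
        ≡ 134 + (q + (a + (b + (l + α)))) + (e + t)
      shuffle = solve-∀

c₁ c₂ : ℕ
c₁ = PolyBounded.degree overhead-poly
c₂ = PolyBounded.degree (timeP bestP)

^-distribʳ-* : ∀ k x y → (x * y) ^ k ≡ x ^ k * y ^ k
^-distribʳ-* zero    x y = refl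
^-distribʳ-* (suc k) x y = trans (cong (x * y *_) (^-distribʳ-* k x y)) (interchange x y (x ^ k) (y ^ k))
  where
  interchange : ∀ a b c d → a * b * (c * d) ≡ a * c * (b * d)
  interchange = solve-∀

module _ (ℓ t : ℕ) (2≤ℓ : 2 ≤ ℓ) where
  private
    instance
      ℓ≢0 = >-nonZero (≤-trans (s≤s z≤n) 2≤ℓ)
      2^≢0 = m^n≢0 2 t

    -- Constants are absorbed as powers of ℓ ≥ 2.
    absorb : ∀ k → 2 ^ k ≤ ℓ ^ k
    absorb k = ^-monoˡ-≤ k 2≤ℓ

  linear≤power : 2 + (4 + 2 * ℓ) ≤ ℓ ^ 4
  linear≤power = ≤-trans (+-monoˡ-≤ (2 * ℓ) (*-monoʳ-≤ 3 2≤ℓ))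
    (≤-trans (≤-reflexive (sym (*-distribʳ-+ ℓ 3 2))) (≤-trans (*-monoˡ-≤ ℓ (≤-trans (m≤m+n 5 3) (absorb 3))) (≤-reflexive (*-comm (ℓ ^ 3) ℓ))))

  enumeration≤power : ∀ x y z s → x ≤ 4 + 2 * ℓ → y ≤ 4 + 2 * ℓ → z ≤ 4 + 2 * ℓ → s ≤ 2 ^ t * (3 + (ℓ + (1 + ℓ))) →
                      2 + (x + (y + (z + (s + 0)))) ≤ 2 ^ t * ℓ ^ 6
  enumeration≤power x y z s px py pz ps = begin
    2 + (x + (y + (z + (s + 0)))) ≤⟨ +-monoʳ-≤ 2 (+-mono-≤ px (+-mono-≤ py (+-mono-≤ pz (+-monoˡ-≤ 0 ps)))) ⟩
    2 + (u + (u + (u + (2 ^ t * w + 0)))) ≡⟨ shuffle u (2 ^ t * w) ⟩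
    (2 + 3 * u) + 2 ^ t * w ≤⟨ +-monoˡ-≤ (2 ^ t * w) (m≤n*m (2 + 3 * u) (2 ^ t)) ⟩
    2 ^ t * (2 + 3 * u) + 2 ^ t * w ≡⟨ sym (*-distribˡ-+ (2 ^ t) (2 + 3 * u) w) ⟩
    2 ^ t * (2 + 3 * u + w) ≡⟨ cong (2 ^ t *_) (collect ℓ) ⟩
    2 ^ t * (9 * 2 + 8 * ℓ) ≤⟨ *-monoʳ-≤ (2 ^ t) (+-monoˡ-≤ (8 * ℓ) (*-monoʳ-≤ 9 2≤ℓ)) ⟩
    2 ^ t * (9 * ℓ + 8 * ℓ) ≡⟨ cong (2 ^ t *_) (sym (*-distribʳ-+ ℓ 9 8)) ⟩
    2 ^ t * (17 * ℓ) ≤⟨ *-monoʳ-≤ (2 ^ t) (*-monoˡ-≤ ℓ (≤-trans (m≤m+n 17 15) (absorb 5))) ⟩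
    2 ^ t * (ℓ ^ 5 * ℓ) ≡⟨ cong (2 ^ t *_) (*-comm (ℓ ^ 5) ℓ) ⟩
    2 ^ t * ℓ ^ 6 ∎
    where
    open ≤-Reasoning
    u w : ℕ
    u = 4 + 2 * ℓ
    w = 3 + (ℓ + (1 + ℓ))
    shuffle : ∀ u w → 2 + (u + (u + (u + (w + 0)))) ≡ 2 + 3 * u + w
    shuffle = solve-∀
    collect : ∀ l → 2 + 3 * (4 + 2 * l) + (3 + (l + (1 + l))) ≡ 9 * 2 + 8 * l
    collect = solve-∀

  -- The scan of the candidates is polynomial of degree `b` in a size that contains the factor
  -- `2 ^ t`, and the enumeration itself takes at most `t < 2 ^ t` steps; together they need the
  -- exponent `suc b * t`. The factor 3 for the three summands goes into `ℓ ^ 2`.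
  total≤power : ∀ x y z a b → x ≤ (ℓ ^ 4) ^ a → y ≤ t → z ≤ (2 ^ t * ℓ ^ 6) ^ b →
                x + (y + z) ≤ 2 ^ (suc b * t) * ℓ ^ (2 + (4 * a + 6 * b))
  total≤power x y z a b px py pz = begin
    x + (y + z) ≤⟨ +-mono-≤ (≤-trans px (≤-reflexive (^-*-assoc ℓ 4 a)))
                     (+-mono-≤ (≤-trans py (<⇒≤ (n<2^n t))) (≤-trans pz (≤-reflexive expand))) ⟩
    p + (2 ^ t + e * q) ≤⟨ +-mono-≤ bound₁ (+-mono-≤ bound₂ bound₃) ⟩
    2 ^ t * e * (p * q) + (2 ^ t * e * (p * q) + 2 ^ t * e * (p * q)) ≡⟨ triple (2 ^ t * e * (p * q)) ⟩
    3 * (2 ^ t * e * (p * q)) ≤⟨ *-monoˡ-≤ (2 ^ t * e * (p * q)) (≤-trans (n≤1+n 3) (absorb 2)) ⟩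
    ℓ ^ 2 * (2 ^ t * e * (p * q)) ≡⟨ regroup (ℓ ^ 2) (2 ^ t * e) (p * q) ⟩
    2 ^ t * e * (ℓ ^ 2 * (p * q)) ≡⟨ cong₂ _*_ (trans (sym (^-distribˡ-+-* 2 t (t * b))) (cong (λ k → 2 ^ (t + k)) (*-comm t b)))
                                              (trans (cong (ℓ ^ 2 *_) (sym (^-distribˡ-+-* ℓ (4 * a) (6 * b)))) (sym (^-distribˡ-+-* ℓ 2 (4 * a + 6 * b)))) ⟩
    2 ^ (suc b * t) * ℓ ^ (2 + (4 * a + 6 * b)) ∎
    where
    open ≤-Reasoning
    p q e : ℕ
    p = ℓ ^ (4 * a)
    q = ℓ ^ (6 * b)
    e = 2 ^ (t * b)
    expand : (2 ^ t * ℓ ^ 6) ^ b ≡ e * q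
    expand = trans (^-distribʳ-* b (2 ^ t) (ℓ ^ 6)) (cong₂ _*_ (^-*-assoc 2 t b) (^-*-assoc ℓ 6 b))
    instance
      p≢0 = m^n≢0 ℓ (4 * a)
      q≢0 = m^n≢0 ℓ (6 * b)
      e≢0 = m^n≢0 2 (t * b)
      te≢0 = m*n≢0 (2 ^ t) e
      pq≢0 = m*n≢0 p q
    bound₁ : p ≤ 2 ^ t * e * (p * q)
    bound₁ = ≤-trans (m≤m*n p q) (m≤n*m (p * q) (2 ^ t * e))
    bound₂ : 2 ^ t ≤ 2 ^ t * e * (p * q)
    bound₂ = ≤-trans (m≤m*n (2 ^ t) e) (m≤m*n (2 ^ t * e) (p * q))
    bound₃ : e * q ≤ 2 ^ t * e * (p * q)
    bound₃ = *-mono-≤ (m≤n*m e (2 ^ t)) (m≤n*m q p)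
    triple : ∀ x → x + (x + x) ≡ 3 * x
    triple = solve-∀
    regroup : ∀ x y z → x * (y * z) ≡ y * (x * z)
    regroup = solve-∀

solver-time : ∀ {n m} (I : Instance n m) →
              4 + time solveT (encode I ∷ []) ≤ 2 ^ (suc c₂ * τ n (α I)) * L I ^ (2 + (4 * c₁ + 6 * c₂))
solver-time {n} {m} I = ≤-trans (≤-reflexive (solveT-time I))
  (total≤power (L I) (τ n (α I)) (2≤L I) _ _ _ c₁ c₂
    (≤-trans (PolyBounded.bound overhead-poly (encode I ∷ []))
      (^-monoˡ-≤ c₁ (≤-trans (+-monoʳ-≤ 2 (≤-trans (≤-reflexive (+-identityʳ (size (encode I)))) (size-encode I)))
                              (linear≤power (L I) (τ n (α I)) (2≤L I)))))
    (time-enumerate n (α I))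
    (≤-trans (PolyBounded.bound (timeP bestP) bestEnv)
      (^-monoˡ-≤ c₂ (enumeration≤power (L I) (τ n (α I)) (2≤L I)
        (size (encodeMatrix Q)) (size (encodeMatrix A)) (size (encodeVec b)) (size enumeration)
        (part (≤-trans (size-head (tail (tail (encode I)))) (size-tail² (encode I))))
        (part (≤-trans (size-head (tail (tail (tail (encode I)))))
                       (≤-trans (size-tail (tail (tail (encode I)))) (size-tail² (encode I)))))
        (part (≤-trans (size-tail² (tail (tail (encode I)))) (size-tail² (encode I))))
        (≤-trans (size-enumerate n (α I)) (*-monoʳ-≤ (2 ^ τ n (α I)) (+-monoʳ-≤ 3 (+-mono-≤ (sizeℕ-n≤L I) (sizeℕ-α≤L I)))))))))
  where
  open Instance I
  open Candidates I
  bestEnv : Vec Tree 4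
  bestEnv = encodeMatrix Q ∷ encodeMatrix A ∷ encodeVec b ∷ enumeration ∷ []
  part : ∀ {k} → k ≤ size (encode I) → k ≤ 4 + 2 * L I
  part p = ≤-trans p (size-encode I)
  size-tail² : ∀ t → size (tail (tail t)) ≤ size t
  size-tail² t = ≤-trans (size-tail (tail t)) (size-tail t)

theorem1 : Σ[ p ∈ Program ] Σ[ f ∈ (ℕ → ℕ → ℕ) ] Σ[ c ∈ ℕ ]
    (Computable₂ f ×
    (∀ {n m} (I : Instance n m) →
    Σ[ x ∈ Vec ℤ n ]
    (RunsWithin p (encode I) (encodeVec x) (f n (α I) * L I ^ c) ×
    (HasFeasible I → Feasible I x) ×
    (HasFeasible I → ¬ Unbounded I → Optimal I x))))
theorem1 = solver , (λ n a → 2 ^ (suc c₂ * τ n a)) , 2 + (4 * c₁ + 6 * c₂) , clock-computable (suc c₂) , λ I →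
  let x , e , improves = best-improves I (Candidates.enumeration I)
      best = λ y (c : Candidates.IsCandidate I y) → improves (proj₁ c) (proj₁ (proj₂ c)) y (proj₂ (proj₂ c))
  in x ,
     (_ , solver-time I , _ , ⇓-seq ⇓-assign (run solveT (encode I ∷ []) nil) , trans (solveT-value I) e) ,
     Candidates.best-feasible I x best , Candidates.best-optimal I x best
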